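{- There is a universal constant $c>0$ such that for every finite abelian group $\mathcal{G}$ of size $N$ and every $\alpha\in(0,1]$, $$N(\alpha;\mathcal{L}(\mathcal{G}))\ge c\,\frac{\log N}{\log(4/\alpha)}.$$ In particular, $N^*(\mathcal{L}(\mathcal{G}))=\Omega(\log N)$ and $\min_{\alpha\in(0,1]}\frac{N(\alpha;\mathcal{L}(\mathcal{G}))}{\alpha}=\Omega(\log N)$, with universal implied constants.
   Context: For a finite group $\mathcal{G}$ and $g\in\mathcal{G}$ let $\mathscr{R}(g)$ be the right regular representation on $\mathbb{R}\mathcal{G}$, $\mathscr{R}(g)(\sum_h\alpha_hh)=\sum_h\alpha_h\,hg$, and $L_g=\mathrm{Id}-\frac12(\mathscr{R}(g)+\mathscr{R}(g)^*)$, a positive semidefinite (PSD) operator; $\mathcal{L}(\mathcal{G})=\{L_g\}_{g\in\mathcal{G}}$. $A\preceq B$ means $B-A$ is PSD. Connectivity parameter: for a finite family $\mathcal{A}=\{A_i\}_{i\in I}$ of PSD matrices and $\alpha\ge0$, $N(\alpha;\mathcal{A})$ is the smallest integer such that for every $T\subseteq I$ with $|T|\ge N(\alpha;\mathcal{A})$ there exists $i\in T$ with $\alpha A_i\preceq\sum_{j\in T\setminus\{i\}}A_j$; if no such integer (at most $|I|$) exists, $N(\alpha;\mathcal{A})=|I|+1$. The connectivity threshold is $N^*(\mathcal{A})=N(\alpha_{1/2};\mathcal{A})$ with $\alpha_{1/2}=(\sqrt{7/3}-1)/2$. -}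

module Defs where

open import Level using (0ℓ)
open import Algebra.Bundles using (CommutativeRing; Group)
open import Algebra.Definitions using (Commutative)
import Algebra.Definitions.RawMonoid as RawMonoid
import Algebra.Solver.Ring.NaturalCoefficients.Default as Solver
open import Data.Bool.Base using (if_then_else_)
open import Data.Empty using (⊥-elim)
open import Data.Fin.Base using (Fin)
import Data.Fin.Properties as Fin
open import Data.Fin.Subset using (Subset; ∣_∣; _∈_) renaming (_-_ to _∖_)
open import Data.Fin.Subset.Properties using (_∈?_; anySubset?)
open import Data.Nat.Base as ℕ using (ℕ; zero; suc)
import Data.Nat.Properties as ℕ
open import Data.Product.Base using (∃; _×_; _,_; proj₁; proj₂)
open import Data.Sum.Base using (_⊎_; inj₁; inj₂)
open import Function.Bundles using (Inverse)
open import Relation.Binary.Bundles using (StrictTotalOrder)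
open import Relation.Binary.Core using (Rel)
open import Relation.Binary.Definitions using (tri<; tri≈; tri>)
import Relation.Binary.PropositionalEquality as ≡
import Relation.Binary.Properties.StrictTotalOrder as STO
open import Relation.Binary.Structures using (IsStrictTotalOrder)
open import Relation.Nullary using (Dec; yes; no; ¬_; does)
open import Relation.Nullary.Decidable using (_×-dec_; _→-dec_; map′; decidable-stable; ¬?)
open import Relation.Unary using (Pred; Decidable)

-- The real numbers, axiomatised as in classical analysis: a Dedekind-complete
-- ordered field, unique up to isomorphism.  The inverse is a total function
-- whose value at 0 is unspecified.
record CompleteOrderedField : Set₁ where
  infix  8 _⁻¹
  infixl 7 _/_
  infix  4 _<_ _≤_
  field
    commutativeRing : CommutativeRing 0ℓ 0ℓ

  open CommutativeRing commutativeRing public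
    renaming (Carrier to ℝ)

  field
    _<_                : Rel ℝ 0ℓ
    isStrictTotalOrder : IsStrictTotalOrder _≈_ _<_
    0<1                : 0# < 1#
    +-monoʳ-<          : ∀ x {y z} → y < z → x + y < x + z
    *-pos              : ∀ {x y} → 0# < x → 0# < y → 0# < x * y
    _⁻¹                : ℝ → ℝ
    ⁻¹-cong            : ∀ {x y} → x ≈ y → x ⁻¹ ≈ y ⁻¹
    ⁻¹-inverseʳ        : ∀ {x} → x ≉ 0# → x * x ⁻¹ ≈ 1#

  _≤_ : Rel ℝ 0ℓ
  x ≤ y = (x < y) ⊎ (x ≈ y)

  IsUpperBound : Pred ℝ 0ℓ → ℝ → Set
  IsUpperBound P u = ∀ x → P x → x ≤ u

  IsLUB : Pred ℝ 0ℓ → ℝ → Set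
  IsLUB P s = IsUpperBound P s × (∀ u → IsUpperBound P u → s ≤ u)

  field
    completeness : (P : Pred ℝ 0ℓ) → ∃ P → ∃ (IsUpperBound P) → ∃ (IsLUB P)

  _/_ : ℝ → ℝ → ℝ
  x / y = x * y ⁻¹

  fromℕ : ℕ → ℝ
  fromℕ n = RawMonoid._×_ +-rawMonoid n 1#

  strictTotalOrder : StrictTotalOrder 0ℓ 0ℓ 0ℓ
  strictTotalOrder = record { isStrictTotalOrder = isStrictTotalOrder }

module Analysis (R : CompleteOrderedField) where

  open CompleteOrderedField R hiding (zero)
  open StrictTotalOrder strictTotalOrder using (compare; <-resp-≈)
    renaming (irrefl to <-irrefl; trans to <-trans; _<?_ to infix 4 _<?_; _≟_ to infix 4 _≟_)
  module ≤ = STO strictTotalOrder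
  open Solver commutativeSemiring using (solve; _:=_; _:+_; _:*_; con)

  ≮⇒≥ : ∀ {x y} → ¬ (x < y) → y ≤ x
  ≮⇒≥ {x} {y} x≮y with compare x y
  ... | tri< x<y _ _ = ⊥-elim (x≮y x<y)
  ... | tri≈ _ x≈y _ = inj₂ (sym x≈y)
  ... | tri> _ _ y<x = inj₁ y<x

  <⇒≱ : ∀ {x y} → x < y → ¬ (y ≤ x)
  <⇒≱ x<y (inj₁ y<x) = <-irrefl refl (<-trans x<y y<x)
  <⇒≱ x<y (inj₂ y≈x) = <-irrefl (sym y≈x) x<y

  <-≤-trans : ∀ {x y z} → x < y → y ≤ z → x < z
  <-≤-trans x<y (inj₁ y<z) = <-trans x<y y<z
  <-≤-trans x<y (inj₂ y≈z) = proj₁ <-resp-≈ y≈z x<y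

  ≤-<-trans : ∀ {x y z} → x ≤ y → y < z → x < z
  ≤-<-trans (inj₁ x<y) y<z = <-trans x<y y<z
  ≤-<-trans (inj₂ x≈y) y<z = proj₂ <-resp-≈ (sym x≈y) y<z

  <-resp : ∀ {x x′ y y′} → x ≈ x′ → y ≈ y′ → x < y → x′ < y′
  <-resp x≈x′ y≈y′ x<y = proj₁ <-resp-≈ y≈y′ (proj₂ <-resp-≈ x≈x′ x<y)

  ≤-resp : ∀ {x x′ y y′} → x ≈ x′ → y ≈ y′ → x ≤ y → x′ ≤ y′
  ≤-resp x≈x′ y≈y′ x≤y =
    ≤.trans (inj₂ (sym x≈x′)) (≤.trans x≤y (inj₂ y≈y′))

  +-monoʳ-≤ : ∀ x {y z} → y ≤ z → x + y ≤ x + z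
  +-monoʳ-≤ x (inj₁ y<z) = inj₁ (+-monoʳ-< x y<z)
  +-monoʳ-≤ x (inj₂ y≈z) = inj₂ (+-congˡ y≈z)

  +-mono-≤ : ∀ {x y u v} → x ≤ y → u ≤ v → x + u ≤ y + v
  +-mono-≤ {x} {y} {u} {v} x≤y u≤v = ≤.trans (+-monoʳ-≤ x u≤v)
    (≤-resp (+-comm v x) (+-comm v y) (+-monoʳ-≤ v x≤y))

  x+[y-x]≈y : ∀ x y → x + (y - x) ≈ y
  x+[y-x]≈y x y = trans (+-comm x (y - x)) (trans (+-assoc y (- x) x)
    (trans (+-congˡ (-‿inverseˡ x)) (+-identityʳ y)))

  x<y⇒0<y-x : ∀ {x y} → x < y → 0# < y - x
  x<y⇒0<y-x {x} {y} x<y =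
    <-resp (-‿inverseˡ x) (+-comm (- x) y) (+-monoʳ-< (- x) x<y)

  x≤y⇒0≤y-x : ∀ {x y} → x ≤ y → 0# ≤ y - x
  x≤y⇒0≤y-x {x} {y} x≤y =
    ≤-resp (-‿inverseˡ x) (+-comm (- x) y) (+-monoʳ-≤ (- x) x≤y)

  x<x+d : ∀ x {d} → 0# < d → x < x + d
  x<x+d x 0<d = <-resp (+-identityʳ x) refl (+-monoʳ-< x 0<d)

  *-monoʳ-< : ∀ {z x y} → 0# < z → x < y → z * x < z * y
  *-monoʳ-< {z} {x} {y} 0<z x<y = <-resp refl
    (trans (sym (distribˡ z x (y - x))) (*-congˡ (x+[y-x]≈y x y)))
    (x<x+d (z * x) (*-pos 0<z (x<y⇒0<y-x x<y)))

  *-monoʳ-≤ : ∀ {z x y} → 0# ≤ z → x ≤ y → z * x ≤ z * y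
  *-monoʳ-≤ (inj₁ 0<z) (inj₁ x<y) = inj₁ (*-monoʳ-< 0<z x<y)
  *-monoʳ-≤ _          (inj₂ x≈y) = inj₂ (*-congˡ x≈y)
  *-monoʳ-≤ {z} {x} {y} (inj₂ 0≈z) _ = inj₂
    (trans (*-congʳ (sym 0≈z)) (trans (zeroˡ x) (trans (sym (zeroˡ y)) (*-congʳ 0≈z))))

  *-mono-< : ∀ {x y} → 0# ≤ x → x < y → x * x < y * y
  *-mono-< {x} {y} 0≤x x<y = ≤-<-trans (*-monoʳ-≤ 0≤x (inj₁ x<y))
    (<-resp (*-comm y x) refl (*-monoʳ-< (≤-<-trans 0≤x x<y) x<y))

  *-cancelʳ-≤ : ∀ {z x y} → 0# < z → x * z ≤ y * z → x ≤ y
  *-cancelʳ-≤ {z} {x} {y} 0<z xz≤yz = ≮⇒≥ λ y<x →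
    <⇒≱ (<-resp (*-comm z y) (*-comm z x) (*-monoʳ-< 0<z y<x)) xz≤yz

  pos⇒≉0 : ∀ {x} → 0# < x → x ≉ 0#
  pos⇒≉0 0<x x≈0 = <-irrefl (sym x≈0) 0<x

  ⁻¹-inverseˡ : ∀ {x} → 0# < x → x ⁻¹ * x ≈ 1#
  ⁻¹-inverseˡ {x} 0<x = trans (*-comm (x ⁻¹) x) (⁻¹-inverseʳ (pos⇒≉0 0<x))

  ⁻¹-pos : ∀ {x} → 0# < x → 0# < x ⁻¹
  ⁻¹-pos {x} 0<x with compare 0# (x ⁻¹)
  ... | tri< 0<x⁻¹ _ _ = 0<x⁻¹
  ... | tri≈ _ 0≈x⁻¹ _ = ⊥-elim (pos⇒≉0 0<1
        (trans (sym (⁻¹-inverseʳ (pos⇒≉0 0<x))) (trans (*-congˡ (sym 0≈x⁻¹)) (zeroʳ x))))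
  ... | tri> _ _ x⁻¹<0 = ⊥-elim (<⇒≱ 0<1
        (inj₁ (<-resp (⁻¹-inverseʳ (pos⇒≉0 0<x)) (zeroʳ x) (*-monoʳ-< 0<x x⁻¹<0))))

  ⁻¹-anti-≤ : ∀ {x y} → 0# < x → x ≤ y → y ⁻¹ ≤ x ⁻¹
  ⁻¹-anti-≤ {x} {y} 0<x x≤y = *-cancelʳ-≤ 0<y (≤-resp
    (trans (⁻¹-inverseˡ 0<x) (sym (⁻¹-inverseˡ 0<y))) refl
    (*-monoʳ-≤ (inj₁ (⁻¹-pos 0<x)) x≤y))
    where 0<y = <-≤-trans 0<x x≤y

  _≤?_ : ∀ x y → Dec (x ≤ y)
  x ≤? y = ≤._≤?_ x y

  -- Completeness together with trichotomy decides every negation.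
  ¬-dec : (P : Set) → Dec (¬ P)
  ¬-dec P with completeness S (0# , inj₁ refl) (1# , S≤1)
    where
    S : Pred ℝ 0ℓ
    S x = (x ≈ 0#) ⊎ (P × (x ≈ 1#))
    S≤1 : IsUpperBound S 1#
    S≤1 x (inj₁ x≈0)       = inj₁ (proj₂ <-resp-≈ (sym x≈0) 0<1)
    S≤1 x (inj₂ (_ , x≈1)) = inj₂ x≈1
  ... | s , ub , least with s <? 1#
  ...   | yes s<1 = yes λ p → <⇒≱ s<1 (ub 1# (inj₂ (p , refl)))
  ...   | no  s≮1 = no  λ ¬p → s≮1 (≤-<-trans (least 0# λ where
            x (inj₁ x≈0)     → inj₂ x≈0
            x (inj₂ (p , _)) → ⊥-elim (¬p p)) 0<1)

  √-exists : ∀ x → 0# ≤ x → ∃ λ r → 0# ≤ r × r * r ≈ x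
  √-exists x 0≤x = s , 0≤s , s*s≈x
    where
    S : Pred ℝ 0ℓ
    S y = 0# ≤ y × y * y ≤ x

    0∈S : S 0#
    0∈S = ≤.refl , ≤-resp (sym (zeroˡ 0#)) refl 0≤x

    bound : ∀ {u} → 0# ≤ u → x ≤ u * u → IsUpperBound S u
    bound 0≤u x≤u² y (_ , y²≤x) = ≮⇒≥ λ u<y →
      <⇒≱ (*-mono-< 0≤u u<y) (≤.trans y²≤x x≤u²)

    0≤x+1 : 0# ≤ x + 1#
    0≤x+1 = ≤-resp (+-identityʳ 0#) refl (+-mono-≤ 0≤x (inj₁ 0<1))

    x≤[x+1]² : x ≤ (x + 1#) * (x + 1#)
    x≤[x+1]² = ≤-resp (+-identityʳ x)
      (solve 1 (λ a → a :+ (a :* a :+ a :+ con 1) := (a :+ con 1) :* (a :+ con 1)) refl x)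
      (+-monoʳ-≤ x (≤-resp (trans (+-identityʳ _) (+-identityʳ 0#)) refl
        (+-mono-≤ (+-mono-≤ (≤-resp (zeroʳ x) refl (*-monoʳ-≤ 0≤x 0≤x)) 0≤x) (inj₁ 0<1))))

    lub : ∃ (IsLUB S)
    lub = completeness S (0# , 0∈S) (x + 1# , bound 0≤x+1 x≤[x+1]²)

    s     = proj₁ lub
    0≤s   = proj₁ (proj₂ lub) 0# 0∈S
    0≤2s : 0# ≤ s + s
    0≤2s = ≤-resp (+-identityʳ 0#) refl (+-mono-≤ 0≤s 0≤s)

    s²≮x : ¬ (s * s < x)
    s²≮x s²<x = <⇒≱ (x<x+d s 0<ε) (proj₁ (proj₂ lub) (s + ε)
      (inj₁ (≤-<-trans 0≤s (x<x+d s 0<ε)) , small))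
      where
      d   = x - s * s
      0<d = x<y⇒0<y-x s²<x
      D   = s + s + (1# + d)
      1<1+d : 1# < 1# + d
      1<1+d = x<x+d 1# 0<d
      0<D : 0# < D
      0<D = <-≤-trans (<-trans 0<1 1<1+d)
        (≤-resp (+-identityˡ _) refl (+-mono-≤ 0≤2s ≤.refl))
      ε   = d * D ⁻¹
      0<ε = *-pos 0<d (⁻¹-pos 0<D)
      εD≈d : ε * D ≈ d
      εD≈d = trans (*-assoc d (D ⁻¹) D)
        (trans (*-congˡ (⁻¹-inverseˡ 0<D)) (*-identityʳ d))
      d≤D : d ≤ D
      d≤D = ≤-resp (trans (+-identityˡ _) (+-identityˡ _)) refl
        (+-mono-≤ 0≤2s (+-mono-≤ (inj₁ 0<1) (≤.refl {d})))
      ε≤1 : ε ≤ 1#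
      ε≤1 = *-cancelʳ-≤ 0<D (≤-resp (sym εD≈d) (sym (*-identityˡ D)) d≤D)
      small : (s + ε) * (s + ε) ≤ x
      small = ≤-resp
        (solve 2 (λ a e → a :* a :+ e :* (a :+ a :+ e) := (a :+ e) :* (a :+ e)) refl s ε)
        (trans (+-congˡ εD≈d) (x+[y-x]≈y (s * s) x))
        (+-monoʳ-≤ (s * s) (*-monoʳ-≤ (inj₁ 0<ε)
          (+-monoʳ-≤ (s + s) (≤.trans ε≤1 (inj₁ 1<1+d)))))

    x≮s² : ¬ (x < s * s)
    x≮s² x<s² = <⇒≱ t<s (proj₂ (proj₂ lub) t (bound (inj₁ 0<t) x≤t²))
      where
      0<s : 0# < s
      0<s with 0≤s
      ... | inj₁ 0<s = 0<s
      ... | inj₂ 0≈s = ⊥-elim (<⇒≱ x<s²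
              (≤-resp (trans (sym (zeroˡ 0#)) (*-cong 0≈s 0≈s)) refl 0≤x))
      0<2s : 0# < s + s
      0<2s = <-trans 0<s (x<x+d s 0<s)
      d    = s * s - x
      0<d  = x<y⇒0<y-x x<s²
      ε    = d * (s + s) ⁻¹
      0<ε  = *-pos 0<d (⁻¹-pos 0<2s)
      t    = s - ε
      ε+t≈s : ε + t ≈ s
      ε+t≈s = x+[y-x]≈y ε s
      ε2s≈d : ε * (s + s) ≈ d
      ε2s≈d = trans (*-assoc d ((s + s) ⁻¹) (s + s))
        (trans (*-congˡ (⁻¹-inverseˡ 0<2s)) (*-identityʳ d))
      t<s : t < s
      t<s = <-resp refl (trans (+-comm t ε) ε+t≈s) (x<x+d t 0<ε)
      ε<s : ε < s
      ε<s = ≰⇒> λ s≤ε → <⇒≱ 0<s² (s²≤0 s≤ε)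
        where
        ≰⇒> : ∀ {a b} → ¬ (b ≤ a) → a < b
        ≰⇒> {a} {b} b≰a with compare a b
        ... | tri< a<b _ _ = a<b
        ... | tri≈ _ a≈b _ = ⊥-elim (b≰a (inj₂ (sym a≈b)))
        ... | tri> _ _ b<a = ⊥-elim (b≰a (inj₁ b<a))
        0<s² : 0# < s * s
        0<s² = *-pos 0<s 0<s
        d≤s² : d ≤ s * s
        d≤s² = ≤-resp (+-identityˡ d) (x+[y-x]≈y x (s * s)) (+-mono-≤ 0≤x ≤.refl)
        2s²≤s² : s ≤ ε → s * s + s * s ≤ s * s
        2s²≤s² s≤ε = ≤.trans
          (≤-resp (distribˡ s s s) (trans (*-comm (s + s) ε) ε2s≈d)
            (≤-resp (*-comm (s + s) s) refl (*-monoʳ-≤ (inj₁ 0<2s) s≤ε))) d≤s²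
        s²≤0 : s ≤ ε → s * s ≤ 0#
        s²≤0 s≤ε = ⊥-elim (<⇒≱ (x<x+d (s * s) 0<s²) (2s²≤s² s≤ε))
      0<t : 0# < t
      0<t = x<y⇒0<y-x ε<s
      x+d≈s² : x + d ≈ s * s
      x+d≈s² = x+[y-x]≈y x (s * s)
      -- s² + ε² ≈ 2εs + t² and s² ≈ x + 2εs.
      x+ε²≤t² : x + ε * ε ≤ t * t
      x+ε²≤t² = ≮⇒≥ λ t²<x+ε² → <-irrefl refl
        (<-resp
          (trans (solve 2 (λ e u → e :* ((e :+ u) :+ (e :+ u)) :+ u :* u
                              := (e :+ u) :* (e :+ u) :+ e :* e) refl ε t)
                 (+-congʳ (*-cong ε+t≈s ε+t≈s)))
          (trans (+-congʳ (trans (*-congˡ (+-cong ε+t≈s ε+t≈s)) ε2s≈d))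
            (trans (solve 3 (λ y e z → e :+ (y :+ z) := (y :+ e) :+ z) refl x d (ε * ε))
                   (+-congʳ x+d≈s²)))
          (+-monoʳ-< (ε * ((ε + t) + (ε + t))) t²<x+ε²))
      x≤t² : x ≤ t * t
      x≤t² = ≤.trans (inj₁ (x<x+d x (*-pos 0<ε 0<ε))) x+ε²≤t²

    s*s≈x : s * s ≈ x
    s*s≈x with compare (s * s) x
    ... | tri< s²<x _ _ = ⊥-elim (s²≮x s²<x)
    ... | tri≈ _ s²≈x _ = s²≈x
    ... | tri> _ _ x<s² = ⊥-elim (x≮s² x<s²)

  √ : ∀ x → 0# ≤ x → ℝ
  √ x 0≤x = proj₁ (√-exists x 0≤x)

  -- s is a lower Darboux sum of t ↦ 1/t over a partition of [a , b]: on a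
  -- piece [a , t] the infimum of the integrand is 1/t.
  data LowerSum : ℝ → ℝ → ℝ → Set where
    end  : ∀ {a b} → a ≈ b → LowerSum a b 0#
    step : ∀ {a b s} t → a ≤ t → LowerSum t b s → LowerSum a b ((t - a) * t ⁻¹ + s)

  LowerSum-bound : ∀ {a b s u} → 0# < a → a ⁻¹ ≤ u →
                   LowerSum a b s → s ≤ (b - a) * u
  LowerSum-bound {a} {b} {u = u} 0<a a⁻¹≤u (end a≈b) = inj₂ (sym
    (trans (*-congʳ (trans (+-congʳ (sym a≈b)) (-‿inverseʳ a))) (zeroˡ u)))
  LowerSum-bound {a} {b} {u = u} 0<a a⁻¹≤u (step t a≤t σ) =
    ≤-resp refl
      (trans (sym (distribʳ u (t - a) (b - t)))
             (*-congʳ telescope))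
      (+-mono-≤ (*-monoʳ-≤ (x≤y⇒0≤y-x a≤t) t⁻¹≤u)
                (LowerSum-bound (<-≤-trans 0<a a≤t) t⁻¹≤u σ))
    where
    t⁻¹≤u = ≤.trans (⁻¹-anti-≤ 0<a a≤t) a⁻¹≤u
    telescope : (t - a) + (b - t) ≈ b - a
    telescope = trans
      (solve 4 (λ p q v w → (p :+ q) :+ (v :+ w) := (w :+ p) :+ (v :+ q)) refl t (- a) b (- t))
      (trans (+-congʳ (-‿inverseˡ t)) (+-identityˡ (b - a)))

  -- The integral of dt/t over [a , b].
  ∫dt/t : ∀ a b → 0# < a → a ≤ b → ℝ
  ∫dt/t a b 0<a a≤b = proj₁ (completeness (LowerSum a b)
    (_ , step b a≤b (end refl))
    ((b - a) * a ⁻¹ , λ _ → LowerSum-bound 0<a ≤.refl))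

  -- The natural logarithm, with value 0 outside its domain (0 , ∞).
  log : ℝ → ℝ
  log x with compare 0# x | compare 1# x
  ... | tri≈ _ _ _ | _            = 0#
  ... | tri> _ _ _ | _            = 0#
  ... | tri< _ _ _ | tri< 1<x _ _ = ∫dt/t 1# x 0<1 (inj₁ 1<x)
  ... | tri< _ _ _ | tri≈ _ 1≈x _ = ∫dt/t 1# x 0<1 (inj₂ 1≈x)
  ... | tri< 0<x _ _ | tri> _ _ x<1 = - ∫dt/t x 1# 0<x (inj₁ x<1)

  IsMinimum : Pred ℝ 0ℓ → ℝ → Set
  IsMinimum P m = (∃ λ x → P x × m ≈ x) × (∀ x → P x → m ≤ x)

  ∑ : ∀ {n} → (Fin n → ℝ) → ℝ
  ∑ = RawMonoid.sum +-rawMonoid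

  Matrix : ℕ → Set
  Matrix n = Fin n → Fin n → ℝ

  identity : ∀ {n} → Matrix n
  identity i j = if does (i Fin.≟ j) then 1# else 0#

  infixl 7 _·_
  infixl 6 _⊕_ _⊖_
  infix  9 _ᵀ
  infix  4 _⪯_

  _⊕_ _⊖_ : ∀ {n} → Matrix n → Matrix n → Matrix n
  (A ⊕ B) i j = A i j + B i j
  (A ⊖ B) i j = A i j - B i j

  _·_ : ∀ {n} → ℝ → Matrix n → Matrix n
  (α · A) i j = α * A i j

  _ᵀ : ∀ {n} → Matrix n → Matrix n
  (A ᵀ) i j = A j i

  ∑[_]_ : ∀ {k n} → Subset k → (Fin k → Matrix n) → Matrix n
  (∑[ T ] A) x y = ∑ λ j → if does (j ∈? T) then A j x y else 0#

  quadraticForm : ∀ {n} → Matrix n → (Fin n → ℝ) → ℝ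
  quadraticForm A v = ∑ λ i → ∑ λ j → v i * (A i j * v j)

  PSD : ∀ {n} → Matrix n → Set
  PSD A = (∀ i j → A i j ≈ A j i) × (∀ v → 0# ≤ quadraticForm A v)

  _⪯_ : ∀ {n} → Matrix n → Matrix n → Set
  A ⪯ B = PSD (B ⊖ A)

  PSD? : ∀ {n} → Decidable (PSD {n})
  PSD? A = Fin.all? (λ i → Fin.all? λ j → A i j ≟ A j i) ×-dec
    map′ (λ ¬∃ v → ≮⇒≥ λ q<0 → ¬∃ (v , q<0))
         (λ ∀v (v , q<0) → <⇒≱ q<0 (∀v v))
         (¬-dec (∃ λ v → quadraticForm A v < 0#))

  Connected : ∀ {k n} → ℝ → (Fin k → Matrix n) → ℕ → Set
  Connected α A m = ∀ T → m ℕ.≤ ∣ T ∣ →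
    ∃ λ i → i ∈ T × α · A i ⪯ ∑[ T ∖ i ] A

  allSubset? : ∀ {k} {P : Pred (Subset k) 0ℓ} → Decidable P → Dec (∀ T → P T)
  allSubset? P? with anySubset? (λ T → ¬? (P? T))
  ... | yes (T , ¬PT) = no λ ∀P → ¬PT (∀P T)
  ... | no  ¬∃        = yes λ T → decidable-stable (P? T) λ ¬PT → ¬∃ (T , ¬PT)

  Connected? : ∀ {k n} α (A : Fin k → Matrix n) → Decidable (Connected α A)
  Connected? α A m = allSubset? λ T → (m ℕ.≤? ∣ T ∣) →-dec
    Fin.any? (λ i → (i ∈? T) ×-dec PSD? _)

  -- The least m < b satisfying P, or b if there is none.
  leastBelow : ∀ {P : Pred ℕ 0ℓ} → Decidable P → ℕ → ℕ
  leastBelow P? zero    = zero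
  leastBelow P? (suc b) = if does (P? 0) then 0 else suc (leastBelow (λ m → P? (suc m)) b)

  connectivity : ∀ {k n} → ℝ → (Fin k → Matrix n) → ℕ
  connectivity {k} α A = leastBelow (Connected? α A) (suc k)

  0≤fromℕ : ∀ n → 0# ≤ fromℕ n
  0≤fromℕ zero    = ≤.refl
  0≤fromℕ (suc n) = ≤-resp (+-identityʳ 0#) refl (+-mono-≤ (inj₁ 0<1) (0≤fromℕ n))

  0<fromℕ-suc : ∀ n → 0# < fromℕ (suc n)
  0<fromℕ-suc n = <-≤-trans 0<1
    (≤-resp (+-identityʳ 1#) refl (+-monoʳ-≤ 1# (0≤fromℕ n)))

  0≤7/3 : 0# ≤ fromℕ 7 / fromℕ 3
  0≤7/3 = inj₁ (*-pos (0<fromℕ-suc 6) (⁻¹-pos (0<fromℕ-suc 2)))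

  α½ : ℝ
  α½ = (√ (fromℕ 7 / fromℕ 3) 0≤7/3 - 1#) / fromℕ 2

  connectivityThreshold : ∀ {k n} → (Fin k → Matrix n) → ℕ
  connectivityThreshold A = connectivity α½ A

record FiniteGroup : Set₁ where
  field
    group       : Group 0ℓ 0ℓ
    size        : ℕ
    enumeration : Inverse (Group.setoid group) (≡.setoid (Fin size))

  open Group group public using (Carrier; _≈_; _∙_)

  element : Fin size → Carrier
  element = Inverse.from enumeration

  index : Carrier → Fin size
  index = Inverse.to enumeration

  IsAbelian : Set
  IsAbelian = Commutative _≈_ _∙_

module Cayley (R : CompleteOrderedField) (G : FiniteGroup) where

  open CompleteOrderedField R using (ℝ; 0#; 1#; _/_; fromℕ)
  open Analysis R
  open FiniteGroup G

  -- Matrix of α ↦ Σ_h α_h (h ∙ g) in the basis of group elements: column h is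
  -- the basis vector of h ∙ g.
  rightRegular : Carrier → Matrix size
  rightRegular g x h =
    if does (x Fin.≟ index (element h ∙ g)) then 1# else 0#

  L : Carrier → Matrix size
  L g = identity ⊖ (1# / fromℕ 2) · (rightRegular g ⊕ rightRegular g ᵀ)

  -- The family indexed by the group itself, through its enumeration.
  𝓛 : Fin size → Matrix size
  𝓛 i = L (element i)

{-# OPTIONS --safe #-}
module Submission where

-- For a {0,1}-valued v on the group, twice the quadratic form of L_g at v is
-- the number of x with v(x) ≠ v(xg).  Split the group as a sum of cyclic groups
-- ⟨gᵢ⟩ of orders nᵢ, fix m ≥ 7/α of size O(1/α), put B = 2m, and let T consist of
-- the Bᵗgᵢ with t < kᵢ, where kᵢ = max(1, ⌊log_B nᵢ⌋).  The square wave
-- v(x) = ⌊xᵢ/Bˢ⌋ mod 2 in the i-th coordinate almost always flips under Bˢgᵢ,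
-- flips on a fraction of order B^(t-s) under Bᵗgᵢ with t < s, flips only at the
-- wrap-around under Bᵗgᵢ with t > s (its period 2Bˢ divides Bᵗ), and never flips
-- under the other generators.  So every element of T outweighs the rest of T by
-- the factor 1/α, and N(α) > |T|, while N ≤ B^(2|T|) and B ≤ (4/α)².

open import Defs
open import Data.Product.Base using (∃; _×_; _,_)

-- The base `B = 2m` does two jobs. Its factor 2 makes every longer shift a multiple of the full
-- period of the wave, and its size makes `m` times the sum of the lower powers at most the next
-- power. After multiplication by `m` the shifts other than `B ^ s` then cost at most `3n`, while
-- the shift `B ^ s` itself flips at least `n / 2` positions: an excess of 6 flip counts, which 7
-- makes strict. Hence the demand `m ≥ 7/α`. Since `B ≤ (4/α)²` and `N ≤ B ^ (2|T|)`,
-- `log N ≤ 4 |T| log (4/α)`, so the constant is 1/4; `α log (4/α) ≤ 4` turns it into 1/16 for the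
-- ratio. The cyclic splitting is itself proved: an element realising the exponent of the quotient
-- by the span so far is corrected to one of the same order in the group. That the minimum over `α`
-- exists is a separate matter, `α` ranging over a continuum. The numerator takes finitely many
-- values, and for each of them the admissible `α` contain their supremum, so finitely many
-- candidates remain.

module Preliminaries where

  open import Algebra.Bundles using (CommutativeMonoid)
  import Algebra.Properties.CommutativeMonoid.Sum as Sum
  open import Data.Bool.Base using (if_then_else_)
  open import Data.Fin.Base using (Fin; zero; suc)
  import Data.Fin.Properties as Fin
  open import Function.Base using (_∘_)
  open import Relation.Binary.PropositionalEquality as ≡ using (_≡_; _≢_)
  open import Relation.Nullary using (Dec; does; yes; no; ¬_; contradiction)

  module _ {a} {A : Set a} where

    if-yes : ∀ {P : Set} (P? : Dec P) {x y : A} → P → (if does P? then x else y) ≡ x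
    if-yes (yes _) p = ≡.refl
    if-yes (no ¬p) p = contradiction p ¬p

    if-no : ∀ {P : Set} (P? : Dec P) {x y : A} → ¬ P → (if does P? then x else y) ≡ y
    if-no (yes p) ¬p = contradiction p ¬p
    if-no (no _)  ¬p = ≡.refl

  module _ {c ℓ} (M : CommutativeMonoid c ℓ) where

    open CommutativeMonoid M
    open Sum M using (sum; sum-cong-≋; sum-replicate-zero)

    sum-zero : ∀ {k} {f : Fin k → Carrier} → (∀ i → f i ≈ ε) → sum f ≈ ε
    sum-zero {k} f≈0 = trans (sum-cong-≋ f≈0) (sum-replicate-zero k)

    sum-single : ∀ {k} (f : Fin k → Carrier) i → (∀ j → i ≢ j → f j ≈ ε) → sum f ≈ f i
    sum-single {k = _} f zero    f≈0 =
      trans (∙-congˡ (sum-zero (λ j → f≈0 (suc j) λ ()))) (identityʳ (f zero))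
    sum-single {k = _} f (suc i) f≈0 = trans (∙-congʳ (f≈0 zero λ ())) (trans (identityˡ _)
      (sum-single (f ∘ suc) i (λ j i≢j → f≈0 (suc j) (i≢j ∘ Fin.suc-injective))))

-- Square waves on a cyclic group and their flips under shifts.

module SquareWave where

  open import Data.Bool.Base using (Bool; true; false; not; _xor_; if_then_else_)
  open import Data.Bool.Properties using (not-involutive)
  open import Data.Nat.Base
  open import Data.Nat.Properties
  open import Data.Nat.DivMod
  open import Data.Nat.Divisibility using (divides)
  open import Data.Nat.Tactic.RingSolver using (solve-∀)
  open import Data.Sum.Base using (_⊎_; inj₁; inj₂)
  open import Function.Base using (_∘_)
  open import Relation.Binary.PropositionalEquality

  ∑< : ℕ → (ℕ → ℕ) → ℕ
  ∑< zero    f = 0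
  ∑< (suc n) f = ∑< n f + f n

  ∑<-suc : ∀ n f → ∑< (suc n) f ≡ f 0 + ∑< n (f ∘ suc)
  ∑<-suc zero    f = +-comm 0 (f 0)
  ∑<-suc (suc n) f = trans (cong (_+ f (suc n)) (∑<-suc n f)) (+-assoc (f 0) _ _)

  ∑<-cong : ∀ n {f g} → (∀ c → f c ≡ g c) → ∑< n f ≡ ∑< n g
  ∑<-cong zero    f≡g = refl
  ∑<-cong (suc n) f≡g = cong₂ _+_ (∑<-cong n f≡g) (f≡g n)

  ∑<-mono : ∀ n {f g} → (∀ c → c < n → f c ≤ g c) → ∑< n f ≤ ∑< n g
  ∑<-mono zero    f≤g = z≤n
  ∑<-mono (suc n) f≤g =
    +-mono-≤ (∑<-mono n (λ c c<n → f≤g c (m<n⇒m<1+n c<n))) (f≤g n (n<1+n n))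

  ∑<-+ : ∀ n f g → ∑< n (λ c → f c + g c) ≡ ∑< n f + ∑< n g
  ∑<-+ zero    f g = refl
  ∑<-+ (suc n) f g = trans (cong (_+ (f n + g n)) (∑<-+ n f g)) (lemma (∑< n f) (∑< n g) (f n) (g n))
    where
    lemma : ∀ a b c d → (a + b) + (c + d) ≡ (a + c) + (b + d)
    lemma = solve-∀

  ∑<-zero : ∀ n {f} → (∀ c → c < n → f c ≡ 0) → ∑< n f ≡ 0
  ∑<-zero zero    f≡0 = refl
  ∑<-zero (suc n) f≡0 = cong₂ _+_ (∑<-zero n (λ c c<n → f≡0 c (m<n⇒m<1+n c<n))) (f≡0 n (n<1+n n))

  ∑<-≥ : ∀ n {f} → (∀ c → c < n → 1 ≤ f c) → n ≤ ∑< n f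
  ∑<-≥ zero    1≤f = z≤n
  ∑<-≥ (suc n) {f} 1≤f = subst (_≤ ∑< n f + f n) (+-comm n 1)
    (+-mono-≤ (∑<-≥ n (λ c c<n → 1≤f c (m<n⇒m<1+n c<n))) (1≤f n (n<1+n n)))

  ∑<-extend-≤ : ∀ p a {f} → (∀ c → f c ≤ 1) → ∑< (a + p) f ≤ a + ∑< p f
  ∑<-extend-≤ p zero        f≤1 = ≤-refl
  ∑<-extend-≤ p (suc a) {f} f≤1 = subst (∑< (a + p) f + f (a + p) ≤_) (+-comm (a + ∑< p f) 1)
    (+-mono-≤ (∑<-extend-≤ p a f≤1) (f≤1 (a + p)))

  ∑<-extend-≥ : ∀ p a {f} → ∑< p f ≤ ∑< (a + p) f
  ∑<-extend-≥ p zero    = ≤-refl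
  ∑<-extend-≥ p (suc a) = ≤-trans (∑<-extend-≥ p a) (m≤m+n _ _)

  Periodic : ∀ {A : Set} → ℕ → (ℕ → A) → Set
  Periodic n f = ∀ c → f (c + n) ≡ f c

  -- Advancing the window by one drops `f u` and gains `f (n + u)`, which periodicity makes equal.
  ∑<-shift : ∀ n {f} → Periodic n f → ∀ u → ∑< n (λ c → f (c + u)) ≡ ∑< n f
  ∑<-shift n {f} per zero    = ∑<-cong n (λ c → cong f (+-identityʳ c))
  ∑<-shift n {f} per (suc u) = trans
    (∑<-cong n (λ c → cong f (+-suc c u)))
    (trans (+-cancelˡ-≡ (f u) _ _ step) (∑<-shift n per u))
    where
    step : f u + ∑< n (λ c → f (suc c + u)) ≡ f u + ∑< n (λ c → f (c + u))
    step = trans (sym (∑<-suc n (λ c → f (c + u))))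
      (trans (cong (∑< n (λ c → f (c + u)) +_) (trans (cong f (+-comm n u)) (per u))) (+-comm _ (f u)))

  dist : Bool → Bool → ℕ
  dist x y = if x xor y then 1 else 0

  dist-refl : ∀ x → dist x x ≡ 0
  dist-refl false = refl
  dist-refl true  = refl

  dist-not : ∀ x → dist x (not x) ≡ 1
  dist-not false = refl
  dist-not true  = refl

  dist≤1 : ∀ x y → dist x y ≤ 1
  dist≤1 false false = z≤n
  dist≤1 false true  = ≤-refl
  dist≤1 true  false = ≤-refl
  dist≤1 true  true  = z≤n

  dist-triangle : ∀ x y z → dist x z ≤ dist x y + dist y z
  dist-triangle false y     false = z≤n
  dist-triangle true  y     true  = z≤n
  dist-triangle false false true  = ≤-refl
  dist-triangle false true  true  = ≤-refl
  dist-triangle true  false false = ≤-refl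
  dist-triangle true  true  false = ≤-refl

  odd : ℕ → Bool
  odd zero    = false
  odd (suc n) = not (odd n)

  odd-+2* : ∀ r q → odd (q + r * 2) ≡ odd q
  odd-+2* zero    q = cong odd (+-identityʳ q)
  odd-+2* (suc r) q = trans (cong odd (lemma q (r * 2)))
    (trans (not-involutive _) (odd-+2* r q))
    where
    lemma : ∀ a b → a + (2 + b) ≡ 2 + (a + b)
    lemma = solve-∀

  dist-odd : ∀ d a → dist (odd a) (odd (d + a)) ≤ d
  dist-odd zero    a = ≤-reflexive (dist-refl (odd a))
  dist-odd (suc d) a = ≤-trans (dist-triangle (odd a) (odd (d + a)) (odd (suc d + a)))
    (subst (dist (odd a) (odd (d + a)) + dist (odd (d + a)) (odd (suc d + a)) ≤_) (+-comm d 1)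
      (+-mono-≤ (dist-odd d a) (≤-reflexive (dist-not (odd (d + a))))))

  wave : (w : ℕ) .{{_ : NonZero w}} → ℕ → Bool
  wave w c = odd (c / w)

  module _ (w : ℕ) .{{_ : NonZero w}} where

    /-+* : ∀ c q → (c + q * w) / w ≡ c / w + q
    /-+* c q = trans (+-distrib-/-∣ʳ c (divides q refl)) (cong (c / w +_) (m*n/n≡m q w))

    wave-+w : ∀ c → wave w (c + w) ≡ not (wave w c)
    wave-+w c = cong odd (trans (cong (λ u → (c + u) / w) (sym (*-identityˡ w)))
      (trans (/-+* c 1) (+-comm (c / w) 1)))

    wave-period : ∀ r c → wave w (c + r * 2 * w) ≡ wave w c
    wave-period r c = trans (cong odd (/-+* c (r * 2))) (odd-+2* r (c / w))

    -- A change of the wave forces the quotient by `w` to grow, so the changes telescope to the last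
    -- quotient.
    wave-variation : ∀ j → ∑< j (λ c → dist (wave w c) (wave w (c + 1))) ≤ j / w
    wave-variation zero    = z≤n
    wave-variation (suc j) = ≤-trans (+-mono-≤ (wave-variation j)
      (subst (λ x → dist (wave w j) (odd x) ≤ (j + 1) / w ∸ j / w)
        (m∸n+n≡m mono) (dist-odd _ (j / w))))
      (≤-reflexive (trans (m+[n∸m]≡n mono) (cong (_/ w) (+-comm j 1))))
      where
      mono : j / w ≤ (j + 1) / w
      mono = /-monoˡ-≤ w (m≤m+n j 1)

  module _ (n : ℕ) .{{_ : NonZero n}} (w : ℕ) .{{_ : NonZero w}} where

    cyclicWave : ℕ → Bool
    cyclicWave c = wave w (c % n)

    flips : ℕ → ℕ
    flips a = ∑< n (λ c → dist (cyclicWave c) (cyclicWave (c + a)))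

    cyclicWave-periodic : Periodic n cyclicWave
    cyclicWave-periodic c = cong (wave w) ([m+n]%n≡m%n c n)

    cyclicWave-< : ∀ {c} → c < n → cyclicWave c ≡ wave w c
    cyclicWave-< c<n = cong (wave w) (m<n⇒m%n≡m c<n)

    -- Triangle inequality through `c + a`; rotating the period by `a` turns the second leg into
    -- `flips b`.
    flips-+ : ∀ a b → flips (a + b) ≤ flips a + flips b
    flips-+ a b = begin
      flips (a + b)
        ≤⟨ ∑<-mono n (λ c _ → dist-triangle (F c) (F (c + a)) (F (c + (a + b)))) ⟩
      ∑< n (λ c → dist (F c) (F (c + a)) + dist (F (c + a)) (F (c + (a + b))))
        ≡⟨ ∑<-+ n _ _ ⟩
      flips a + ∑< n (λ c → dist (F (c + a)) (F (c + (a + b))))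
        ≡⟨ cong (flips a +_) (∑<-cong n (λ c → cong (λ x → dist (F (c + a)) (F x)) (sym (+-assoc c a b)))) ⟩
      flips a + ∑< n (λ c → dist (F (c + a)) (F (c + a + b)))
        ≡⟨ cong (flips a +_) (∑<-shift n per a) ⟩
      flips a + flips b ∎
      where
      open ≤-Reasoning
      F = cyclicWave
      per : Periodic n (λ c → dist (F c) (F (c + b)))
      per c = cong₂ dist (cyclicWave-periodic c)
        (trans (cong F (lemma c n b)) (cyclicWave-periodic (c + b)))
        where
        lemma : ∀ c n b → c + n + b ≡ c + b + n
        lemma = solve-∀

    flips-≤* : ∀ a → flips a ≤ flips 1 * a
    flips-≤* zero = ≤-trans (≤-reflexive (∑<-zero n λ c _ →
      trans (cong (λ x → dist (cyclicWave c) (cyclicWave x)) (+-identityʳ c)) (dist-refl (cyclicWave c)))) z≤n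
    flips-≤* (suc a) = ≤-trans (flips-+ 1 a)
      (≤-trans (+-monoʳ-≤ (flips 1) (flips-≤* a)) (≤-reflexive (sym (*-suc (flips 1) a))))

    n≡ : ∀ {a} → a ≤ n → n ≡ a + (n ∸ a)
    n≡ a≤n = sym (m+[n∸m]≡n a≤n)

    c+a<n : ∀ {a c} → a ≤ n → c < n ∸ a → c + a < n
    c+a<n a≤n c<n∸a = subst (_ <_) (m∸n+n≡m a≤n) (+-monoˡ-< _ c<n∸a)

    -- The `a` residues that wrap around are charged one flip each; on the others no reduction
    -- modulo `n` takes place.
    flips-split : ∀ {a} → a ≤ n → flips a ≤ a + ∑< (n ∸ a) (λ c → dist (cyclicWave c) (cyclicWave (c + a)))
    flips-split {a} a≤n = subst (λ x → ∑< x D ≤ a + ∑< (n ∸ a) D) (sym (n≡ a≤n))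
      (∑<-extend-≤ (n ∸ a) a (λ c → dist≤1 (cyclicWave c) (cyclicWave (c + a))))
      where D = λ c → dist (cyclicWave c) (cyclicWave (c + a))

    cyclicDist : ∀ {a c} → a ≤ n → c < n ∸ a →
      dist (cyclicWave c) (cyclicWave (c + a)) ≡ dist (wave w c) (wave w (c + a))
    cyclicDist {a} {c} a≤n c<n∸a =
      cong₂ dist (cyclicWave-< (≤-<-trans (m≤m+n c a) c+a<)) (cyclicWave-< c+a<)
      where c+a< = c+a<n a≤n c<n∸a

    -- The shift is a whole number of periods `2w`, so only residues that wrap around can flip.
    flips-period : ∀ r → r * 2 * w ≤ n → flips (r * 2 * w) ≤ r * 2 * w
    flips-period r a≤n = ≤-trans (flips-split a≤n) (≤-reflexive (trans
      (cong (r * 2 * w +_) (∑<-zero (n ∸ r * 2 * w) λ c c< → trans (cyclicDist a≤n c<)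
        (trans (cong (dist (wave w c)) (wave-period w r c)) (dist-refl (wave w c)))))
      (+-identityʳ _)))

    flips-w : w ≤ n → n ∸ w ≤ flips w
    flips-w w≤n = ≤-trans
      (∑<-≥ (n ∸ w) λ c c< → ≤-reflexive (sym (trans (cyclicDist w≤n c<)
        (trans (cong (dist (wave w c)) (wave-+w w c)) (dist-not (wave w c))))))
      (subst (λ x → ∑< (n ∸ w) D ≤ ∑< x D) (sym (n≡ w≤n)) (∑<-extend-≥ (n ∸ w) w))
      where D = λ c → dist (cyclicWave c) (cyclicWave (c + w))

    -- Before the wrap-around the wave changes at most `(n - 1) / w` times; the factor `w` avoids
    -- fractions.
    w*flips-1 : w * flips 1 ≤ w + n
    w*flips-1 = begin
      w * flips 1              ≤⟨ *-monoʳ-≤ w (flips-split (>-nonZero⁻¹ n)) ⟩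
      w * (1 + ∑< (n ∸ 1) _)   ≤⟨ *-monoʳ-≤ w (+-monoʳ-≤ 1 (∑<-mono (n ∸ 1) λ c c< →
                                    ≤-reflexive (cyclicDist {c = c} (>-nonZero⁻¹ n) c<))) ⟩
      w * (1 + ∑< (n ∸ 1) _)   ≤⟨ *-monoʳ-≤ w (+-monoʳ-≤ 1 (wave-variation w (n ∸ 1))) ⟩
      w * (1 + (n ∸ 1) / w)    ≡⟨ *-suc w _ ⟩
      w + w * ((n ∸ 1) / w)    ≡⟨ cong (w +_) (*-comm w _) ⟩
      w + (n ∸ 1) / w * w      ≤⟨ +-monoʳ-≤ w (≤-trans (m/n*n≤m (n ∸ 1) w) (m∸n≤m n 1)) ⟩
      w + n                    ∎
      where
      open ≤-Reasoning

  module _ (m : ℕ) .{{_ : NonZero m}} where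

    private
      B = 2 * m

      instance
        B≢0 : NonZero B
        B≢0 = m*n≢0 2 m

    -- As `m + m = B`, one half of the base pays for the new power and the other half for all
    -- earlier ones.
    geometric : ∀ k → m * ∑< k (B ^_) ≤ B ^ k
    geometric zero    = ≤-trans (≤-reflexive (*-zeroʳ m)) z≤n
    geometric (suc k) = begin
      m * (∑< k (B ^_) + B ^ k)      ≡⟨ *-distribˡ-+ m _ (B ^ k) ⟩
      m * ∑< k (B ^_) + m * B ^ k    ≤⟨ +-monoˡ-≤ _ (≤-trans (geometric k) (m≤n*m (B ^ k) m)) ⟩
      m * B ^ k + m * B ^ k          ≡⟨ lemma m (B ^ k) ⟩
      B * B ^ k                      ∎
      where
      open ≤-Reasoning
      lemma : ∀ m b → m * b + m * b ≡ 2 * m * b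
      lemma = solve-∀

    module _ (n : ℕ) .{{_ : NonZero n}} (s : ℕ) where

      private
        instance
          w≢0 : NonZero (B ^ s)
          w≢0 = m^n≢0 B s

        e : ℕ → ℕ
        e t = flips n (B ^ s) (B ^ t)
        E = flips n (B ^ s) 1

      -- Subadditivity alone: a shift by `B ^ t` costs at most `B ^ t` unit shifts.
      short-shifts : ∀ u → ∑< u e ≤ E * ∑< u (B ^_)
      short-shifts zero    = z≤n
      short-shifts (suc u) = ≤-trans (+-mono-≤ (short-shifts u) (flips-≤* n (B ^ s) (B ^ u)))
        (≤-reflexive (sym (*-distribˡ-+ E _ (B ^ u))))

      -- The factor 2 of the base makes `B ^ (suc j + s)` an even multiple of the half-period
      -- `B ^ s`.
      long-shift : ∀ j → B ^ (suc j + s) ≤ n → e (suc j + s) ≤ B ^ (suc j + s)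
      long-shift j ≤n = subst (λ x → flips n (B ^ s) x ≤ x) eq
        (flips-period n (B ^ s) (B ^ j * m) (subst (_≤ n) (sym eq) ≤n))
        where
        lemma : ∀ a m b → a * m * 2 * b ≡ 2 * m * (a * b)
        lemma = solve-∀
        eq : B ^ j * m * 2 * B ^ s ≡ B ^ (suc j + s)
        eq = trans (lemma (B ^ j) m (B ^ s)) (cong (B *_) (sym (^-distribˡ-+-* B j s)))

      -- The shifts `t < s`, `t = s` and `t > s` give one summand each. The last sum also contains
      -- the powers up to `s`; this weakens the bound but gives the shape that `geometric` treats.
      all-shifts : ∀ j → B ^ (j + s) ≤ n →
        ∑< (suc j + s) e ≤ E * ∑< s (B ^_) + e s + ∑< (suc j + s) (B ^_)
      all-shifts zero    _  = ≤-trans (+-monoˡ-≤ (e s) (short-shifts s)) (m≤m+n _ _)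
      all-shifts (suc j) ≤n = ≤-trans
        (+-mono-≤ (all-shifts j (≤-trans (^-monoʳ-≤ B (n≤1+n (j + s))) ≤n)) (long-shift j ≤n))
        (≤-reflexive (+-assoc (E * ∑< s (B ^_) + e s) (∑< (suc j + s) (B ^_)) (B ^ (suc j + s))))

      -- After multiplication by `m` the short shifts cost at most `w + n` and the long ones `n`. As
      -- `w ≤ n ≤ 2 * e s`, the excess is at most `6 * e s`.
      separation-long : ∀ {k} → s < k → B ^ k ≤ n → m * ∑< k e < (m + 7) * e s
      separation-long {k} s<k B^k≤n = begin-strict
        m * ∑< k e
          ≤⟨ *-monoʳ-≤ m (subst (λ k → ∑< k e ≤ E * ∑< s (B ^_) + e s + ∑< k (B ^_)) k≡
               (all-shifts j (≤-trans (^-monoʳ-≤ B (≤-trans (n≤1+n _) (≤-reflexive k≡))) B^k≤n))) ⟩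
        m * (E * ∑< s (B ^_) + e s + ∑< k (B ^_))
          ≡⟨ expand m E (∑< s (B ^_)) (e s) (∑< k (B ^_)) ⟩
        m * e s + ((m * ∑< s (B ^_)) * E + m * ∑< k (B ^_))
          ≤⟨ +-monoʳ-≤ (m * e s) (+-mono-≤ (*-monoˡ-≤ E (geometric s)) (≤-trans (geometric k) B^k≤n)) ⟩
        m * e s + (w * E + n)
          ≤⟨ +-monoʳ-≤ (m * e s) (+-monoˡ-≤ n (w*flips-1 n w)) ⟩
        m * e s + (w + n + n)
          ≤⟨ +-monoʳ-≤ (m * e s) (+-monoˡ-≤ n (+-mono-≤ w≤n n≤2e)) ⟩
        m * e s + (n + 2 * e s + n)
          ≤⟨ +-monoʳ-≤ (m * e s) (+-mono-≤ (+-monoˡ-≤ (2 * e s) n≤2e) n≤2e) ⟩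
        m * e s + (2 * e s + 2 * e s + 2 * e s)
          ≡⟨ collect m (e s) ⟩
        (m + 6) * e s
          <⟨ *-monoˡ-< (e s) {{>-nonZero 0<e}} (+-monoʳ-< m (n<1+n 6)) ⟩
        (m + 7) * e s ∎
        where
        open ≤-Reasoning
        w = B ^ s
        j = k ∸ suc s
        k≡ : suc j + s ≡ k
        k≡ = trans (sym (+-suc j s)) (m∸n+n≡m s<k)
        2w≤n : 2 * w ≤ n
        2w≤n = ≤-trans (*-monoˡ-≤ w (m≤m*n 2 m)) (≤-trans (^-monoʳ-≤ B s<k) B^k≤n)
        w≤n : w ≤ n
        w≤n = ≤-trans (m≤m+n w _) 2w≤n
        -- As `2w ≤ n`, at least half of the residues do not wrap around under the shift by `w`, and
        -- all of these flip.
        n≤2e : n ≤ 2 * e s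
        n≤2e = begin
          n                ≡⟨ m+[n∸m]≡n 2w≤n ⟨
          2 * w + (n ∸ 2 * w) ≤⟨ m≤m+n _ (n ∸ 2 * w) ⟩
          2 * w + (n ∸ 2 * w) + (n ∸ 2 * w) ≡⟨ dbl w (n ∸ 2 * w) ⟩
          2 * (w + (n ∸ 2 * w)) ≡⟨ cong (2 *_) w+ ⟩
          2 * (n ∸ w)      ≤⟨ *-monoʳ-≤ 2 (flips-w n w w≤n) ⟩
          2 * e s          ∎
          where
          dbl : ∀ a b → 2 * a + b + b ≡ 2 * (a + b)
          dbl = solve-∀
          w+ : w + (n ∸ 2 * w) ≡ n ∸ w
          w+ = trans (cong (w +_) (trans (cong (n ∸_) (cong (w +_) (+-identityʳ w))) (sym (∸-+-assoc n w w))))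
            (m+[n∸m]≡n (m+n≤o⇒m≤o∸n w (subst (_≤ n) (cong (w +_) (+-identityʳ w)) 2w≤n)))
        0<e : 0 < e s
        0<e = *-cancelˡ-< 2 0 (e s) (≤-trans (>-nonZero⁻¹ n) n≤2e)
        expand : ∀ m E S e T → m * (E * S + e + T) ≡ m * e + (m * S * E + m * T)
        expand = solve-∀
        collect : ∀ m e → m * e + (2 * e + 2 * e + 2 * e) ≡ (m + 6) * e
        collect = solve-∀

      -- For `k = 1` the order may lie below the base. The only shift is then the unit shift of the
      -- wave of half-period 1, and `2 ≤ n` makes it flip somewhere.
      separation : ∀ {k} → 2 ≤ n → s < k → k ≡ 1 ⊎ B ^ k ≤ n → m * ∑< k e < (m + 7) * e s
      separation _ s<k (inj₂ B^k≤n) = separation-long s<k B^k≤n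
      separation 2≤n (s≤s z≤n) (inj₁ refl) = *-monoˡ-< (e 0) {{>-nonZero 0<e}} (m<m+n m z<s)
        where
        0<e : 0 < e 0
        0<e = ≤-trans (m<n⇒0<n∸m 2≤n) (flips-w n (B ^ 0) (≤-trans (n≤1+n 1) 2≤n))

-- Prime powers and divisibility.

module PrimePowers where

  open import Data.List.Base using ([]; _∷_)
  open import Data.Nat.ListAction using (product)
  open import Data.List.Relation.Unary.All using (_∷_)
  open import Data.Nat.Base
  open import Data.Nat.Properties
  open import Data.Nat.Divisibility
  open import Data.Nat.Induction using (<-wellFounded)
  open import Data.Nat.Primality using (Prime; euclidsLemma; prime⇒nonZero; prime⇒nonTrivial)
  open import Data.Nat.Primality.Factorisation using (factorise)
  open import Data.Product.Base using (∃; ∃₂; _×_; _,_)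
  open import Data.Sum.Base using (inj₁; inj₂)
  open import Induction.WellFounded using (Acc; acc)
  open import Relation.Binary.PropositionalEquality
  open import Relation.Nullary using (¬_; yes; no; contradiction)

  p^k∣a*c⇒p^k∣c : ∀ {p a} → Prime p → ¬ (p ∣ a) → ∀ k {c} → p ^ k ∣ a * c → p ^ k ∣ c
  p^k∣a*c⇒p^k∣c pr p∤a zero    {c} _ = 1∣ c
  p^k∣a*c⇒p^k∣c {p} {a} pr p∤a (suc k) {c} ps with euclidsLemma a c pr (m*n∣⇒m∣ p (p ^ k) ps)
  ... | inj₁ p∣a = contradiction p∣a p∤a
  ... | inj₂ (divides-refl q) = subst (p ^ suc k ∣_) (*-comm p q)
    (*-monoʳ-∣ p (p^k∣a*c⇒p^k∣c pr p∤a k (*-cancelˡ-∣ p {{prime⇒nonZero pr}}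
      (subst (p * p ^ k ∣_) (trans (sym (*-assoc a q p)) (*-comm (a * q) p)) ps))))

  p^k∣c∧a∣c⇒p^k*a∣c : ∀ {p a} → Prime p → ¬ (p ∣ a) → ∀ k {c} → p ^ k ∣ c → a ∣ c → p ^ k * a ∣ c
  p^k∣c∧a∣c⇒p^k*a∣c {p} {a} pr p∤a k p^k∣c (divides-refl q) =
    *-monoˡ-∣ a (p^k∣a*c⇒p^k∣c pr p∤a k (subst (p ^ k ∣_) (*-comm q a) p^k∣c))

  a∣p^k*c⇒a∣c : ∀ {p a} → Prime p → ¬ (p ∣ a) → ∀ k {c} → a ∣ p ^ k * c → a ∣ c
  a∣p^k*c⇒a∣c {p} {a} pr p∤a k {c} a∣ = *-cancelˡ-∣ (p ^ k) {{m^n≢0 p k {{prime⇒nonZero pr}}}}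
    (p^k∣c∧a∣c⇒p^k*a∣c pr p∤a k (m∣m*n c) a∣)

  primeFactor : ∀ {n} → 1 < n → ∃ λ p → Prime p × p ∣ n
  primeFactor {n} 1<n with factorise n {{>-nonZero (<-trans z<s 1<n)}}
  ... | record { factors = []     ; isFactorisation = n≡1 } = contradiction (sym n≡1) (<⇒≢ 1<n)
  ... | record { factors = p ∷ ps ; isFactorisation = n≡ ; factorsPrime = pr ∷ _ } =
    p , pr , subst (p ∣_) (sym n≡) (m∣m*n (product ps))

  splitPrimePower : ∀ {p} → Prime p → ∀ n .{{_ : NonZero n}} →
    ∃₂ λ j a → n ≡ p ^ j * a × ¬ (p ∣ a)
  splitPrimePower {p} pr n = go n (<-wellFounded n)
    where
    go : ∀ n .{{_ : NonZero n}} → Acc _<_ n → ∃₂ λ j a → n ≡ p ^ j * a × ¬ (p ∣ a)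
    go n (acc rec) with p ∣? n
    ... | no  p∤n = 0 , n , sym (*-identityˡ n) , p∤n
    ... | yes (divides q n≡) with go q {{q≢0}} (rec q<n)
      where
      q≢0 : NonZero q
      q≢0 = ≢-nonZero λ { refl → ≢-nonZero⁻¹ n n≡ }
      q<n : q < n
      q<n = subst (q <_) (sym n≡)
        (m<m*n q p {{q≢0}} (nonTrivial⇒n>1 p {{prime⇒nonTrivial pr}}))
    ...   | j , a , q≡ , p∤a = suc j , a ,
      trans n≡ (trans (cong (_* p) q≡) (trans (*-comm _ p) (sym (*-assoc p (p ^ j) a)))) , p∤a

  -- If the full `p`-part of `m` divides `n`, the cofactor prime to `p` cannot, since coprime
  -- divisors multiply; the search continues in the cofactor.
  ∤⇒primePower : ∀ {m n} .{{_ : NonZero m}} → ¬ (m ∣ n) →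
    ∃₂ λ p k → Prime p × p ^ k ∣ m × ¬ (p ^ k ∣ n)
  ∤⇒primePower {m} {n} = go m (<-wellFounded m)
    where
    go : ∀ m .{{_ : NonZero m}} → Acc _<_ m → ¬ (m ∣ n) →
      ∃₂ λ p k → Prime p × p ^ k ∣ m × ¬ (p ^ k ∣ n)
    go 1 _ 1∤n = contradiction (1∣ n) 1∤n
    go m@(suc (suc _)) (acc rec) m∤n with primeFactor {m} (s≤s z<s)
    ... | p , pr , p∣m with splitPrimePower pr m
    ...   | zero  , a , m≡ , p∤a = contradiction (subst (p ∣_) (trans m≡ (*-identityˡ a)) p∣m) p∤a
    ...   | suc k , a , m≡ , p∤a with p ^ suc k ∣? n
    ...     | no  p^k∤n = p , suc k , pr , divides a (trans m≡ (*-comm (p ^ suc k) a)) , p^k∤n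
    ...     | yes p^k∣n with go a {{a≢0}} (rec a<m) (λ a∣n → m∤n (subst (_∣ n) (sym m≡)
                               (p^k∣c∧a∣c⇒p^k*a∣c pr p∤a (suc k) p^k∣n a∣n)))
      where
      a≢0 : NonZero a
      a≢0 = ≢-nonZero λ { refl → p∤a (p ∣0) }
      a<m : a < m
      a<m = subst (a <_) (trans (*-comm a _) (sym m≡)) (m<m*n a (p ^ suc k) {{a≢0}}
        (^-monoʳ-< p (nonTrivial⇒n>1 p {{prime⇒nonTrivial pr}}) (z<s {k})))
    ...       | q , l , qr , q^l∣a , q^l∤n = q , l , qr ,
      ∣-trans q^l∣a (subst (a ∣_) (sym m≡) (n∣m*n (p ^ suc k))) , q^l∤n

-- Orders modulo a subgroup and the exponent of the quotient.

module FiniteAbelianGroup where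

  open import Algebra.Bundles using (AbelianGroup)
  open import Algebra.Core using (Op₁; Op₂)
  import Algebra.Properties.CommutativeMonoid.Mult as Mult
  import Algebra.Properties.Group as Group
  open import Algebra.Structures using (IsAbelianGroup)
  open import Data.Fin.Base as Fin using (Fin; zero; suc; toℕ)
  import Data.Fin.Properties as Fin
  open import Data.List.Extrema.Nat using (argmax; f[xs]≤f[argmax])
  open import Data.List.Membership.Propositional.Properties using (∈-allFin)
  open import Data.List.Base using (allFin)
  import Data.List.Relation.Unary.All as All
  open import Data.Nat.Base
  open import Data.Nat.Properties
  open import Data.Nat.Divisibility
  open import Data.Nat.DivMod
  open import Data.Product.Base using (∃; ∃₂; _×_; _,_; proj₁; proj₂)
  open import Function.Base using (_∘_)
  open import Level using (0ℓ)
  open import Relation.Binary.PropositionalEquality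
  open import Relation.Nullary using (¬_; yes; no; contradiction)
  open import Relation.Nullary.Decidable using (decidable-stable)
  open import Relation.Unary using (Pred; Decidable)
  open import Data.Nat.Primality using (Prime; prime⇒nonZero; prime⇒nonTrivial)
  open PrimePowers

  least : ∀ {P : Pred ℕ 0ℓ} → Decidable P → ∀ n → P n → ∃ λ m → P m × (∀ k → k < m → ¬ P k)
  least P? zero    p = 0 , p , λ _ ()
  least P? (suc n) p with P? 0
  ... | yes p₀ = 0 , p₀ , λ _ ()
  ... | no ¬p₀ with least (P? ∘ suc) n p
  ...   | m , pₘ , below = suc m , pₘ , λ where
    zero    _         → ¬p₀
    (suc k) (s≤s k<m) → below k k<m

  maximum : ∀ {n} → Fin n → (f : Fin n → ℕ) → ∃ λ i → ∀ j → f j ≤ f i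
  maximum {n} i f = argmax f i (allFin n) , λ j →
    All.lookup (f[xs]≤f[argmax] {f = f} i (allFin n)) (∈-allFin j)

  module Subgroups {N : ℕ} {_∙_ : Op₂ (Fin N)} {ε : Fin N} {_⁻¹ : Op₁ (Fin N)}
           (isAbelianGroup : IsAbelianGroup _≡_ _∙_ ε _⁻¹) where

    private
      G = Fin N

    abelianGroup : AbelianGroup 0ℓ 0ℓ
    abelianGroup = record { isAbelianGroup = isAbelianGroup }

    open AbelianGroup abelianGroup
      using (assoc; comm; identityˡ; identityʳ; inverseˡ; commutativeMonoid; group)
    open Mult commutativeMonoid
      using () renaming (_×_ to infixr 8 _⋆_; ×-homo-+ to ⋆-homo-+; ×-assocˡ to ⋆-assocˡ; ×-distrib-+ to ⋆-distrib-∙; ×-homo-1 to ⋆-identityˡ) public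
    open Group group using (∙-cancelˡ; inverseˡ-unique)

    ⋆-comm : ∀ m n x → m ⋆ n ⋆ x ≡ n ⋆ m ⋆ x
    ⋆-comm m n x = trans (⋆-assocˡ x m n) (trans (cong (_⋆ x) (*-comm m n)) (sym (⋆-assocˡ x n m)))

    ⋆-ε : ∀ n → n ⋆ ε ≡ ε
    ⋆-ε zero    = refl
    ⋆-ε (suc n) = trans (identityˡ (n ⋆ ε)) (⋆-ε n)

    -- Two of the `N + 1` multiples `0 ⋆ x`, ..., `N ⋆ x` coincide.
    torsion : ∀ x → ∃ λ n → suc n ⋆ x ≡ ε
    torsion x with Fin.pigeonhole (n<1+n N) (λ (i : Fin (suc N)) → toℕ i ⋆ x)
    ... | i , j , i<j , eq with m≤n⇒∃[o]m+o≡n i<j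
    ...   | o , i+o≡j = o , ∙-cancelˡ (toℕ i ⋆ x) _ _
      (trans (sym (⋆-homo-+ x (toℕ i) (suc o)))
        (trans (cong (_⋆ x) (trans (+-suc (toℕ i) o) i+o≡j)) (trans (sym eq) (sym (identityʳ _)))))

    -- Closure under inverses follows from torsion; decidability lets orders modulo `H` be found by
    -- search.
    record IsSubgroup (H : Pred G 0ℓ) : Set where
      field
        H?  : Decidable H
        ε∈  : H ε
        ∙∈  : ∀ {x y} → H x → H y → H (x ∙ y)

      ⋆∈ : ∀ n {x} → H x → H (n ⋆ x)
      ⋆∈ zero    _  = ε∈
      ⋆∈ (suc n) hx = ∙∈ hx (⋆∈ n hx)

      ⁻¹∈ : ∀ {x} → H x → H (x ⁻¹)
      ⁻¹∈ {x} hx with torsion x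
      ... | n , eq = subst H (inverseˡ-unique _ _ (trans (comm _ x) eq)) (⋆∈ n hx)

      cancelˡ∈ : ∀ {x y} → H x → H (x ∙ y) → H y
      cancelˡ∈ {x} {y} hx hxy = subst H
        (trans (sym (assoc (x ⁻¹) x y)) (trans (cong (_∙ y) (inverseˡ x)) (identityˡ y)))
        (∙∈ (⁻¹∈ hx) hxy)

      -- The order of `x` in the quotient by `H`, a quotient that is never formed.
      record HasOrder (x : G) (n : ℕ) : Set where
        constructor hasOrder
        field
          kill    : H (n ⋆ x)
          minimal : ∀ {c} → H (c ⋆ x) → n ∣ c

      open HasOrder public

      multiple∈ : ∀ {x n c} → HasOrder x n → n ∣ c → H (c ⋆ x)
      multiple∈ {x} {n} ox (divides-refl q) = subst H (⋆-assocˡ x q n) (⋆∈ q (kill ox))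

      order : ∀ x → ∃ λ n → HasOrder x (suc n)
      order x with torsion x
      ... | t , eq with least (λ c → H? (suc c ⋆ x)) t (subst H (sym eq) ε∈)
      ...   | n , hn , below = n , hasOrder hn λ {c} hc → m%n≡0⇒n∣m c (suc n) (remainder c hc)
        where
        remainder∈ : ∀ c → H (c ⋆ x) → H ((c % suc n) ⋆ x)
        remainder∈ c hc = cancelˡ∈ (⋆∈ (c / suc n) hn) (subst H
          (trans (cong (_⋆ x) (trans (m≡m%n+[m/n]*n c (suc n)) (+-comm (c % suc n) _)))
            (trans (⋆-homo-+ x (c / suc n * suc n) (c % suc n))
              (cong (_∙ ((c % suc n) ⋆ x)) (sym (⋆-assocˡ x (c / suc n) (suc n))))))
          hc)
        remainder : ∀ c → H (c ⋆ x) → c % suc n ≡ 0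
        remainder c hc with c % suc n | remainder∈ c hc | m%n<n c (suc n)
        ... | zero  | _  | _         = refl
        ... | suc r | hr | s≤s r<n = contradiction hr (below r r<n)

      ⋆-order : ∀ {x n a} d .{{_ : NonZero d}} → n ≡ d * a → HasOrder x n → HasOrder (d ⋆ x) a
      ⋆-order {x} {_} {a} d refl ox = hasOrder
        (subst H (trans (sym (⋆-assocˡ x d a)) (⋆-comm d a x)) (kill ox))
        λ {c} hc → *-cancelˡ-∣ d (subst (d * a ∣_) (*-comm c d) (minimal ox (subst H (⋆-assocˡ x c d) hc)))

      -- Multiplying a relation `c ⋆ (x ∙ y)` by `a` removes `x` modulo `H`, and by `p ^ k` removes
      -- `y`; coprimality then puts both orders into `c`.
      ∙-order : ∀ {x y a p} k → Prime p → ¬ (p ∣ a) →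
        HasOrder x a → HasOrder y (p ^ k) → HasOrder (x ∙ y) (p ^ k * a)
      ∙-order {x} {y} {a} {p} k pr p∤a ox oy = hasOrder
        (subst H (sym (⋆-distrib-∙ x y (p ^ k * a)))
          (∙∈ (multiple∈ ox (n∣m*n (p ^ k))) (multiple∈ oy (m∣m*n a))))
        λ {c} hc →
          let split d = subst H (trans (⋆-assocˡ (x ∙ y) d c) (⋆-distrib-∙ x y (d * c))) (⋆∈ d hc) in
          p^k∣c∧a∣c⇒p^k*a∣c pr p∤a k
            (p^k∣a*c⇒p^k∣c pr p∤a k (minimal oy (cancelˡ∈ (multiple∈ ox (m∣m*n c)) (split a))))
            (a∣p^k*c⇒a∣c pr p∤a k (minimal ox (cancelˡ∈ (multiple∈ oy (m∣m*n c))
              (subst H (comm _ _) (split (p ^ k))))))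

      -- Some `p ^ k` divides `m` but not `n`. A multiple of `y` of order `p ^ k` and a multiple of
      -- `x` whose order is the part of `n` prime to `p` combine to a larger order.
      larger-order : ∀ {x y n m} .{{_ : NonZero n}} .{{_ : NonZero m}} →
        HasOrder x n → HasOrder y m → ¬ (m ∣ n) → ∃₂ λ z l → HasOrder z l × n < l
      larger-order {x} {y} {n} {m} ox oy m∤n with ∤⇒primePower {m} {n} m∤n
      ... | p , k , pr , divides q m≡ , p^k∤n with splitPrimePower pr n
      ...   | j , a , n≡ , p∤a = _ , _ ,
        ∙-order k pr p∤a (⋆-order (p ^ j) n≡ ox) (⋆-order q m≡ oy) ,
        subst (_< p ^ k * a) (sym n≡) (*-monoˡ-< a (^-monoʳ-< p 1<p j<k))
        where
        instance
          p≢0 = prime⇒nonZero pr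
          p^j≢0 = m^n≢0 p j
          a≢0 : NonZero a
          a≢0 = ≢-nonZero λ { refl → p∤a (p ∣0) }
          q≢0 : NonZero q
          q≢0 = ≢-nonZero λ { refl → ≢-nonZero⁻¹ m m≡ }
        1<p : 1 < p
        1<p = nonTrivial⇒n>1 p {{prime⇒nonTrivial pr}}
        j<k : j < k
        j<k = ≰⇒> λ k≤j → p^k∤n (subst (p ^ k ∣_) (sym n≡) (∣-trans
          (subst (p ^ k ∣_) (trans (sym (^-distribˡ-+-* p k (j ∸ k))) (cong (p ^_) (m+[n∸m]≡n k≤j)))
            (m∣m*n (p ^ (j ∸ k)))) (m∣m*n a)))

      maximal-order : ∀ {x y n m} → HasOrder x (suc n) → HasOrder y (suc m) →
        (∀ {z l} → HasOrder z l → l ≤ suc n) → H (suc n ⋆ y)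
      maximal-order {x} {y} {n} {m} ox oy max = multiple∈ oy
        (decidable-stable (suc m ∣? suc n) λ m∤n →
          let z , l , oz , n<l = larger-order {x} {y} {suc n} {suc m} ox oy m∤n in <⇒≱ n<l (max oz))

      order-unique : ∀ {z l m} → HasOrder z l → HasOrder z (suc m) → l ≤ suc m
      order-unique {m = m} oz oz′ = ∣⇒≤ (minimal oz {suc m} (kill oz′))

      -- By `larger-order`, every order modulo `H` divides the maximal one.
      exponent : ∃₂ λ x n → HasOrder x (suc n) × (∀ y → H (suc n ⋆ y))
      exponent = x , ord x , hasOrd x , λ y → maximal-order (hasOrd x) (hasOrd y)
        λ {z} oz → ≤-trans (order-unique oz (hasOrd z)) (s≤s (max z))
        where
        ord : G → ℕ
        ord y = proj₁ (order y)
        hasOrd : ∀ y → HasOrder y (suc (ord y))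
        hasOrd y = proj₂ (order y)
        x : G
        x = proj₁ (maximum ε ord)
        max : ∀ y → ord y ≤ ord x
        max = proj₂ (maximum ε ord)

-- Splitting a finite abelian group into cyclic factors.

module CyclicDecomposition where

  open import Algebra.Bundles using (AbelianGroup)
  open import Algebra.Core using (Op₁; Op₂)
  import Algebra.Properties.CommutativeSemigroup as CommutativeSemigroup
  import Algebra.Properties.Group as Group
  open import Algebra.Structures using (IsAbelianGroup)
  open import Data.Fin.Base as Fin using (Fin; zero; suc; toℕ; fromℕ<)
  import Data.Fin.Properties as Fin
  open import Data.List.Base using (List; []; _∷_; length; lookup)
  open import Data.Nat.Base
  open import Data.Nat.Properties
  open import Data.Nat.Divisibility
  open import Data.Nat.DivMod
  open import Data.Product.Base using (∃; ∃₂; _×_; _,_; proj₁; proj₂)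
  open import Data.Sum.Base using (inj₁; inj₂)
  import Data.Vec.Functional as Vec
  open import Data.Bool.Base using (if_then_else_)
  open import Function.Base using (_∘_)
  open import Level using (0ℓ)
  open import Relation.Binary.PropositionalEquality
  open import Relation.Nullary using (¬_; yes; no; does; contradiction)
  open import Relation.Nullary.Decidable using (map′; decidable-stable)
  open import Relation.Unary using (Pred; Decidable)
  open FiniteAbelianGroup
  open Preliminaries

  unit : ∀ {r} → Fin r → ℕ → Fin r → ℕ
  unit i c j = if does (i Fin.≟ j) then c else 0

  unit-same : ∀ {r} (i : Fin r) c → unit i c i ≡ c
  unit-same i c = if-yes (i Fin.≟ i) refl

  unit-other : ∀ {r} {i j : Fin r} c → i ≢ j → unit i c j ≡ 0
  unit-other {i = i} {j} c = if-no (i Fin.≟ j)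

  -- An isomorphism with a product of cyclic groups; coordinates are only
  -- meaningful modulo the orders.
  record Decomposition {N : ℕ} (_∙_ : Op₂ (Fin N)) : Set where
    field
      rank        : ℕ
      order       : Fin rank → ℕ
      2≤order     : ∀ i → 2 ≤ order i
      combination : (Fin rank → ℕ) → Fin N
      coordinate  : Fin N → Fin rank → ℕ

    instance
      order≢0 : ∀ {i} → NonZero (order i)
      order≢0 {i} = >-nonZero (<-trans z<s (2≤order i))

    field
      coordinate-∙ : ∀ x b i →
        coordinate (x ∙ combination b) i % order i ≡ (coordinate x i + b i) % order i
      coordinate-injective : ∀ {x y} →
        (∀ i → coordinate x i % order i ≡ coordinate y i % order i) → x ≡ y

  module _ {N : ℕ} {_∙_ : Op₂ (Fin N)} {ε : Fin N} {_⁻¹ : Op₁ (Fin N)}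
           (isAbelianGroup : IsAbelianGroup _≡_ _∙_ ε _⁻¹) where

    open Subgroups isAbelianGroup
    open IsSubgroup
    open AbelianGroup abelianGroup
      using (assoc; comm; identityˡ; identityʳ; inverseʳ; inverseˡ; group)
    open Group group using (∙-cancelˡ)
    open CommutativeSemigroup (AbelianGroup.commutativeSemigroup abelianGroup) using (interchange)

    private
      G = Fin N

    Generators : Set
    Generators = List (G × ℕ)

    ordᵢ : (L : Generators) → Fin (length L) → ℕ
    ordᵢ L i = proj₂ (lookup L i)

    comb : (L : Generators) → (Fin (length L) → ℕ) → G
    comb []            a = ε
    comb ((g , _) ∷ L) a = (a zero ⋆ g) ∙ comb L (a ∘ suc)

    comb-+ : ∀ L a b → comb L (λ i → a i + b i) ≡ comb L a ∙ comb L b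
    comb-+ []            a b = sym (identityˡ ε)
    comb-+ ((g , _) ∷ L) a b = trans
      (cong₂ _∙_ (⋆-homo-+ g (a zero) (b zero)) (comb-+ L (a ∘ suc) (b ∘ suc)))
      (interchange _ _ _ _)

    comb-0 : ∀ L → comb L (λ _ → 0) ≡ ε
    comb-0 []      = refl
    comb-0 (_ ∷ L) = trans (identityˡ _) (comb-0 L)

    Span : Generators → Pred G 0ℓ
    Span L x = ∃ λ a → comb L a ≡ x

    weaken : ∀ {g n L x} → Span L x → Span ((g , n) ∷ L) x
    weaken (a , eq) = 0 Vec.∷ a , trans (identityˡ _) eq

    -- The newest generator comes first. Its order is `n` both in the group and modulo the span of
    -- the older ones, so the sum is direct. That `n` also kills the whole quotient by that span
    -- makes later orders divide earlier ones, as `lift` requires.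
    data Independent : Generators → Set where
      []  : Independent []
      add : ∀ {g n L} → 2 ≤ n → n ⋆ g ≡ ε → (∀ {c} → Span L (c ⋆ g) → n ∣ c) →
            (∀ x → Span L (n ⋆ x)) → Independent L → Independent ((g , n) ∷ L)

    multiples-≡ : ∀ {g n c d} .{{_ : NonZero n}} → n ⋆ g ≡ ε → c % n ≡ d % n → c ⋆ g ≡ d ⋆ g
    multiples-≡ {g} {n} {c} {d} ng≡ε c≡d = trans (reduce c) (trans (cong (_⋆ g) c≡d) (sym (reduce d)))
      where
      reduce : ∀ c → c ⋆ g ≡ (c % n) ⋆ g
      reduce c = trans (cong (_⋆ g) (m≡m%n+[m/n]*n c n))
        (trans (⋆-homo-+ g (c % n) (c / n * n)) (trans (cong (((c % n) ⋆ g) ∙_)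
          (trans (sym (⋆-assocˡ g (c / n) n)) (trans (cong ((c / n) ⋆_) ng≡ε) (⋆-ε (c / n)))))
          (identityʳ _)))

    difference : ∀ {x y z} → x ∙ y ≡ z → z ∙ (x ⁻¹) ≡ y
    difference {x} {y} {z} eq = trans (cong (_∙ (x ⁻¹)) (trans (sym eq) (comm x y)))
      (trans (assoc y x (x ⁻¹)) (trans (cong (y ∙_) (inverseʳ x)) (identityʳ y)))

    undifference : ∀ {x y z} → z ∙ (x ⁻¹) ≡ y → x ∙ y ≡ z
    undifference {x} {y} {z} eq = trans (comm x y) (trans (cong (_∙ x) (sym eq))
      (trans (assoc z (x ⁻¹) x) (trans (cong (z ∙_) (inverseˡ x)) (identityʳ z))))

    -- The coefficient of `g` matters only modulo `n`, so finitely many are tried.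
    Span? : ∀ {L} → Independent L → Decidable (Span L)
    Span? []                            x = map′ (λ eq → (λ ()) , eq) proj₂ (ε Fin.≟ x)
    Span? (add {g} {n} {L} 2≤n ng≡ε _ _ ind) x =
      map′ to from (Fin.any? λ (c : Fin n) → Span? ind (x ∙ ((toℕ c ⋆ g) ⁻¹)))
      where
      instance
        n≢0 : NonZero n
        n≢0 = >-nonZero (<-trans z<s 2≤n)
      to : (∃ λ (c : Fin n) → Span L (x ∙ ((toℕ c ⋆ g) ⁻¹))) → Span ((g , n) ∷ L) x
      to (c , a , eq) = toℕ c Vec.∷ a , undifference (sym eq)
      from : Span ((g , n) ∷ L) x → ∃ λ (c : Fin n) → Span L (x ∙ ((toℕ c ⋆ g) ⁻¹))
      from (a , eq) = fromℕ< (m%n<n (a zero) n) , a ∘ suc , sym (difference (trans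
        (cong (_∙ comb L (a ∘ suc)) (multiples-≡ {g} ng≡ε (trans
          (cong (_% n) (Fin.toℕ-fromℕ< (m%n<n (a zero) n))) (m%n%n≡m%n (a zero) n)))) eq))

    span : ∀ {L} → Independent L → IsSubgroup (Span L)
    span {L} ind = record
      { H? = Span? ind
      ; ε∈ = (λ _ → 0) , comb-0 L
      ; ∙∈ = λ (a , ea) (b , eb) → _ , trans (comb-+ L a b) (cong₂ _∙_ ea eb)
      }

    ordᵢ-kills : ∀ {L} → Independent L → ∀ i x → Span L (ordᵢ L i ⋆ x)
    ordᵢ-kills (add {g} {n} {L} _ _ _ kills _)   zero    x = weaken {g} {n} {L} (kills x)
    ordᵢ-kills (add {g} {n} {L} _ _ _ _     ind) (suc i) x = weaken {g} {n} {L} (ordᵢ-kills ind i x)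

    2≤ordᵢ : ∀ {L} → Independent L → ∀ i → 2 ≤ ordᵢ L i
    2≤ordᵢ (add 2≤n _ _ _ _)   zero    = 2≤n
    2≤ordᵢ (add _   _ _ _ ind) (suc i) = 2≤ordᵢ ind i

    -- The earlier orders being multiples of n, a coset that n kills modulo the
    -- span contains an element that n kills in the group.
    lift : ∀ {L} → Independent L → ∀ n .{{_ : NonZero n}} → (∀ i → n ∣ ordᵢ L i) → ∀ {y} → Span L (n ⋆ y) →
      ∃₂ λ z h → n ⋆ z ≡ ε × Span L h × z ∙ h ≡ y
    lift [] n _ {y} (_ , eq) = y , ε , sym eq , ((λ _ → 0) , refl) , identityʳ y
    lift (add {g} {n₁} {L} 2≤n₁ n₁g≡ε min kills ind) n n∣ {y} (a , eq) with n∣ zero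
    -- With `n₁ = d * n`, the element `d ⋆ n ⋆ y` lies in the span of the older generators. So does
    -- `(d * a zero) ⋆ g`, hence `n₁` divides `d * a zero` and `n` divides `a zero`.
    ... | divides d n₁≡ = split (*-cancelˡ-∣ d (subst (_∣ d * a zero) n₁≡ (min {d * a zero} da₀g∈)))
      where
      h = comb L (a ∘ suc)
      instance
        d≢0 : NonZero d
        d≢0 = ≢-nonZero λ { refl → contradiction (subst (2 ≤_) n₁≡ 2≤n₁) λ () }
      da₀g∈ : Span L ((d * a zero) ⋆ g)
      da₀g∈ = cancelˡ∈ (span ind) (⋆∈ (span ind) d (a ∘ suc , refl)) (subst (Span L)
        (trans (cong (_⋆ y) n₁≡) (trans (sym (⋆-assocˡ y d n)) (trans (cong (d ⋆_) (sym eq))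
          (trans (⋆-distrib-∙ (a zero ⋆ g) h d)
            (trans (comm _ _) (cong ((d ⋆ h) ∙_) (⋆-assocˡ g d (a zero))))))))
        (kills y))
      split : n ∣ a zero → ∃₂ λ z h → n ⋆ z ≡ ε × Span ((g , n₁) ∷ L) h × z ∙ h ≡ y
      -- Subtracting `b ⋆ g` from `y` removes the `g`-part of `n ⋆ y` and leaves a problem about the
      -- older generators.
      split (divides b a₀≡) with lift ind n (n∣ ∘ suc) {y ∙ ((b ⋆ g) ⁻¹)} (a ∘ suc , sym ny₁≡h)
        where
        ny₁≡h : n ⋆ (y ∙ ((b ⋆ g) ⁻¹)) ≡ h
        ny₁≡h = ∙-cancelˡ (a zero ⋆ g) _ _ (trans
          (cong (_∙ (n ⋆ (y ∙ ((b ⋆ g) ⁻¹)))) (trans (cong (_⋆ g) (trans a₀≡ (*-comm b n))) (sym (⋆-assocˡ g n b))))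
          (trans (sym (⋆-distrib-∙ (b ⋆ g) (y ∙ ((b ⋆ g) ⁻¹)) n))
            (trans (cong (n ⋆_) (undifference refl)) (sym eq))))
      ... | z , h′ , nz≡ε , (a′ , eq′) , zh′≡ = z , (b ⋆ g) ∙ h′ , nz≡ε ,
        (b Vec.∷ a′ , cong ((b ⋆ g) ∙_) eq′) ,
        trans (sym (assoc z _ h′)) (trans (cong (_∙ h′) (comm z (b ⋆ g)))
          (trans (assoc _ z h′) (undifference (sym zh′≡))))

    comb-injective : ∀ {L} → Independent L → ∀ {a b} → comb L a ≡ comb L b →
      ∀ i .{{_ : NonZero (ordᵢ L i)}} → a i % ordᵢ L i ≡ b i % ordᵢ L i
    comb-injective (add {g} {n} {L} 2≤n ng≡ε min _ ind) {a} {b} eq = λ where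
        zero    → a₀≡b₀
        (suc i) → comb-injective ind {a ∘ suc} {b ∘ suc} (∙-cancelˡ (a zero ⋆ g) _ _
          (trans eq (cong (_∙ comb L (b ∘ suc)) (multiples-≡ {g} {n} {b zero} {a zero} ng≡ε (sym a₀≡b₀))))) i
      where
      instance
        n≢0 : NonZero n
        n≢0 = >-nonZero (<-trans z<s 2≤n)
      -- Coefficients are natural numbers, so the smaller leading one is taken from the larger. The
      -- difference times `g` lies in the span of the rest, so `n` divides the difference.
      below : ∀ {a b} → comb ((g , n) ∷ L) a ≡ comb ((g , n) ∷ L) b → b zero ≤ a zero → a zero % n ≡ b zero % n
      below {a} {b} eq b₀≤a₀ with min {a zero ∸ b zero} (cancelˡ∈ (span ind) (a ∘ suc , refl) (b ∘ suc , sym cancelled))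
        where
        cancelled : comb L (a ∘ suc) ∙ ((a zero ∸ b zero) ⋆ g) ≡ comb L (b ∘ suc)
        cancelled = ∙-cancelˡ (b zero ⋆ g) _ _ (trans (cong ((b zero ⋆ g) ∙_) (comm _ _))
          (trans (sym (assoc _ _ _)) (trans (cong (_∙ comb L (a ∘ suc))
            (trans (sym (⋆-homo-+ g (b zero) (a zero ∸ b zero))) (cong (_⋆ g) (m+[n∸m]≡n b₀≤a₀)))) eq)))
      ... | divides q q≡ = trans (cong (_% n) (trans (sym (m+[n∸m]≡n b₀≤a₀)) (cong (b zero +_) q≡)))
        ([m+kn]%n≡m%n (b zero) q n)
      a₀≡b₀ : a zero % n ≡ b zero % n
      a₀≡b₀ with ≤-total (b zero) (a zero)
      ... | inj₁ b≤a = below {a} {b} eq b≤a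
      ... | inj₂ a≤b = sym (below {b} {a} (sym eq) a≤b)

    comb-cong : ∀ {L} → Independent L → ∀ {a b} →
      (∀ i .{{_ : NonZero (ordᵢ L i)}} → a i % ordᵢ L i ≡ b i % ordᵢ L i) → comb L a ≡ comb L b
    comb-cong [] _ = refl
    comb-cong (add {g} {n} 2≤n ng≡ε _ _ ind) {a} {b} a≡b =
      cong₂ _∙_ (multiples-≡ {g} {n} {a zero} {b zero} ng≡ε (a≡b zero)) (comb-cong ind {a ∘ suc} {b ∘ suc} (λ i → a≡b (suc i)))
      where
      instance
        n≢0 : NonZero n
        n≢0 = >-nonZero (<-trans z<s 2≤n)

    -- Independent generators are pairwise distinct elements; this bounds how often the list can
    -- grow.
    length≤N : ∀ {L} → Independent L → length L ≤ N
    length≤N {L} ind = Fin.injective⇒≤ {f = λ i → comb L (unit i 1)} injective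
      where
      injective : ∀ {i j} → comb L (unit i 1) ≡ comb L (unit j 1) → i ≡ j
      injective {i} {j} eq = decidable-stable (i Fin.≟ j) λ i≢j → contradiction (begin
        1                             ≡⟨ m<n⇒m%n≡m (2≤ordᵢ ind i) ⟨
        1 % ordᵢ L i                  ≡⟨ cong (_% ordᵢ L i) (unit-same i 1) ⟨
        unit i 1 i % ordᵢ L i         ≡⟨ comb-injective ind {unit i 1} {unit j 1} eq i ⟩
        unit j 1 i % ordᵢ L i         ≡⟨ cong (_% ordᵢ L i) (unit-other 1 (i≢j ∘ sym)) ⟩
        0 % ordᵢ L i                  ≡⟨ m<n⇒m%n≡m (<-trans z<s (2≤ordᵢ ind i)) ⟩
        0                             ∎) λ ()
        where
        open ≡-Reasoning
        instance
          n≢0 : NonZero (ordᵢ L i)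
          n≢0 = >-nonZero (<-trans z<s (2≤ordᵢ ind i))

    -- `suc n`, the order of `y` in the quotient, divides every earlier order, so `lift` can change
    -- `y` within its coset into an element with that order in the group.
    adjoin : ∀ {L} (ind : Independent L) {y n} → HasOrder (span ind) y (suc n) →
      (∀ x → Span L (suc n ⋆ x)) → ∀ {x} → ¬ Span L x → ∃₂ λ g n → Independent ((g , n) ∷ L)
    adjoin {L} ind {y} {n} oy kills {x} x∉
      with lift ind (suc n) (λ i → minimal oy {ordᵢ L i} (ordᵢ-kills ind i y)) {y} (kill oy)
    ... | z , h , nz≡ε , h∈ , zh≡y = z , suc n , add (s≤s (n≢0⇒n>0 n≢0)) nz≡ε
      (λ {c} cz∈ → minimal oy {c} (subst (Span L) (trans (sym (⋆-distrib-∙ z h c)) (cong (c ⋆_) zh≡y))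
        (∙∈ (span ind) cz∈ (⋆∈ (span ind) c h∈))))
      kills ind
      where
      -- Order 1 would put every element, in particular `x`, into the span.
      n≢0 : n ≢ 0
      n≢0 refl = x∉ (subst (Span L) (⋆-identityˡ x) (kills x))

    extend : ∀ {L} → Independent L → ∀ {x} → ¬ Span L x → ∃₂ λ g n → Independent ((g , n) ∷ L)
    extend ind x∉ = let _ , _ , oy , kills = exponent (span ind) in adjoin ind oy kills x∉

    -- `f` is fuel: by `length≤N` it cannot run out before the span is the whole group.
    completion : ∀ f {L} → Independent L → N < f + length L → ∃ λ L → Independent L × (∀ x → Span L x)
    completion zero        ind N< = contradiction (length≤N ind) (<⇒≱ N<)
    completion (suc f) {L} ind N< with Fin.all? (Span? ind)
    ... | yes all  = L , ind , all
    ... | no ¬all  =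
      let _ , x∉ = Fin.¬∀⟶∃¬ N (Span L) (Span? ind) ¬all
          _ , _ , ind′ = extend ind x∉
      in completion f ind′ (subst (N <_) (sym (+-suc f (length L))) N<)

    decomposition : Decomposition _∙_
    decomposition = fromTotal (completion (suc N) [] (m≤m+n (suc N) 0))
      where
      fromTotal : (∃ λ L → Independent L × (∀ x → Span L x)) → Decomposition _∙_
      fromTotal (L , ind , total) = record
        { rank        = length L
        ; order       = ordᵢ L
        ; 2≤order     = 2≤ordᵢ ind
        ; combination = comb L
        ; coordinate  = coordinate
        ; coordinate-∙ = λ x b i → comb-injective ind
            {coordinate (x ∙ comb L b)} {λ i → coordinate x i + b i}
            (trans (comb-coordinate (x ∙ comb L b)) (sym (trans (comb-+ L (coordinate x) b)
              (cong (_∙ comb L b) (comb-coordinate x))))) i {{>-nonZero (<-trans z<s (2≤ordᵢ ind i))}}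
        ; coordinate-injective = λ {x} {y} eq → trans (sym (comb-coordinate x))
            (trans (comb-cong ind {coordinate x} {coordinate y} (λ i → eq i)) (comb-coordinate y))
        }
        where
        coordinate : G → Fin (length L) → ℕ
        coordinate x = proj₁ (total x)
        comb-coordinate : ∀ x → comb L (coordinate x) ≡ x
        comb-coordinate x = proj₂ (total x)

-- The family of powers of generators, with its separating waves.

module SeparatedFamily where
  open import Algebra.Core using (Op₁; Op₂)
  import Algebra.Properties.CommutativeMonoid.Sum as Sum
  open import Algebra.Structures using (IsAbelianGroup)
  open import Data.Bool.Base using (Bool)
  open import Data.Fin.Base using (Fin; zero; suc; toℕ; fromℕ<; combine)
  open import Data.Fin.Permutation using (Permutation; permutation)
  import Data.Fin.Properties as Fin
  open import Data.List.Base using (List; length; map; concat; tabulate; applyUpTo)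
  open import Data.List.Membership.Propositional using (_∈_)
  open import Data.List.Membership.Propositional.Properties using (∈-concat⁻′; ∈-tabulate⁻; ∈-applyUpTo⁻)
  open import Data.List.Properties using (length-++; length-applyUpTo; map-++)
  open import Data.Nat.Base
  open import Data.Nat.DivMod
  open import Data.Nat.ListAction using () renaming (sum to total)
  open import Data.Nat.ListAction.Properties using (sum-++)
  open import Data.Nat.Properties
  open import Data.Nat.Tactic.RingSolver using (solve-∀)
  open import Data.Product.Base using (∃; _×_; _,_; proj₁; proj₂)
  open import Data.Sum.Base using (_⊎_; inj₁; inj₂)
  import Data.Vec.Functional as Vec
  open import Function.Base using (_∘_)
  open import Relation.Binary.PropositionalEquality
  open Preliminaries
  open SquareWave
  open CyclicDecomposition using (Decomposition; module Decomposition; decomposition; unit; unit-same; unit-other)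
  open Sum +-0-commutativeMonoid using (sum; sum-cong-≗; sum-replicate-zero; ∑-distrib-+; sum-permute)

  sum-∑<-comm : ∀ {k} n (f : Fin k → ℕ → ℕ) →
    sum (λ x → ∑< n (f x)) ≡ ∑< n (λ c → sum (λ x → f x c))
  sum-∑<-comm {k} zero    f = sum-replicate-zero k
  sum-∑<-comm     (suc n) f = trans (∑-distrib-+ (λ x → ∑< n (f x)) (λ x → f x n))
    (cong (_+ sum (λ x → f x n)) (sum-∑<-comm n f))

  sum-const : ∀ k c → sum {k} (λ _ → c) ≡ k * c
  sum-const zero    c = refl
  sum-const (suc k) c = cong (c +_) (sum-const k c)

  ∑<-const : ∀ n c → ∑< n (λ _ → c) ≡ n * c
  ∑<-const zero    c = refl
  ∑<-const (suc n) c = trans (cong (_+ c) (∑<-const n c)) (+-comm (n * c) c)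

  *-distribˡ-∑< : ∀ a n f → a * ∑< n f ≡ ∑< n (λ c → a * f c)
  *-distribˡ-∑< a zero    f = *-zeroʳ a
  *-distribˡ-∑< a (suc n) f = trans (*-distribˡ-+ a (∑< n f) (f n)) (cong (_+ a * f n) (*-distribˡ-∑< a n f))

  sum-map-concat : ∀ {A : Set} (f : A → ℕ) {k} (xss : Fin k → List A) →
    total (map f (concat (tabulate xss))) ≡ sum (λ i → total (map f (xss i)))
  sum-map-concat f {zero}  xss = refl
  sum-map-concat f {suc k} xss = trans
    (cong total (map-++ f (xss zero) (concat (tabulate (xss ∘ suc)))))
    (trans (sum-++ (map f (xss zero)) _) (cong (total (map f (xss zero)) +_) (sum-map-concat f (xss ∘ suc))))

  length-concat-tabulate : ∀ {A : Set} {k} (xss : Fin k → List A) →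
    length (concat (tabulate xss)) ≡ sum (length ∘ xss)
  length-concat-tabulate {k = zero}  xss = refl
  length-concat-tabulate {k = suc k} xss = trans (length-++ (xss zero))
    (cong (length (xss zero) +_) (length-concat-tabulate (xss ∘ suc)))

  sum-map-applyUpTo : ∀ {A : Set} (f : A → ℕ) (g : ℕ → A) k →
    total (map f (applyUpTo g k)) ≡ ∑< k (f ∘ g)
  sum-map-applyUpTo f g zero    = refl
  sum-map-applyUpTo f g (suc k) = trans (cong (f (g 0) +_) (sum-map-applyUpTo f (g ∘ suc) k))
    (sym (∑<-suc k (f ∘ g)))

  ∏ : ∀ {k} → (Fin k → ℕ) → ℕ
  ∏ = Vec.foldr _*_ 1

  -- Mixed-radix encoding; its injectivity bounds `N` by the product of the orders.
  tuple : ∀ {k} {n : Fin k → ℕ} → (∀ i → Fin (n i)) → Fin (∏ n)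
  tuple {zero}  a = zero
  tuple {suc k} a = combine (a zero) (tuple (λ i → a (suc i)))

  tuple-injective : ∀ {k} {n : Fin k → ℕ} (a b : ∀ i → Fin (n i)) → tuple a ≡ tuple b → ∀ i → a i ≡ b i
  tuple-injective {suc k} a b eq zero    = proj₁ (Fin.combine-injective (a zero) _ (b zero) _ eq)
  tuple-injective {suc k} a b eq (suc i) = tuple-injective (λ i → a (suc i)) (λ i → b (suc i))
    (proj₂ (Fin.combine-injective (a zero) _ (b zero) _ eq)) i

  ∏-≤-^ : ∀ b {k} (n d : Fin k → ℕ) → (∀ i → n i ≤ b ^ (2 * d i)) → ∏ n ≤ b ^ (2 * sum d)
  ∏-≤-^ b {zero}  n d n≤ = ≤-refl
  ∏-≤-^ b {suc k} n d n≤ = ≤-trans (*-mono-≤ (n≤ zero) (∏-≤-^ b (n ∘ suc) (d ∘ suc) (n≤ ∘ suc)))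
    (≤-reflexive (trans (sym (^-distribˡ-+-* b (2 * d zero) _))
      (cong (b ^_) (sym (*-distribˡ-+ 2 (d zero) (sum (d ∘ suc)))))))

  logarithm : ∀ {b} → 2 ≤ b → ∀ n .{{_ : NonZero n}} → ∃ λ k → b ^ k ≤ n × n < b ^ suc k
  logarithm {b} 2≤b 1 = 0 , ≤-refl , subst (1 <_) (sym (*-identityʳ b)) 2≤b
  logarithm {b} 2≤b (suc n@(suc _)) with logarithm 2≤b n
  ... | k , ≤n , n< with m≤n⇒m<n∨m≡n n<
  ...   | inj₁ 1+n< = k , m≤n⇒m≤1+n ≤n , 1+n<
  ...   | inj₂ 1+n≡ = suc k , ≤-reflexive (sym 1+n≡) ,
    subst (_< b ^ (2 + k)) (sym 1+n≡) (^-monoʳ-< b 2≤b (n<1+n (suc k)))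

  -- From `n < b ^ (k + 1)` the first bound follows once `k ≥ 1`. A logarithm 0 is raised to 1,
  -- which keeps the first bound and gives up `b ^ k ≤ n`.
  digits : ∀ {b} → 2 ≤ b → ∀ n .{{_ : NonZero n}} →
    ∃ λ k → n ≤ b ^ (2 * k) × (k ≡ 1 ⊎ b ^ k ≤ n)
  digits {b} 2≤b n with logarithm 2≤b n
  ... | zero  , _  , n< = 1 , ≤-trans (<⇒≤ n<) (^-monoʳ-≤ b {{>-nonZero (<-trans z<s 2≤b)}} {1} {2} (s≤s z≤n)) , inj₁ refl
  ... | suc k , ≤n , n< = suc k , ≤-trans (<⇒≤ n<) (^-monoʳ-≤ b {{>-nonZero (<-trans z<s 2≤b)}}
    {2 + k} {2 * suc k} (+-mono-≤ (s≤s z≤n) (m≤m+n (suc k) 0))) , inj₂ ≤n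

  module _ {N : ℕ} {_∙_ : Op₂ (Fin N)} where

    flipsBy : (Fin N → Bool) → Fin N → ℕ
    flipsBy S g = sum (λ x → dist (S x) (S (x ∙ g)))

    -- The total includes `h` itself, hence `m + 7`: a 7 remains once the share of `h` is moved
    -- across.
    Separated : ℕ → List (Fin N) → Set
    Separated m xs = ∀ {h} → h ∈ xs → ∃ λ S → m * total (map (flipsBy S) xs) < (m + 7) * flipsBy S h

  module _ {N : ℕ} {_∙_ : Op₂ (Fin N)} {ε : Fin N} {_⁻¹ : Op₁ (Fin N)}
           (isAbelianGroup : IsAbelianGroup _≡_ _∙_ ε _⁻¹) where

    open IsAbelianGroup isAbelianGroup using (assoc; identityʳ; inverseˡ; inverseʳ)

    translation : Fin N → Permutation N N
    translation g = permutation (_∙ g) (_∙ (g ⁻¹))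
      (λ x → trans (assoc x (g ⁻¹) g) (trans (cong (x ∙_) (inverseˡ g)) (identityʳ x)))
      (λ x → trans (assoc x g (g ⁻¹)) (trans (cong (x ∙_) (inverseʳ g)) (identityʳ x)))

  module _ {N : ℕ} {_∙_ : Op₂ (Fin N)} {ε : Fin N} {_⁻¹ : Op₁ (Fin N)}
           (isAbelianGroup : IsAbelianGroup _≡_ _∙_ ε _⁻¹) (D : Decomposition _∙_) where

    open Decomposition D

    private
      instance
        N≢0 : NonZero N
        N≢0 = Fin.nonZeroIndex ε

      flipsᴳ = flipsBy {_∙_ = _∙_}

    -- Averaging over the translates by the i-th generator: the residues of the
    -- i-th coordinate are equidistributed.
    average : ∀ i (F : ℕ → ℕ) →
      order i * sum (λ x → F (coordinate x i % order i)) ≡ N * ∑< (order i) (λ c → F (c % order i))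
    average i F = begin
      n * sum (λ x → f (φ x))                            ≡⟨ ∑<-const n _ ⟨
      ∑< n (λ _ → sum (λ x → f (φ x)))                   ≡⟨ ∑<-cong n translate ⟩
      ∑< n (λ c → sum (λ x → f (c + φ x)))               ≡⟨ sum-∑<-comm n (λ x c → f (c + φ x)) ⟨
      sum (λ x → ∑< n (λ c → f (c + φ x)))               ≡⟨ sum-cong-≗ (λ x → ∑<-shift n periodic (φ x)) ⟩
      sum {N} (λ _ → ∑< n f)                             ≡⟨ sum-const N _ ⟩
      N * ∑< n f                                         ∎
      where
      open ≡-Reasoning
      n = order i
      φ : Fin N → ℕ
      φ x = coordinate x i
      f : ℕ → ℕ
      f c = F (c % n)
      periodic : Periodic n f
      periodic c = cong F ([m+n]%n≡m%n c n)
      translate : ∀ c → sum (λ x → f (φ x)) ≡ sum (λ x → f (c + φ x))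
      translate c = trans (sum-permute (λ x → f (φ x)) (translation isAbelianGroup (combination (unit i c))))
        (sum-cong-≗ λ x → cong F (trans (coordinate-∙ x (unit i c) i)
          (cong (_% n) (trans (cong (φ x +_) (unit-same i c)) (+-comm (φ x) c)))))

    module _ (w : ℕ) .{{_ : NonZero w}} (i : Fin rank) where

      coordinateWave : Fin N → Bool
      coordinateWave x = wave w (coordinate x i % order i)

      -- The proportion of flips in the group equals that in the cyclic factor, cross-multiplied to
      -- stay in the naturals.
      flips-coordinateWave : ∀ b → order i * flipsᴳ coordinateWave (combination b) ≡ N * flips (order i) w (b i)
      flips-coordinateWave b = trans
        (cong (order i *_) (sum-cong-≗ λ x → cong (λ y → dist (coordinateWave x) (wave w y))
          (trans (coordinate-∙ x b i) (sym (reduce (coordinate x i))))))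
        (trans (average i (λ y → dist (wave w y) (wave w ((y + b i) % order i))))
          (cong (N *_) (∑<-cong (order i) λ c → cong (λ y → dist (wave w (c % order i)) (wave w y)) (reduce c))))
        where
        reduce : ∀ c → (c % order i + b i) % order i ≡ (c + b i) % order i
        reduce c = trans (%-distribˡ-+ (c % order i) (b i) (order i))
          (trans (cong (λ y → (y + b i % order i) % order i) (m%n%n≡m%n c (order i)))
            (sym (%-distribˡ-+ c (b i) (order i))))

    module _ (m : ℕ) .{{_ : NonZero m}} where

      private
        B = 2 * m

        2≤B : 2 ≤ B
        2≤B = m≤m*n 2 m

        digit : (i : Fin rank) → ∃ λ k → order i ≤ B ^ (2 * k) × (k ≡ 1 ⊎ B ^ k ≤ order i)
        digit i = digits 2≤B (order i)

        k : Fin rank → ℕ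
        k i = proj₁ (digit i)

      power : Fin rank → ℕ → Fin N
      power i t = combination (unit i (B ^ t))

      powers : List (Fin N)
      powers = concat (tabulate λ i → applyUpTo (power i) (k i))

      module _ (i : Fin rank) (s : ℕ) where

        private
          instance
            w≢0 : NonZero (B ^ s)
            w≢0 = m^n≢0 B s {{m*n≢0 2 m}}

          S = coordinateWave (B ^ s) i
          n = order i

        flips-power-same : ∀ t → n * flipsᴳ S (power i t) ≡ N * flips n (B ^ s) (B ^ t)
        flips-power-same t = trans (flips-coordinateWave (B ^ s) i (unit i (B ^ t)))
          (cong (λ a → N * flips n (B ^ s) a) (unit-same i (B ^ t)))

        -- A power of another generator fixes the `i`-th coordinate modulo its order.
        flips-power-other : ∀ {j} → i ≢ j → ∀ t → flipsᴳ S (power j t) ≡ 0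
        flips-power-other {j} i≢j t = m*n≡0⇒m≡0 _ n (trans (*-comm _ n)
          (trans (flips-coordinateWave (B ^ s) i (unit j (B ^ t)))
            (trans (cong (N *_) (trans (cong (flips n (B ^ s)) (unit-other (B ^ t) (i≢j ∘ sym)))
              (n≤0⇒n≡0 (≤-trans (flips-≤* n (B ^ s) 0) (≤-reflexive (*-zeroʳ (flips n (B ^ s) 1)))))))
              (*-zeroʳ N))))

        flips-powers : n * total (map (flipsᴳ S) powers) ≡ N * ∑< (k i) (λ t → flips n (B ^ s) (B ^ t))
        flips-powers = begin
          n * total (map (flipsᴳ S) powers)
            ≡⟨ cong (n *_) (sum-map-concat (flipsᴳ S) (λ j → applyUpTo (power j) (k j))) ⟩
          n * sum (λ j → total (map (flipsᴳ S) (applyUpTo (power j) (k j))))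
            ≡⟨ cong (n *_) (sum-cong-≗ λ j → sum-map-applyUpTo (flipsᴳ S) (power j) (k j)) ⟩
          n * sum (λ j → ∑< (k j) (flipsᴳ S ∘ power j))
            ≡⟨ cong (n *_) (sum-single +-0-commutativeMonoid (λ j → ∑< (k j) (flipsᴳ S ∘ power j)) i λ j i≢j →
                 ∑<-zero (k j) λ t _ → flips-power-other i≢j t) ⟩
          n * ∑< (k i) (flipsᴳ S ∘ power i)
            ≡⟨ *-distribˡ-∑< n (k i) _ ⟩
          ∑< (k i) (λ t → n * flipsᴳ S (power i t))
            ≡⟨ ∑<-cong (k i) flips-power-same ⟩
          ∑< (k i) (λ t → N * flips n (B ^ s) (B ^ t))
            ≡⟨ *-distribˡ-∑< N (k i) _ ⟨
          N * ∑< (k i) (λ t → flips n (B ^ s) (B ^ t)) ∎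
          where open ≡-Reasoning

        -- Passing from the cyclic factor to the group multiplies both sides of `separation` by
        -- `N / n`.
        power-separated : s < k i → m * total (map (flipsᴳ S) powers) < (m + 7) * flipsᴳ S (power i s)
        power-separated s<k = *-cancelˡ-< n _ _ (begin-strict
          n * (m * total (map (flipsᴳ S) powers))             ≡⟨ swap n m _ ⟩
          m * (n * total (map (flipsᴳ S) powers))             ≡⟨ cong (m *_) flips-powers ⟩
          m * (N * ∑< (k i) (λ t → flips n (B ^ s) (B ^ t)))  ≡⟨ swap m N _ ⟩
          N * (m * ∑< (k i) (λ t → flips n (B ^ s) (B ^ t)))  <⟨ *-monoʳ-< N (separation m n s (2≤order i) s<k (proj₂ (proj₂ (digit i)))) ⟩
          N * ((m + 7) * flips n (B ^ s) (B ^ s))             ≡⟨ swap N (m + 7) _ ⟩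
          (m + 7) * (N * flips n (B ^ s) (B ^ s))             ≡⟨ cong ((m + 7) *_) (flips-power-same s) ⟨
          (m + 7) * (n * flipsᴳ S (power i s))                ≡⟨ swap (m + 7) n _ ⟩
          n * ((m + 7) * flipsᴳ S (power i s))                ∎)
          where
          open ≤-Reasoning
          swap : ∀ a b c → a * (b * c) ≡ b * (a * c)
          swap = solve-∀

      powers-separated : Separated {_∙_ = _∙_} m powers
      powers-separated h∈ with ∈-concat⁻′ (tabulate λ i → applyUpTo (power i) (k i)) h∈
      ... | _ , h∈xs , xs∈ with ∈-tabulate⁻ {f = λ i → applyUpTo (power i) (k i)} xs∈
      ...   | i , refl with ∈-applyUpTo⁻ (power i) h∈xs
      ...     | s , s<k , refl =
        coordinateWave (B ^ s) {{m^n≢0 B s {{m*n≢0 2 m}}}} i , power-separated i s s<k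

      -- An element is determined by its residues, and the `i`-th one takes at most `B ^ (2 * k i)`
      -- values.
      size≤ : N ≤ B ^ (2 * length powers)
      size≤ = begin
        N                  ≤⟨ Fin.injective⇒≤ {f = λ x → tuple (residue x)} injective ⟩
        ∏ order            ≤⟨ ∏-≤-^ B order k (λ i → proj₁ (proj₂ (digit i))) ⟩
        B ^ (2 * sum k)    ≡⟨ cong (λ l → B ^ (2 * l)) (trans
                                (length-concat-tabulate (λ i → applyUpTo (power i) (k i)))
                                (sum-cong-≗ λ i → length-applyUpTo (power i) (k i))) ⟨
        B ^ (2 * length powers) ∎
        where
        open ≤-Reasoning
        residue : ∀ x i → Fin (order i)
        residue x i = fromℕ< (m%n<n (coordinate x i) (order i))
        injective : ∀ {x y} → tuple (residue x) ≡ tuple (residue y) → x ≡ y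
        injective {x} {y} eq = coordinate-injective λ i → trans
          (sym (Fin.toℕ-fromℕ< (m%n<n (coordinate x i) (order i))))
          (trans (cong toℕ (tuple-injective (residue x) (residue y) eq i))
            (Fin.toℕ-fromℕ< (m%n<n (coordinate y i) (order i))))

  separatedFamily : ∀ {N} {_∙_ : Op₂ (Fin N)} {ε _⁻¹} → IsAbelianGroup _≡_ _∙_ ε _⁻¹ →
    ∀ m .{{_ : NonZero m}} → ∃ λ xs → Separated {_∙_ = _∙_} m xs × N ≤ (2 * m) ^ (2 * length xs)
  separatedFamily ab m = powers ab D m , powers-separated ab D m , size≤ ab D m
    where D = decomposition ab

-- From the list of powers to a subset of the group.

module SeparatedSubset where

  open import Algebra.Core using (Op₂)
  import Algebra.Properties.CommutativeMonoid.Sum as Sum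
  open import Algebra.Structures using (IsAbelianGroup)
  open import Data.Bool.Base using (Bool; if_then_else_)
  open import Data.Fin.Base using (Fin; zero; suc)
  import Data.Fin.Properties as Fin
  open import Data.Fin.Subset using (Subset; ⊥; ⁅_⁆; _∪_; ∣_∣; _∈_; _∉_) renaming (_-_ to _∖_)
  open import Data.Fin.Subset.Properties
    using (_∈?_; ∉⊥; x∈⁅x⁆; x∈⁅y⁆⇒x≡y; x∈p∪q⁻; q⊆p∪q; p⊆p∪q; p⊂q⇒∣p∣<∣q∣; p─q⊆p; p─q─q≡p─q; x∈p⇒∣p-x∣<∣p∣)
  open import Data.List.Base using (List; []; _∷_; length; map)
  open import Data.List.Membership.Propositional using () renaming (_∈_ to _∈ˡ_)
  open import Data.List.Relation.Unary.Any using (here; there)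
  open import Data.Nat.Base
  open import Data.Nat.ListAction using () renaming (sum to total)
  open import Data.Nat.Properties
  open import Data.Nat.Tactic.RingSolver using (solve-∀)
  open import Data.Product.Base using (∃; _×_; _,_)
  open import Data.Sum.Base using (inj₁; inj₂)
  open import Function.Base using (_∘_)
  open import Relation.Binary.PropositionalEquality
  open import Relation.Nullary using (Dec; does; yes; no; contradiction)
  open Preliminaries
  open SeparatedFamily
  open Sum +-0-commutativeMonoid using (sum; ∑-distrib-+)

  sum-mono : ∀ {k} {f g : Fin k → ℕ} → (∀ i → f i ≤ g i) → sum f ≤ sum g
  sum-mono {zero}  f≤g = z≤n
  sum-mono {suc k} f≤g = +-mono-≤ (f≤g zero) (sum-mono (f≤g ∘ suc))

  indicator : ∀ {P : Set} → Dec P → ℕ → ℕ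
  indicator P? c = if does P? then c else 0

  module _ {N : ℕ} where

    fromList : List (Fin N) → Subset N
    fromList []       = ⊥
    fromList (x ∷ xs) = ⁅ x ⁆ ∪ fromList xs

    ∈-fromList⁻ : ∀ {y} xs → y ∈ fromList xs → y ∈ˡ xs
    ∈-fromList⁻ []       y∈ = contradiction y∈ ∉⊥
    ∈-fromList⁻ (x ∷ xs) y∈ with x∈p∪q⁻ ⁅ x ⁆ (fromList xs) y∈
    ... | inj₁ y∈⁅x⁆ = here (x∈⁅y⁆⇒x≡y x y∈⁅x⁆)
    ... | inj₂ y∈xs  = there (∈-fromList⁻ xs y∈xs)

    weight : (Fin N → ℕ) → Subset N → ℕ
    weight f T = sum (λ y → indicator (y ∈? T) (f y))

    sum-indicator-≡ : ∀ (f : Fin N → ℕ) x → sum (λ y → indicator (x Fin.≟ y) (f y)) ≡ f x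
    sum-indicator-≡ f x = trans
      (sum-single +-0-commutativeMonoid (λ y → indicator (x Fin.≟ y) (f y)) x (λ y → if-no (x Fin.≟ y)))
      (if-yes (x Fin.≟ x) refl)

    -- Only an inequality, because the subset merges repetitions of the list.
    weight-fromList : ∀ f xs → weight f (fromList xs) ≤ total (map f xs)
    weight-fromList f [] = ≤-reflexive (sum-zero +-0-commutativeMonoid λ y → if-no (y ∈? ⊥) {f y} ∉⊥)
    weight-fromList f (x ∷ xs) = begin
      weight f (fromList (x ∷ xs))
        ≤⟨ sum-mono pointwise ⟩
      sum (λ y → indicator (x Fin.≟ y) (f y) + indicator (y ∈? fromList xs) (f y))
        ≡⟨ ∑-distrib-+ (λ y → indicator (x Fin.≟ y) (f y)) _ ⟩
      sum (λ y → indicator (x Fin.≟ y) (f y)) + weight f (fromList xs)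
        ≤⟨ +-mono-≤ (≤-reflexive (sum-indicator-≡ f x)) (weight-fromList f xs) ⟩
      f x + total (map f xs) ∎
      where
      open ≤-Reasoning
      pointwise : ∀ y → indicator (y ∈? fromList (x ∷ xs)) (f y)
        ≤ indicator (x Fin.≟ y) (f y) + indicator (y ∈? fromList xs) (f y)
      pointwise y with y ∈? fromList (x ∷ xs)
      ... | no  _  = z≤n
      ... | yes y∈ with x∈p∪q⁻ ⁅ x ⁆ (fromList xs) y∈
      ...   | inj₁ y∈⁅x⁆ = ≤-trans (≤-reflexive (sym (if-yes (x Fin.≟ y) (sym (x∈⁅y⁆⇒x≡y x y∈⁅x⁆))))) (m≤m+n _ _)
      ...   | inj₂ y∈xs  = ≤-trans (≤-reflexive (sym (if-yes (y ∈? fromList xs) y∈xs))) (m≤n+m _ _)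

    weight-∖ : ∀ f {T i} → i ∈ T → weight f (T ∖ i) + f i ≤ weight f T
    weight-∖ f {T} {i} i∈T = begin
      weight f (T ∖ i) + f i
        ≡⟨ cong (weight f (T ∖ i) +_) (sum-indicator-≡ f i) ⟨
      weight f (T ∖ i) + sum (λ y → indicator (i Fin.≟ y) (f y))
        ≡⟨ ∑-distrib-+ (λ y → indicator (y ∈? (T ∖ i)) (f y)) _ ⟨
      sum (λ y → indicator (y ∈? (T ∖ i)) (f y) + indicator (i Fin.≟ y) (f y))
        ≤⟨ sum-mono pointwise ⟩
      weight f T ∎
      where
      open ≤-Reasoning
      -- Otherwise removing `i` a second time would shrink the set, yet removal is idempotent.
      i∉T∖i : i ∉ T ∖ i
      i∉T∖i i∈ = <-irrefl (cong ∣_∣ (p─q─q≡p─q T ⁅ i ⁆)) (x∈p⇒∣p-x∣<∣p∣ {x = i} {p = T ∖ i} i∈)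
      pointwise : ∀ y → indicator (y ∈? (T ∖ i)) (f y) + indicator (i Fin.≟ y) (f y) ≤ indicator (y ∈? T) (f y)
      pointwise y with i Fin.≟ y
      ... | yes refl = ≤-reflexive (trans (cong (_+ f i) (if-no (i ∈? (T ∖ i)) i∉T∖i)) (sym (if-yes (i ∈? T) i∈T)))
      ... | no  _ with y ∈? (T ∖ i)
      ...   | no  _  = z≤n
      ...   | yes y∈ = ≤-reflexive (trans (+-identityʳ (f y)) (sym (if-yes (y ∈? T) (p─q⊆p T ⁅ i ⁆ y∈))))

    member≤total : ∀ (f : Fin N → ℕ) {h xs} → h ∈ˡ xs → f h ≤ total (map f xs)
    member≤total f (here refl) = m≤m+n _ _
    member≤total f (there h∈)  = ≤-trans (member≤total f h∈) (m≤n+m _ _)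

    -- A repeated element would contribute twice to the sum that it has to dominate.
    length≤∣fromList∣ : ∀ {m} → 7 ≤ m → ∀ xs →
      (∀ {h} → h ∈ˡ xs → ∃ λ (f : Fin N → ℕ) → m * total (map f xs) < (m + 7) * f h) →
      length xs ≤ ∣ fromList xs ∣
    length≤∣fromList∣ 7≤m [] dominates = z≤n
    length≤∣fromList∣ {m} 7≤m (x ∷ xs) dominates = ≤-<-trans
      (length≤∣fromList∣ 7≤m xs λ h∈ → let f , dom = dominates (there h∈) in
        f , ≤-<-trans (*-monoʳ-≤ m (m≤n+m _ (f x))) dom)
      (p⊂q⇒∣p∣<∣q∣ (q⊆p∪q ⁅ x ⁆ (fromList xs) , x , p⊆p∪q (fromList xs) (x∈⁅x⁆ x) , x∉xs))
      where
      x∉xs : x ∉ fromList xs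
      x∉xs x∈ = let f , dom = dominates (here refl) in <⇒≱ dom (begin
        (m + 7) * f x             ≤⟨ *-monoˡ-≤ (f x) (+-monoʳ-≤ m 7≤m) ⟩
        (m + m) * f x             ≡⟨ double m (f x) ⟩
        m * (f x + f x)           ≤⟨ *-monoʳ-≤ m (+-monoʳ-≤ (f x) (member≤total f (∈-fromList⁻ xs x∈))) ⟩
        m * total (map f (x ∷ xs)) ∎)
        where
        open ≤-Reasoning
        double : ∀ a b → (a + a) * b ≡ a * (b + b)
        double = solve-∀

  -- Taking the share `m * F S i` of `i` out of the total turns `m + 7` into 7.
  separatedSubset : ∀ {N} {_∙_ : Op₂ (Fin N)} {ε _⁻¹} → IsAbelianGroup _≡_ _∙_ ε _⁻¹ →
    ∀ {m} → 7 ≤ m → ∃ λ T → N ≤ (2 * m) ^ (2 * ∣ T ∣) ×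
      (∀ {i} → i ∈ T → ∃ λ S → m * weight (flipsBy {_∙_ = _∙_} S) (T ∖ i) < 7 * flipsBy {_∙_ = _∙_} S i)
  separatedSubset {N} {_∙_} ab {m} 7≤m = fromFamily (separatedFamily ab m)
    where
    instance
      m≢0 : NonZero m
      m≢0 = >-nonZero (<-≤-trans z<s 7≤m)
      2m≢0 : NonZero (2 * m)
      2m≢0 = m*n≢0 2 m
    F = flipsBy {_∙_ = _∙_}
    fromFamily : (∃ λ xs → Separated {_∙_ = _∙_} m xs × N ≤ (2 * m) ^ (2 * length xs)) →
      ∃ λ T → N ≤ (2 * m) ^ (2 * ∣ T ∣) × (∀ {i} → i ∈ T → ∃ λ S → m * weight (F S) (T ∖ i) < 7 * F S i)
    fromFamily (xs , separated , N≤) = fromList xs ,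
      ≤-trans N≤ (^-monoʳ-≤ (2 * m) (*-monoʳ-≤ 2 (length≤∣fromList∣ 7≤m xs λ h∈ →
        let S , dom = separated h∈ in F S , dom))) ,
      λ {i} i∈ → let S , dom = separated (∈-fromList⁻ xs i∈) in
        S , +-cancelˡ-< (m * F S i) _ _ (begin-strict
          m * F S i + m * weight (F S) (fromList xs ∖ i)
            ≡⟨ rearrange m (F S i) _ ⟩
          m * (weight (F S) (fromList xs ∖ i) + F S i)
            ≤⟨ *-monoʳ-≤ m (≤-trans (weight-∖ (F S) i∈) (weight-fromList (F S) xs)) ⟩
          m * total (map (F S) xs)
            <⟨ dom ⟩
          (m + 7) * F S i
            ≡⟨ *-distribʳ-+ (F S i) m 7 ⟩
          m * F S i + 7 * F S i ∎)
      where
      open ≤-Reasoning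
      rearrange : ∀ a b c → a * b + a * c ≡ a * (c + b)
      rearrange = solve-∀

-- Ordered-field arithmetic and the logarithm from lower sums.

module Reals (R : CompleteOrderedField) where

  import Algebra.Properties.Monoid.Mult as Mult
  import Algebra.Properties.Semiring.Exp as Exp
  import Algebra.Properties.Semiring.Mult as SemiringMult
  open import Data.Nat.Base as ℕ using (ℕ; zero; suc)
  import Data.Nat.Properties as ℕ
  open import Data.Product.Base using (∃; _×_; _,_; proj₁; proj₂)
  open import Data.Sum.Base using (inj₁; inj₂)
  open import Relation.Binary.Bundles using (StrictTotalOrder)
  open import Relation.Binary.Definitions using (tri<; tri≈; tri>)
  import Relation.Binary.PropositionalEquality as ≡
  open import Relation.Nullary using (¬_; contradiction)

  open CompleteOrderedField R hiding (zero)
  open Analysis R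
  open StrictTotalOrder strictTotalOrder using (compare) renaming (trans to <-trans)
  open Exp semiring public using (_^_; ^-assocʳ)

  ≰⇒> : ∀ {x y} → ¬ (y ≤ x) → x < y
  ≰⇒> {x} {y} y≰x with compare x y
  ... | tri< x<y _ _ = x<y
  ... | tri≈ _ x≈y _ = contradiction (inj₂ (sym x≈y)) y≰x
  ... | tri> _ _ y<x = contradiction (inj₁ y<x) y≰x

  ≤-antisym : ∀ {x y} → x ≤ y → y ≤ x → x ≈ y
  ≤-antisym (inj₂ x≈y) _   = x≈y
  ≤-antisym (inj₁ x<y) y≤x = contradiction y≤x (<⇒≱ x<y)

  *-mono-≤ : ∀ {x y u v} → 0# ≤ x → 0# ≤ v → x ≤ y → u ≤ v → x * u ≤ y * v
  *-mono-≤ {x} {y} {u} {v} 0≤x 0≤v x≤y u≤v = ≤.trans (*-monoʳ-≤ 0≤x u≤v)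
    (≤-resp (*-comm v x) (*-comm v y) (*-monoʳ-≤ 0≤v x≤y))

  *-monoˡ-≤ : ∀ {z x y} → 0# ≤ z → x ≤ y → x * z ≤ y * z
  *-monoˡ-≤ {z} {x} {y} 0≤z x≤y = ≤-resp (*-comm z x) (*-comm z y) (*-monoʳ-≤ 0≤z x≤y)

  *-nonneg : ∀ {x y} → 0# ≤ x → 0# ≤ y → 0# ≤ x * y
  *-nonneg {x} 0≤x 0≤y = ≤-resp (zeroʳ x) refl (*-monoʳ-≤ 0≤x 0≤y)

  +-nonneg : ∀ {x y} → 0# ≤ x → 0# ≤ y → 0# ≤ x + y
  +-nonneg 0≤x 0≤y = ≤-resp (+-identityʳ 0#) refl (+-mono-≤ 0≤x 0≤y)

  *-cancelˡ-≤ : ∀ {z x y} → 0# < z → z * x ≤ z * y → x ≤ y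
  *-cancelˡ-≤ {z} {x} {y} 0<z zx≤zy = *-cancelʳ-≤ 0<z (≤-resp (*-comm z x) (*-comm z y) zx≤zy)

  *-cancelʳ-≈ : ∀ {z x y} → 0# < z → x * z ≈ y * z → x ≈ y
  *-cancelʳ-≈ 0<z xz≈yz =
    ≤-antisym (*-cancelʳ-≤ 0<z (inj₂ xz≈yz)) (*-cancelʳ-≤ 0<z (inj₂ (sym xz≈yz)))

  x/y*y≈x : ∀ x {y} → 0# < y → x / y * y ≈ x
  x/y*y≈x x {y} 0<y = trans (*-assoc x (y ⁻¹) y) (trans (*-congˡ (⁻¹-inverseˡ 0<y)) (*-identityʳ x))

  x≤z*y⇒x/y≤z : ∀ {x y z} → 0# < y → x ≤ z * y → x / y ≤ z
  x≤z*y⇒x/y≤z {x} 0<y x≤zy = *-cancelʳ-≤ 0<y (≤-resp (sym (x/y*y≈x x 0<y)) refl x≤zy)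

  x*y≤z⇒x≤z/y : ∀ {x y z} → 0# < y → x * y ≤ z → x ≤ z / y
  x*y≤z⇒x≤z/y {z = z} 0<y xy≤z = *-cancelʳ-≤ 0<y (≤-resp refl (sym (x/y*y≈x z 0<y)) xy≤z)

  fromℕ-+ : ∀ m n → fromℕ (m ℕ.+ n) ≈ fromℕ m + fromℕ n
  fromℕ-+ = Mult.×-homo-+ +-monoid 1#

  fromℕ-* : ∀ m n → fromℕ (m ℕ.* n) ≈ fromℕ m * fromℕ n
  fromℕ-* = SemiringMult.×1-homo-* semiring

  fromℕ-^ : ∀ m n → fromℕ (m ℕ.^ n) ≈ fromℕ m ^ n
  fromℕ-^ m zero    = +-identityʳ 1#
  fromℕ-^ m (suc n) = trans (fromℕ-* m (m ℕ.^ n)) (*-congˡ (fromℕ-^ m n))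

  fromℕ-mono-≤ : ∀ {m n} → m ℕ.≤ n → fromℕ m ≤ fromℕ n
  fromℕ-mono-≤ {n = n} ℕ.z≤n = 0≤fromℕ n
  fromℕ-mono-≤ (ℕ.s≤s m≤n)   = +-monoʳ-≤ 1# (fromℕ-mono-≤ m≤n)

  fromℕ-mono-< : ∀ {m n} → m ℕ.< n → fromℕ m < fromℕ n
  fromℕ-mono-< {m} m<n = <-≤-trans
    (<-resp refl (+-comm (fromℕ m) 1#) (x<x+d (fromℕ m) 0<1)) (fromℕ-mono-≤ m<n)

  fromℕ-cancel-≤ : ∀ {m n} → fromℕ m ≤ fromℕ n → m ℕ.≤ n
  fromℕ-cancel-≤ m≤n = ℕ.≮⇒≥ λ n<m → <⇒≱ (fromℕ-mono-< n<m) m≤n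

  1≤fromℕ : ∀ {n} → 0 ℕ.< n → 1# ≤ fromℕ n
  1≤fromℕ 0<n = ≤-resp (+-identityʳ 1#) refl (fromℕ-mono-≤ 0<n)

  -- If the naturals were bounded, their supremum minus 1 would bound them too.
  archimedean : ∀ u → ¬ (∀ n → fromℕ n ≤ u)
  archimedean u bounded = <⇒≱ (x<x+d (s - 1#) 0<1)
    (≤-resp (trans (sym (x+[y-x]≈y 1# s)) (+-comm 1# (s - 1#))) refl
      (least (s - 1#) λ { _ (n , ≡.refl) → shift n }))
    where
    S : ℝ → Set
    S x = ∃ λ n → x ≡.≡ fromℕ n
    lub = completeness S (0# , 0 , ≡.refl) (u , λ { _ (n , ≡.refl) → bounded n })
    s     = proj₁ lub
    least = proj₂ (proj₂ lub)
    shift : ∀ n → fromℕ n ≤ s - 1#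
    shift n = ≤-resp
      (trans (+-comm (- 1#) _) (trans (+-congʳ (+-comm 1# (fromℕ n)))
        (trans (+-assoc (fromℕ n) 1# (- 1#)) (trans (+-congˡ (-‿inverseʳ 1#)) (+-identityʳ _)))))
      (+-comm (- 1#) s)
      (+-monoʳ-≤ (- 1#) (proj₁ (proj₂ lub) (fromℕ (suc n)) (suc n , ≡.refl)))

  1≤^ : ∀ {x} → 1# ≤ x → ∀ k → 1# ≤ x ^ k
  1≤^ 1≤x zero    = ≤.refl
  1≤^ 1≤x (suc k) = ≤-resp (*-identityʳ 1#) refl
    (*-mono-≤ (inj₁ 0<1) (≤.trans (inj₁ 0<1) (1≤^ 1≤x k)) 1≤x (1≤^ 1≤x k))

  ^-mono-≤ : ∀ {x y} → 0# ≤ x → x ≤ y → ∀ k → x ^ k ≤ y ^ k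
  ^-mono-≤ 0≤x x≤y zero    = ≤.refl
  ^-mono-≤ 0≤x x≤y (suc k) = *-mono-≤ 0≤x (0≤^ k) x≤y (^-mono-≤ 0≤x x≤y k)
    where
    0≤^ : ∀ k → 0# ≤ _ ^ k
    0≤^ zero    = inj₁ 0<1
    0≤^ (suc k) = *-nonneg (≤.trans 0≤x x≤y) (0≤^ k)

  log-IsLUB : ∀ {x} → 1# ≤ x → IsLUB (LowerSum 1# x) (log x)
  log-IsLUB {x} 1≤x with compare 0# x | compare 1# x
  ... | tri≈ _ 0≈x _ | _ = contradiction (≤-resp refl (sym 0≈x) 1≤x) (<⇒≱ 0<1)
  ... | tri> _ _ x<0 | _ = contradiction (≤.trans 1≤x (inj₁ x<0)) (<⇒≱ 0<1)
  ... | tri< _ _ _ | tri> _ _ x<1 = contradiction 1≤x (<⇒≱ x<1)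
  ... | tri< _ _ _ | tri< 1<x _ _ = proj₂ (completeness (LowerSum 1# x) _ _)
  ... | tri< _ _ _ | tri≈ _ 1≈x _ = proj₂ (completeness (LowerSum 1# x) _ _)

  LowerSum-extend : ∀ {a x y s} → 0# < a → LowerSum a x s → x ≤ y → ∃ λ s′ → LowerSum a y s′ × s ≤ s′
  LowerSum-extend {a} {x} {y} 0<a (end a≈x) x≤y = _ , step y a≤y (end refl) ,
    ≤-resp refl (sym (+-identityʳ _))
      (*-nonneg (x≤y⇒0≤y-x a≤y) (inj₁ (⁻¹-pos (<-≤-trans 0<a a≤y))))
    where a≤y = ≤.trans (inj₂ a≈x) x≤y
  LowerSum-extend 0<a (step t a≤t σ) x≤y with LowerSum-extend (<-≤-trans 0<a a≤t) σ x≤y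
  ... | _ , σ′ , s≤s′ = _ , step t a≤t σ′ , +-monoʳ-≤ _ s≤s′

  -- Cutting the piece that contains `c` can only raise the lower sum, since `1/c ≥ 1/t`.
  LowerSum-split : ∀ {a b c s} → 0# < a → LowerSum a b s → a ≤ c → c ≤ b →
    ∃ λ s₁ → ∃ λ s₂ → LowerSum a c s₁ × LowerSum c b s₂ × s ≤ s₁ + s₂
  LowerSum-split 0<a (end a≈b) a≤c c≤b = _ , _ ,
    end (≤-antisym a≤c (≤.trans c≤b (inj₂ (sym a≈b)))) ,
    end (≤-antisym c≤b (≤.trans (inj₂ (sym a≈b)) a≤c)) , inj₂ (sym (+-identityʳ 0#))
  LowerSum-split {a} {b} {c} 0<a (step {s = s} t a≤t σ) a≤c c≤b with ≤.total t c
  ... | inj₁ t≤c with LowerSum-split (<-≤-trans 0<a a≤t) σ t≤c c≤b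
  ...   | _ , _ , σ₁ , σ₂ , s≤ = _ , _ , step t a≤t σ₁ , σ₂ ,
    ≤-resp refl (sym (+-assoc _ _ _)) (+-monoʳ-≤ _ s≤)
  LowerSum-split {a} {b} {c} 0<a (step {s = s} t a≤t σ) a≤c c≤b | inj₂ c≤t =
    _ , _ , step c a≤c (end refl) , step t c≤t σ ,
    ≤-resp refl (trans (+-assoc _ _ _) (+-congʳ (sym (+-identityʳ _))))
      (+-mono-≤ refined ≤.refl)
    where
    0<c = <-≤-trans 0<a a≤c
    telescope : (c - a) + (t - c) ≈ t - a
    telescope = trans (+-comm _ _) (trans (sym (+-assoc (t - c) c (- a)))
      (+-congʳ (trans (+-comm (t - c) c) (x+[y-x]≈y c t))))
    refined : (t - a) * t ⁻¹ ≤ (c - a) * c ⁻¹ + (t - c) * t ⁻¹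
    refined = ≤-resp (trans (sym (distribʳ (t ⁻¹) (c - a) (t - c))) (*-congʳ telescope)) refl
      (+-mono-≤ (*-monoʳ-≤ (x≤y⇒0≤y-x a≤c) (⁻¹-anti-≤ 0<c c≤t)) ≤.refl)

  -- Each term `(t - a) / t` is unchanged by scaling, the discrete form of the invariance of `dt/t`.
  LowerSum-scale : ∀ {k a b s a′ b′} → 0# < k → 0# < a → a′ ≈ k * a → b′ ≈ k * b →
    LowerSum a b s → ∃ λ s′ → LowerSum a′ b′ s′ × s ≈ s′
  LowerSum-scale 0<k 0<a a′≈ b′≈ (end a≈b) =
    _ , end (trans a′≈ (trans (*-congˡ a≈b) (sym b′≈))) , refl
  LowerSum-scale {k} {a} {a′ = a′} 0<k 0<a a′≈ b′≈ (step t a≤t σ)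
    with LowerSum-scale 0<k (<-≤-trans 0<a a≤t) refl b′≈ σ
  ... | _ , σ′ , s≈s′ = _ ,
    step (k * t) (≤-resp (sym a′≈) refl (*-monoʳ-≤ (inj₁ 0<k) a≤t)) σ′ , +-cong piece s≈s′
    where
    0<t = <-≤-trans 0<a a≤t
    piece : (t - a) * t ⁻¹ ≈ (k * t - a′) * (k * t) ⁻¹
    piece = *-cancelʳ-≈ (*-pos 0<k 0<t) (trans
      (trans (*-congˡ (*-comm k t)) (trans (sym (*-assoc _ t k)) (trans (*-congʳ (x/y*y≈x (t - a) 0<t)) (*-comm _ k))))
      (trans (trans (distribˡ k t (- a)) (+-congˡ (trans (sym (-‿distribʳ-* k a)) (-‿cong (sym a′≈)))))
        (sym (x/y*y≈x (k * t - a′) (*-pos 0<k 0<t)))))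
      where open import Algebra.Properties.Ring ring using (-‿distribʳ-*)

  log-mono : ∀ {x y} → 1# ≤ x → x ≤ y → log x ≤ log y
  log-mono {x} {y} 1≤x x≤y = proj₂ (log-IsLUB 1≤x) (log y) λ s σ →
    let s′ , σ′ , s≤s′ = LowerSum-extend 0<1 σ x≤y
    in ≤.trans s≤s′ (proj₁ (log-IsLUB (≤.trans 1≤x x≤y)) s′ σ′)

  -- A lower sum on `[1 , x * y]` is split at `x`, and its upper part scaled by `1/x` onto
  -- `[1 , y]`.
  log-* : ∀ {x y} → 1# ≤ x → 1# ≤ y → log (x * y) ≤ log x + log y
  log-* {x} {y} 1≤x 1≤y = proj₂ (log-IsLUB (≤.trans 1≤x x≤xy)) (log x + log y) λ s σ →
    let s₁ , s₂ , σ₁ , σ₂ , s≤ = LowerSum-split 0<1 σ 1≤x x≤xy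
        s₂′ , σ₂′ , s₂≈ = LowerSum-scale (⁻¹-pos 0<x) 0<x (sym (⁻¹-inverseˡ 0<x))
          (sym (trans (sym (*-assoc (x ⁻¹) x y)) (trans (*-congʳ (⁻¹-inverseˡ 0<x)) (*-identityˡ y)))) σ₂
    in ≤.trans s≤ (+-mono-≤ (proj₁ (log-IsLUB 1≤x) s₁ σ₁)
         (≤.trans (inj₂ s₂≈) (proj₁ (log-IsLUB 1≤y) s₂′ σ₂′)))
    where
    0<x = <-≤-trans 0<1 1≤x
    x≤xy : x ≤ x * y
    x≤xy = ≤-resp (*-identityʳ x) refl (*-monoʳ-≤ (inj₁ 0<x) 1≤y)

  log-≤ : ∀ {x} → 1# ≤ x → log x ≤ x - 1#
  log-≤ {x} 1≤x = proj₂ (log-IsLUB 1≤x) (x - 1#) λ s σ →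
    ≤-resp refl (trans (*-congˡ 1⁻¹≈1) (*-identityʳ _)) (LowerSum-bound 0<1 ≤.refl σ)
    where
    1⁻¹≈1 : 1# ⁻¹ ≈ 1#
    1⁻¹≈1 = trans (sym (*-identityʳ _)) (⁻¹-inverseˡ 0<1)

  -- The one-piece lower sum `(x - 1) / x` is already positive.
  0<log : ∀ {x} → 1# < x → 0# < log x
  0<log {x} 1<x = <-≤-trans
    (<-resp refl (sym (+-identityʳ _)) (*-pos (x<y⇒0<y-x 1<x) (⁻¹-pos (<-trans 0<1 1<x))))
    (proj₁ (log-IsLUB (inj₁ 1<x)) _ (step x (inj₁ 1<x) (end refl)))

  log-^ : ∀ {x} → 1# ≤ x → ∀ k → log (x ^ k) ≤ fromℕ k * log x
  log-^ {x} 1≤x zero = ≤-resp refl (trans (-‿inverseʳ 1#) (sym (zeroˡ _))) (log-≤ ≤.refl)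
  log-^ {x} 1≤x (suc k) = ≤.trans (log-* 1≤x (1≤^ 1≤x k))
    (≤-resp refl (trans (+-congʳ (sym (*-identityˡ (log x)))) (sym (distribʳ (log x) 1# (fromℕ k))))
      (+-monoʳ-≤ (log x) (log-^ 1≤x k)))

-- Algebra of quadratic forms.

module QuadraticForms (R : CompleteOrderedField) where

  import Algebra.Properties.CommutativeMonoid.Sum as Sum
  import Algebra.Properties.Semiring.Sum as SemiringSum
  import Algebra.Solver.Ring.NaturalCoefficients.Default as Solver
  open import Data.Bool.Base using (if_then_else_)
  open import Data.Fin.Base using (Fin; zero; suc)
  import Data.Fin.Properties as Fin
  open import Data.Fin.Subset using (Subset)
  open import Data.Fin.Subset.Properties using (_∈?_)
  open import Data.Nat.Base as ℕ using (ℕ; zero; suc)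
  import Data.Nat.Properties as ℕ
  open import Function.Base using (_∘_)
  import Relation.Binary.PropositionalEquality as ≡
  import Relation.Binary.Reasoning.Setoid as ≈-Reasoning
  open import Relation.Nullary using (does; yes; no)

  open CompleteOrderedField R hiding (zero)
  open Analysis R
  open Reals R
  open Preliminaries
  open Sum +-commutativeMonoid using (sum-cong-≋; ∑-distrib-+; ∑-comm)
  open SemiringSum semiring using (*-distribˡ-sum)
  open Solver commutativeSemiring using (solve; _:=_; _:+_; _:*_)
  open Sum ℕ.+-0-commutativeMonoid using () renaming (sum to ∑ℕ)

  ∑-nonneg : ∀ {n} {f : Fin n → ℝ} → (∀ i → 0# ≤ f i) → 0# ≤ ∑ f
  ∑-nonneg {zero}  0≤f = ≤.refl
  ∑-nonneg {suc n} 0≤f = +-nonneg (0≤f zero) (∑-nonneg (0≤f ∘ suc))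

  fromℕ-∑ : ∀ {n} (f : Fin n → ℕ) → fromℕ (∑ℕ f) ≈ ∑ (fromℕ ∘ f)
  fromℕ-∑ {zero}  f = refl
  fromℕ-∑ {suc n} f = trans (fromℕ-+ (f zero) _) (+-congˡ (fromℕ-∑ (f ∘ suc)))

  module _ {n : ℕ} (v : Fin n → ℝ) where

    private
      ∑∑-+ : {f g h : Fin n → Fin n → ℝ} → (∀ i j → f i j + g i j ≈ h i j) →
        ∑ (λ i → ∑ (f i)) + ∑ (λ i → ∑ (g i)) ≈ ∑ (λ i → ∑ (h i))
      ∑∑-+ {f} {g} {h} eq = trans (sym (∑-distrib-+ (λ i → ∑ (f i)) (λ i → ∑ (g i))))
        (sum-cong-≋ λ i → trans (sym (∑-distrib-+ (f i) (g i))) (sum-cong-≋ (eq i)))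

    quadraticForm-⊕ : ∀ A B → quadraticForm A v + quadraticForm B v ≈ quadraticForm (A ⊕ B) v
    quadraticForm-⊕ A B = ∑∑-+ λ i j →
      solve 4 (λ a b x y → x :* (a :* y) :+ x :* (b :* y) := x :* ((a :+ b) :* y)) refl (A i j) (B i j) (v i) (v j)

    quadraticForm-⊖ : ∀ A B → quadraticForm (A ⊖ B) v + quadraticForm B v ≈ quadraticForm A v
    quadraticForm-⊖ A B = ∑∑-+ λ i j → trans
      (solve 4 (λ a b x y → x :* (a :* y) :+ x :* (b :* y) := x :* ((b :+ a) :* y)) refl (A i j - B i j) (B i j) (v i) (v j))
      (*-congˡ (*-congʳ (x+[y-x]≈y (B i j) (A i j))))

    quadraticForm-· : ∀ α A → quadraticForm (α · A) v ≈ α * quadraticForm A v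
    quadraticForm-· α A = trans
      (sum-cong-≋ λ i → trans
        (sum-cong-≋ λ j → solve 4 (λ c a x y → x :* (c :* a :* y) := c :* (x :* (a :* y))) refl α (A i j) (v i) (v j))
        (sym (*-distribˡ-sum α (λ j → v i * (A i j * v j)))))
      (sym (*-distribˡ-sum α (λ i → ∑ λ j → v i * (A i j * v j))))

    quadraticForm-ᵀ : ∀ A → quadraticForm (A ᵀ) v ≈ quadraticForm A v
    quadraticForm-ᵀ A = trans (∑-comm (λ i j → v i * (A j i * v j)))
      (sum-cong-≋ λ i → sum-cong-≋ λ j → solve 3 (λ a x y → x :* (a :* y) := y :* (a :* x)) refl (A i j) (v j) (v i))

    quadraticForm-∑ : ∀ {k} (T : Subset k) A →
      quadraticForm (∑[ T ] A) v ≈ ∑ (λ j → if does (j ∈? T) then quadraticForm (A j) v else 0#)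
    quadraticForm-∑ {k} T A = begin
      ∑ (λ x → ∑ λ y → v x * (∑ (λ j → a j x y) * v y))
        ≈⟨ sum-cong-≋ (λ x → sum-cong-≋ λ y → expand x y) ⟩
      ∑ (λ x → ∑ λ y → ∑ λ j → v x * (a j x y * v y))
        ≈⟨ sum-cong-≋ (λ x → ∑-comm λ y j → v x * (a j x y * v y)) ⟩
      ∑ (λ x → ∑ λ j → ∑ λ y → v x * (a j x y * v y))
        ≈⟨ ∑-comm (λ x j → ∑ λ y → v x * (a j x y * v y)) ⟩
      ∑ (λ j → quadraticForm (a j) v)
        ≈⟨ sum-cong-≋ pull ⟩
      ∑ (λ j → if does (j ∈? T) then quadraticForm (A j) v else 0#) ∎
      where
      open ≈-Reasoning setoid
      a : Fin k → Matrix n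
      a j x y = if does (j ∈? T) then A j x y else 0#
      expand : ∀ x y → v x * (∑ (λ j → a j x y) * v y) ≈ ∑ (λ j → v x * (a j x y * v y))
      expand x y = trans (solve 3 (λ s p q → p :* (s :* q) := p :* q :* s) refl (∑ (λ j → a j x y)) (v x) (v y))
        (trans (*-distribˡ-sum (v x * v y) (λ j → a j x y))
          (sum-cong-≋ λ j → solve 3 (λ s p q → p :* q :* s := p :* (s :* q)) refl (a j x y) (v x) (v y)))
      pull : ∀ j → quadraticForm (a j) v ≈ (if does (j ∈? T) then quadraticForm (A j) v else 0#)
      pull j with j ∈? T
      ... | yes _ = refl
      ... | no  _ = sum-zero +-commutativeMonoid λ x → sum-zero +-commutativeMonoid λ y →
        trans (*-congˡ (zeroˡ (v y))) (zeroʳ (v x))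

    -- The matrix sends the basis vector of `y` to that of `σ y`; the identity and the right
    -- translations are both of this kind.
    quadraticForm-indicator : ∀ (σ : Fin n → Fin n) →
      quadraticForm (λ x y → if does (x Fin.≟ σ y) then 1# else 0#) v ≈ ∑ (λ y → v (σ y) * v y)
    quadraticForm-indicator σ = trans (∑-comm term) (sum-cong-≋ λ y → trans
      (sum-single +-commutativeMonoid (λ x → term x y) (σ y) λ x σy≢x →
        trans (*-congˡ (trans (*-congʳ (reflexive (if-no (x Fin.≟ σ y) (σy≢x ∘ ≡.sym)))) (zeroˡ (v y)))) (zeroʳ (v x)))
      (*-congˡ (trans (*-congʳ (reflexive (if-yes (σ y Fin.≟ σ y) ≡.refl))) (*-identityˡ (v y)))))
      where
      term : Fin n → Fin n → ℝ
      term x y = v x * ((if does (x Fin.≟ σ y) then 1# else 0#) * v y)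

-- Cayley Laplacians evaluated at 0-1 vectors.

module CayleyForms (R : CompleteOrderedField) (G : FiniteGroup) (abelian : FiniteGroup.IsAbelian G) where

  open import Algebra.Bundles using (Group)
  import Algebra.Morphism.GroupMonomorphism as GroupMonomorphism
  open import Algebra.Structures using (IsAbelianGroup)
  import Algebra.Properties.CommutativeMonoid.Sum as Sum
  import Algebra.Properties.Semiring.Sum as SemiringSum
  import Algebra.Solver.Ring.NaturalCoefficients.Default as Solver
  open import Data.Bool.Base using (Bool; true; false; if_then_else_)
  open import Data.Fin.Base using (Fin)
  import Data.Fin.Properties as Fin
  open import Data.Fin.Subset using (Subset) renaming (_-_ to _∖_)
  open import Data.Fin.Subset.Properties using (_∈?_)
  open import Data.Nat.Base as ℕ using (ℕ)
  import Data.Nat.Properties as ℕ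
  open import Data.Product.Base using (_,_)
  open import Data.Sum.Base using (inj₁; inj₂)
  open import Function.Base using (_∘_)
  open import Function.Bundles using (Inverse)
  import Relation.Binary.PropositionalEquality as ≡
  import Relation.Binary.Reasoning.Setoid as ≈-Reasoning
  open import Relation.Nullary using (does; yes; no; ¬_)

  open CompleteOrderedField R
  open Analysis R
  open Cayley R G
  open Reals R
  open Preliminaries
  open QuadraticForms R
  open SquareWave using (dist)
  open SeparatedFamily using (flipsBy; translation)
  open SeparatedSubset using (weight)
  open FiniteGroup G using (group; size; enumeration; element; index)
  open Sum +-commutativeMonoid using (sum-cong-≋; ∑-distrib-+; sum-permute)
  open SemiringSum semiring using (*-distribˡ-sum)
  open Solver commutativeSemiring using (solve; _:=_; _:+_; _:*_; con)

  private
    module G = Group group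
    module E = Inverse enumeration

  -- The group operation on indices, where equality is propositional and the combinatorial results
  -- apply.
  _⊙_ : Fin size → Fin size → Fin size
  x ⊙ y = index (element x G.∙ element y)

  isAbelianGroup : IsAbelianGroup ≡._≡_ _⊙_ (index G.ε) (λ x → index (element x G.⁻¹))
  isAbelianGroup = GroupMonomorphism.isAbelianGroup
    {G₁ = record { _∙_ = _⊙_ ; ε = index G.ε ; _⁻¹ = λ x → index (element x G.⁻¹) }} {G₂ = G.rawGroup} {element}
    (record
      { isGroupHomomorphism = record
        { isMonoidHomomorphism = record
          { isMagmaHomomorphism = record
            { isRelHomomorphism = record { cong = E.from-cong }
            ; homo = λ x y → E.strictlyInverseʳ (element x G.∙ element y)
            }
          ; ε-homo = E.strictlyInverseʳ G.ε
          }
        ; ⁻¹-homo = λ x → E.strictlyInverseʳ (element x G.⁻¹)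
        }
      ; injective = λ {x} {y} eq →
          ≡.trans (≡.sym (E.strictlyInverseˡ x)) (≡.trans (E.to-cong eq) (E.strictlyInverseˡ y))
      })
    (record { isGroup = G.isGroup ; comm = abelian })

  square : ℝ → ℝ
  square x = x * x

  energy : (Fin size → ℝ) → Fin size → ℝ
  energy v y = ∑ λ x → square (v x - v (x ⊙ y))

  2*½≈1 : fromℕ 2 * (1# / fromℕ 2) ≈ 1#
  2*½≈1 = trans (*-comm (fromℕ 2) _) (x/y*y≈x 1# (0<fromℕ-suc 1))

  -- The Dirichlet form of a Cayley graph: each squared difference expands into two squares and a
  -- correlation, and translation by `y` makes the two sums of squares equal.
  quadraticForm-𝓛 : ∀ v y → fromℕ 2 * quadraticForm (𝓛 y) v ≈ energy v y
  quadraticForm-𝓛 v y = +-cancelʳ (C + C) _ _ (begin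
    fromℕ 2 * Q + (C + C)                 ≈⟨ +-congˡ (sym 2*½[C+C]) ⟩
    fromℕ 2 * Q + fromℕ 2 * (½ * (C + C)) ≈⟨ distribˡ (fromℕ 2) Q (½ * (C + C)) ⟨
    fromℕ 2 * (Q + ½ * (C + C))           ≈⟨ *-congˡ (+-congˡ (sym correlation)) ⟩
    fromℕ 2 * (Q + quadraticForm (½ · (Rʸ ⊕ Rʸ ᵀ)) v)
                                          ≈⟨ *-congˡ (quadraticForm-⊖ v identity (½ · (Rʸ ⊕ Rʸ ᵀ))) ⟩
    fromℕ 2 * quadraticForm identity v    ≈⟨ *-congˡ (quadraticForm-indicator v (λ x → x)) ⟩
    fromℕ 2 * ∑ (square ∘ v)              ≈⟨ solve 1 (λ s → (con 1 :+ (con 1 :+ con 0)) :* s := s :+ s) refl (∑ (square ∘ v)) ⟩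
    ∑ (square ∘ v) + ∑ (square ∘ v)       ≈⟨ +-congˡ (sum-permute (square ∘ v) (translation isAbelianGroup y)) ⟩
    ∑ (square ∘ v) + ∑ (λ x → square (v (x ⊙ y)))
                                          ≈⟨ ∑-distrib-+ (square ∘ v) (λ x → square (v (x ⊙ y))) ⟨
    ∑ (λ x → square (v x) + square (v (x ⊙ y)))
                                          ≈⟨ sum-cong-≋ (λ x → sym (polarise (v x) (v (x ⊙ y)))) ⟩
    ∑ (λ x → square (v x - v (x ⊙ y)) + (c x + c x))
                                          ≈⟨ ∑-distrib-+ (λ x → square (v x - v (x ⊙ y))) (λ x → c x + c x) ⟩
    energy v y + ∑ (λ x → c x + c x)      ≈⟨ +-congˡ (∑-distrib-+ c c) ⟩
    energy v y + (C + C)                  ∎)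
    where
    open ≈-Reasoning setoid
    open import Algebra.Properties.Group +-group using () renaming (∙-cancelʳ to +-cancelʳ)
    ½ = 1# / fromℕ 2
    Q = quadraticForm (𝓛 y) v
    Rʸ = rightRegular (element y)
    c : Fin size → ℝ
    c x = v (x ⊙ y) * v x
    C = ∑ c
    2*½[C+C] : fromℕ 2 * (½ * (C + C)) ≈ C + C
    2*½[C+C] = trans (sym (*-assoc (fromℕ 2) ½ (C + C))) (trans (*-congʳ 2*½≈1) (*-identityˡ (C + C)))
    correlation : quadraticForm (½ · (Rʸ ⊕ Rʸ ᵀ)) v ≈ ½ * (C + C)
    correlation = trans (quadraticForm-· v ½ (Rʸ ⊕ Rʸ ᵀ)) (*-congˡ (trans (sym (quadraticForm-⊕ v Rʸ (Rʸ ᵀ)))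
      (+-cong form (trans (quadraticForm-ᵀ v Rʸ) form))))
      where
      form : quadraticForm Rʸ v ≈ C
      form = quadraticForm-indicator v (_⊙ y)
    -- With `a` written as `b + (a - b)` this becomes a semiring identity in `b` and `a - b`.
    polarise : ∀ a b → square (a - b) + (b * a + b * a) ≈ square a + square b
    polarise a b = trans (+-congˡ (+-cong (*-congˡ a≈) (*-congˡ a≈)))
      (trans (solve 2 (λ d b → d :* d :+ (b :* (b :+ d) :+ b :* (b :+ d)) := (b :+ d) :* (b :+ d) :+ b :* b) refl (a - b) b)
        (+-congʳ (sym (*-cong a≈ a≈))))
      where
      a≈ : a ≈ b + (a - b)
      a≈ = sym (x+[y-x]≈y b a)

  bit : Bool → ℝ
  bit b = if b then 1# else 0#

  square-bit : ∀ a b → square (bit a - bit b) ≈ fromℕ (dist a b)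
  square-bit false false = trans (*-congʳ (-‿inverseʳ 0#)) (zeroˡ _)
  square-bit true  true  = trans (*-congʳ (-‿inverseʳ 1#)) (zeroˡ _)
  square-bit true  false = trans (*-cong 1-0 1-0) (trans (*-identityˡ 1#) (sym (+-identityʳ 1#)))
    where
    1-0 : 1# - 0# ≈ 1#
    1-0 = trans (sym (+-identityˡ (1# - 0#))) (x+[y-x]≈y 0# 1#)
  square-bit false true  = trans (*-cong (+-identityˡ (- 1#)) (+-identityˡ (- 1#)))
    (trans -1*-1≈1 (sym (+-identityʳ 1#)))
    where
    open import Algebra.Properties.Ring ring using (-1*x≈-x; -‿involutive)
    -1*-1≈1 : - 1# * - 1# ≈ 1#
    -1*-1≈1 = trans (-1*x≈-x (- 1#)) (-‿involutive 1#)

  flips : (Fin size → Bool) → Fin size → ℕ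
  flips = flipsBy {_∙_ = _⊙_}

  quadraticForm-bit : ∀ S y → fromℕ 2 * quadraticForm (𝓛 y) (bit ∘ S) ≈ fromℕ (flips S y)
  quadraticForm-bit S y = trans (quadraticForm-𝓛 (bit ∘ S) y)
    (trans (sum-cong-≋ λ x → square-bit (S x) (S (x ⊙ y))) (sym (fromℕ-∑ λ x → dist (S x) (S (x ⊙ y)))))

  quadraticForm-∑-bit : ∀ S T → fromℕ 2 * quadraticForm (∑[ T ] 𝓛) (bit ∘ S) ≈ fromℕ (weight (flips S) T)
  quadraticForm-∑-bit S T = trans (*-congˡ (quadraticForm-∑ (bit ∘ S) T 𝓛))
    (trans (*-distribˡ-sum (fromℕ 2) (λ y → if does (y ∈? T) then quadraticForm (𝓛 y) (bit ∘ S) else 0#))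
      (trans (sum-cong-≋ pointwise) (sym (fromℕ-∑ λ y → if does (y ∈? T) then flips S y else 0))))
    where
    pointwise : ∀ y → fromℕ 2 * (if does (y ∈? T) then quadraticForm (𝓛 y) (bit ∘ S) else 0#)
      ≈ fromℕ (if does (y ∈? T) then flips S y else 0)
    pointwise y with y ∈? T
    ... | yes _ = quadraticForm-bit S y
    ... | no  _ = zeroʳ (fromℕ 2)

  𝓛-PSD : ∀ y → PSD (𝓛 y)
  𝓛-PSD y = symmetric , λ v → *-cancelˡ-≤ (0<fromℕ-suc 1)
    (≤-resp (sym (zeroʳ (fromℕ 2))) (sym (quadraticForm-𝓛 v y)) (∑-nonneg λ x → 0≤x² (v x - v (x ⊙ y))))
    where
    open import Algebra.Properties.Ring ring using (-‿distribˡ-*; -‿distribʳ-*; -‿involutive)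
    0≤x² : ∀ x → 0# ≤ square x
    0≤x² x with ≤.total 0# x
    ... | inj₁ 0≤x = *-nonneg 0≤x 0≤x
    ... | inj₂ x≤0 = ≤-resp refl
      (trans (sym (-‿distribˡ-* x (- x))) (trans (-‿cong (sym (-‿distribʳ-* x x))) (-‿involutive _)))
      (*-nonneg 0≤-x 0≤-x)
      where
      0≤-x : 0# ≤ - x
      0≤-x = ≤-resp refl (+-identityˡ (- x)) (x≤y⇒0≤y-x x≤0)
    identity-sym : ∀ (i j : Fin size) → identity i j ≈ identity j i
    identity-sym i j with i Fin.≟ j
    ... | yes i≡j = reflexive (≡.sym (if-yes (j Fin.≟ i) (≡.sym i≡j)))
    ... | no  i≢j = reflexive (≡.sym (if-no (j Fin.≟ i) (i≢j ∘ ≡.sym)))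
    symmetric : ∀ i j → 𝓛 y i j ≈ 𝓛 y j i
    symmetric i j = +-cong (identity-sym i j) (-‿cong (*-congˡ (+-comm _ _)))

  -- At the 0-1 vector of `S` the order relation would give `α F ≤ W`, so `7 F ≤ α m F ≤ m W`,
  -- against the separation.
  separated⇒¬⪯ : ∀ {α m} S T i → 0# < α → fromℕ 7 ≤ α * fromℕ m →
    m ℕ.* weight (flips S) (T ∖ i) ℕ.< 7 ℕ.* flips S i → ¬ (α · 𝓛 i ⪯ ∑[ T ∖ i ] 𝓛)
  separated⇒¬⪯ {α} {m} S T i 0<α 7≤αm separated (_ , nonneg) = <⇒≱ (fromℕ-mono-< separated) (≤.trans
    (≤-resp (sym (fromℕ-* 7 F)) refl (*-monoˡ-≤ (0≤fromℕ F) 7≤αm))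
    (≤-resp (solve 3 (λ m a f → m :* (a :* f) := a :* m :* f) refl (fromℕ m) α (fromℕ F)) (sym (fromℕ-* m W))
      (*-monoʳ-≤ (0≤fromℕ m) αF≤W)))
    where
    v = bit ∘ S
    F = flips S i
    W = weight (flips S) (T ∖ i)
    αq≤q : α * quadraticForm (𝓛 i) v ≤ quadraticForm (∑[ T ∖ i ] 𝓛) v
    αq≤q = ≤-resp (+-identityˡ _)
      (trans (+-congˡ (sym (quadraticForm-· v α (𝓛 i)))) (quadraticForm-⊖ v (∑[ T ∖ i ] 𝓛) (α · 𝓛 i)))
      (+-mono-≤ (nonneg v) ≤.refl)
    αF≤W : α * fromℕ F ≤ fromℕ W
    αF≤W = ≤-resp
      (trans (solve 3 (λ t a q → t :* (a :* q) := a :* (t :* q)) refl (fromℕ 2) α (quadraticForm (𝓛 i) v))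
        (*-congˡ (quadraticForm-bit S i)))
      (quadraticForm-∑-bit S (T ∖ i))
      (*-monoʳ-≤ (0≤fromℕ 2) αq≤q)

-- The connectivity parameter and the minimum of its ratio to `α`.

module Connectivity (R : CompleteOrderedField) where

  import Algebra.Properties.CommutativeMonoid.Sum as Sum
  open import Data.Bool.Base using (if_then_else_)
  open import Data.Fin.Base using (Fin; zero; suc)
  import Data.Fin.Properties as Fin
  open import Data.Fin.Subset using (Subset; ∣_∣; _∈_) renaming (_-_ to _∖_)
  open import Data.Fin.Subset.Properties using (_∈?_; ∣p∣≤n)
  open import Data.Nat.Base as ℕ using (ℕ; zero; suc)
  import Data.Nat.Properties as ℕ
  open import Data.Product.Base using (∃; _×_; _,_; proj₁; proj₂)
  open import Data.Sum.Base using (_⊎_; inj₁; inj₂; [_,_]′)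
  open import Function.Base using (_∘_)
  open import Level using (0ℓ)
  open import Relation.Binary.Bundles using (StrictTotalOrder)
  import Relation.Binary.PropositionalEquality as ≡
  open import Relation.Nullary using (Dec; ¬_; does; yes; no; contradiction)
  open import Relation.Nullary.Decidable using (_×-dec_)
  open import Relation.Unary using (Pred; Decidable)

  open CompleteOrderedField R hiding (zero)
  open Analysis R
  open StrictTotalOrder strictTotalOrder using (_<?_)
  open Reals R
  open QuadraticForms R
  open Sum +-commutativeMonoid using (sum-cong-≋)

  leastBelow-≤ : ∀ {P : Pred ℕ 0ℓ} (P? : Decidable P) b {m} → P m → leastBelow P? b ℕ.≤ m
  leastBelow-≤ P? zero    p = ℕ.z≤n
  leastBelow-≤ P? (suc b) {m} p with P? 0
  ... | yes _ = ℕ.z≤n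
  leastBelow-≤ P? (suc b) {zero}  p | no ¬p₀ = contradiction p ¬p₀
  leastBelow-≤ P? (suc b) {suc m} p | no _   = ℕ.s≤s (leastBelow-≤ (P? ∘ suc) b p)

  leastBelow-satisfies : ∀ {P : Pred ℕ 0ℓ} (P? : Decidable P) b → P b → P (leastBelow P? b)
  leastBelow-satisfies P? zero    p = p
  leastBelow-satisfies P? (suc b) p with P? 0
  ... | yes p₀ = p₀
  ... | no  _  = leastBelow-satisfies (P? ∘ suc) b p

  -- A finite maximum started at 0, hence nonnegative and still strictly below `s`.
  boundBelow : ∀ {k} {Q : Pred (Fin k) 0ℓ} → Decidable Q → (t : Fin k → ℝ) → ∀ {s} → 0# < s →
    (∀ {i} → Q i → t i < s) → ∃ λ M → M < s × 0# ≤ M × (∀ i → Q i → t i ≤ M)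
  boundBelow {zero}  Q? t 0<s t<s = 0# , 0<s , ≤.refl , λ ()
  boundBelow {suc k} {Q} Q? t {s} 0<s t<s with boundBelow (Q? ∘ suc) (t ∘ suc) 0<s t<s | Q? zero
  ... | M , M<s , 0≤M , t≤M | no ¬q = M , M<s , 0≤M , λ where
    zero    q → contradiction q ¬q
    (suc i) q → t≤M i q
  ... | M , M<s , 0≤M , t≤M | yes q with ≤.total M (t zero)
  ...   | inj₁ M≤t₀ = t zero , t<s q , ≤.trans 0≤M M≤t₀ , λ where
    zero    _  → ≤.refl
    (suc i) q′ → ≤.trans (t≤M i q′) M≤t₀
  ...   | inj₂ t₀≤M = M , M<s , 0≤M , λ where
    zero    _  → t₀≤M
    (suc i) q′ → t≤M i q′

  module _ {k n : ℕ} (A : Fin k → Matrix n) where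

    -- Even the default `suc k` qualifies, vacuously: no subset has more than `k` elements.
    connected-connectivity : ∀ α → Connected α A (connectivity α A)
    connected-connectivity α = leastBelow-satisfies (Connected? α A) (suc k)
      λ T k<∣T∣ → contradiction (∣p∣≤n T) (ℕ.<⇒≱ k<∣T∣)

    connectivity-≤ : ∀ {α m} → Connected α A m → connectivity α A ℕ.≤ m
    connectivity-≤ {α} = leastBelow-≤ (Connected? α A) (suc k)

    connectivity-≤-suc : ∀ α → connectivity α A ℕ.≤ suc k
    connectivity-≤-suc α = connectivity-≤ λ T k<∣T∣ → contradiction (∣p∣≤n T) (ℕ.<⇒≱ k<∣T∣)

    connectivity-> : ∀ {α} T → (∀ {i} → i ∈ T → ¬ (α · A i ⪯ ∑[ T ∖ i ] A)) → ∣ T ∣ ℕ.< connectivity α A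
    connectivity-> {α} T separated = ℕ.≰⇒> λ ≤∣T∣ →
      let _ , i∈T , connected = connected-connectivity α T ≤∣T∣ in separated i∈T connected

    ratio : ℝ → ℝ
    ratio α = fromℕ (connectivity α A) / α

    module _ (A-PSD : ∀ j → PSD (A j)) where

      ∑-PSD : ∀ T → PSD (∑[ T ] A)
      ∑-PSD T = (λ x y → sum-cong-≋ (symmetric x y)) , λ v →
        ≤-resp refl (sym (quadraticForm-∑ v T A)) (∑-nonneg (nonneg v))
        where
        symmetric : ∀ x y j → (if does (j ∈? T) then A j x y else 0#) ≈ (if does (j ∈? T) then A j y x else 0#)
        symmetric x y j with j ∈? T
        ... | yes _ = proj₁ (A-PSD j) x y
        ... | no  _ = refl
        nonneg : ∀ v j → 0# ≤ (if does (j ∈? T) then quadraticForm (A j) v else 0#)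
        nonneg v j with j ∈? T
        ... | yes _ = proj₂ (A-PSD j) v
        ... | no  _ = ≤.refl

      ⪯⇒≤ : ∀ {α T i} → α · A i ⪯ ∑[ T ] A → ∀ v → α * quadraticForm (A i) v ≤ quadraticForm (∑[ T ] A) v
      ⪯⇒≤ {α} {T} {i} (_ , nonneg) v = ≤-resp (+-identityˡ _)
        (trans (+-congˡ (sym (quadraticForm-· v α (A i)))) (quadraticForm-⊖ v (∑[ T ] A) (α · A i)))
        (+-mono-≤ (nonneg v) ≤.refl)

      ≤⇒⪯ : ∀ {α T i} → (∀ v → α * quadraticForm (A i) v ≤ quadraticForm (∑[ T ] A) v) → α · A i ⪯ ∑[ T ] A
      ≤⇒⪯ {α} {T} {i} q≤q =
        (λ x y → +-cong (proj₁ (∑-PSD T) x y) (-‿cong (*-congˡ (proj₁ (A-PSD i) x y)))) ,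
        λ v → ≤-resp refl (difference v) (x≤y⇒0≤y-x (q≤q v))
        where
        difference : ∀ v → quadraticForm (∑[ T ] A) v - α * quadraticForm (A i) v ≈ quadraticForm (∑[ T ] A ⊖ α · A i) v
        difference v = +-cancelʳ (α * quadraticForm (A i) v) _ _ (trans
          (trans (+-comm _ _) (x+[y-x]≈y _ _))
          (sym (trans (+-congˡ (sym (quadraticForm-· v α (A i)))) (quadraticForm-⊖ v (∑[ T ] A) (α · A i)))))
          where open import Algebra.Properties.Group +-group using () renaming (∙-cancelʳ to +-cancelʳ)

      -- The supremum of the feasible α is feasible, every inequality between
      -- quadratic forms being closed in α.
      threshold : ∀ T i → ∃ λ s → ∀ {α} → 0# ≤ α → α ≤ 1# →
        (α · A i ⪯ ∑[ T ] A → α ≤ s) × (α ≤ s → α · A i ⪯ ∑[ T ] A)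
      threshold T i = s , λ {α} 0≤α α≤1 →
        (λ feasible → proj₁ (proj₂ lub) α (0≤α , α≤1 , feasible)) , attained {α} 0≤α
        where
        q r : (Fin n → ℝ) → ℝ
        q = quadraticForm (A i)
        r = quadraticForm (∑[ T ] A)
        S : Pred ℝ 0ℓ
        S α = 0# ≤ α × α ≤ 1# × α · A i ⪯ ∑[ T ] A
        0∈S : S 0#
        0∈S = ≤.refl , inj₁ 0<1 , ≤⇒⪯ {0#} {T} {i} λ v → ≤-resp (sym (zeroˡ (q v))) refl (proj₂ (∑-PSD T) v)
        bounded : IsUpperBound S 1#
        bounded α (_ , α≤1 , _) = α≤1
        lub : ∃ (IsLUB S)
        lub = completeness S (0# , 0∈S) (1# , bounded)
        s : ℝ
        s = proj₁ lub
        s≤r/q : ∀ v → 0# < q v → s ≤ r v / q v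
        s≤r/q v 0<q = proj₂ (proj₂ lub) (r v / q v) λ β (_ , _ , feasible) →
          x*y≤z⇒x≤z/y {β} {q v} {r v} 0<q (⪯⇒≤ {β} {T} {i} feasible v)
        attained : ∀ {α} → 0# ≤ α → α ≤ s → α · A i ⪯ ∑[ T ] A
        attained {α} 0≤α α≤s = ≤⇒⪯ {α} {T} {i} λ v → bound v (proj₂ (A-PSD i) v)
          where
          bound : ∀ v → 0# ≤ q v → α * q v ≤ r v
          bound v (inj₁ 0<q) = ≤-resp refl (x/y*y≈x (r v) 0<q)
            (*-monoˡ-≤ {q v} {α} {r v / q v} (inj₁ 0<q) (≤.trans α≤s (s≤r/q v 0<q)))
          bound v (inj₂ 0≈q) = ≤-resp (trans (sym (zeroʳ α)) (*-congˡ 0≈q)) refl (proj₂ (∑-PSD T) v)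

      Feasible : ℕ → Pred ℝ 0ℓ
      Feasible m α = 0# < α × α ≤ 1# × Connected α A m

      -- If for some `T` all thresholds of its elements were below `s`, the largest of these
      -- finitely many would bound every feasible parameter, although `s` lies below all such
      -- bounds.
      connected-limit : ∀ {m s} → 0# < s → s ≤ 1# →
        (∀ u → 0# ≤ u → (∀ {α} → Feasible m α → α ≤ u) → s ≤ u) → Connected s A m
      connected-limit {m} {s} 0<s s≤1 least T m≤∣T∣ =
        decide (Fin.any? (λ i → (i ∈? T) ×-dec PSD? (∑[ T ∖ i ] A ⊖ s · A i)))
        where
        t : Fin k → ℝ
        t i = proj₁ (threshold (T ∖ i) i)
        ⪯⇒≤t : ∀ {α} i → 0# ≤ α → α ≤ 1# → α · A i ⪯ ∑[ T ∖ i ] A → α ≤ t i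
        ⪯⇒≤t {α} i 0≤α α≤1 = proj₁ (proj₂ (threshold (T ∖ i) i) {α} 0≤α α≤1)
        ≤t⇒⪯ : ∀ i → s ≤ t i → s · A i ⪯ ∑[ T ∖ i ] A
        ≤t⇒⪯ i = proj₂ (proj₂ (threshold (T ∖ i) i) {s} (inj₁ 0<s) s≤1)
        refute : ¬ (∀ {i} → i ∈ T → t i < s)
        refute t<s = let M , M<s , 0≤M , t≤M = boundBelow (_∈? T) t 0<s t<s in
          <⇒≱ M<s (least M 0≤M λ {α} (0<α , α≤1 , connected) →
            let i , i∈T , feasible = connected T m≤∣T∣ in
            ≤.trans (⪯⇒≤t {α} i (inj₁ 0<α) α≤1 feasible) (t≤M i i∈T))
        decide : Dec (∃ λ i → i ∈ T × s · A i ⪯ ∑[ T ∖ i ] A) → ∃ λ i → i ∈ T × s · A i ⪯ ∑[ T ∖ i ] A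
        decide (yes found) = found
        decide (no none)   = contradiction
          (λ {i} i∈T → ≰⇒> λ s≤t → none (i , i∈T , ≤t⇒⪯ i s≤t)) refute

      -- Adjoining 0 makes the set nonempty. If its supremum is positive, `connected-limit` makes it
      -- feasible; otherwise nothing is.
      largestFeasible : ∀ m →
        (∃ λ s → Feasible m s × (∀ {α} → Feasible m α → α ≤ s)) ⊎ (∀ {α} → ¬ Feasible m α)
      largestFeasible m = decide (0# <? s)
        where
        S : Pred ℝ 0ℓ
        S α = α ≈ 0# ⊎ Feasible m α
        bounded : IsUpperBound S 1#
        bounded α (inj₁ α≈0)           = ≤.trans (inj₂ α≈0) (inj₁ 0<1)
        bounded α (inj₂ (_ , α≤1 , _)) = α≤1
        lub : ∃ (IsLUB S)
        lub = completeness S (0# , inj₁ refl) (1# , bounded)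
        s : ℝ
        s = proj₁ lub
        upper : ∀ {α} → Feasible m α → α ≤ s
        upper {α} feasible = proj₁ (proj₂ lub) α (inj₂ feasible)
        least : ∀ u → IsUpperBound S u → s ≤ u
        least = proj₂ (proj₂ lub)
        least⁺ : ∀ u → 0# ≤ u → (∀ {α} → Feasible m α → α ≤ u) → s ≤ u
        least⁺ u 0≤u ≤u = least u λ where
          α (inj₁ α≈0)      → ≤.trans (inj₂ α≈0) 0≤u
          α (inj₂ feasible) → ≤u feasible
        decide : Dec (0# < s) →
          (∃ λ s → Feasible m s × (∀ {α} → Feasible m α → α ≤ s)) ⊎ (∀ {α} → ¬ Feasible m α)
        decide (no  0≮s) = inj₂ λ {α} feasible → 0≮s (<-≤-trans (proj₁ feasible) (upper {α} feasible))
        decide (yes 0<s) = inj₁ (s , (0<s , s≤1 , connected-limit {m} {s} 0<s s≤1 least⁺) , λ {α} → upper {α})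
          where
          s≤1 = least 1# bounded

      -- Minimality restricted to parameters of small connectivity, so that the minimiser is found
      -- by induction on the finitely many values of the numerator.
      MinimalBelow : ℕ → ℝ → Set
      MinimalBelow M β = 0# < β × β ≤ 1# ×
        (∀ α → 0# < α → α ≤ 1# → connectivity α A ℕ.< M → ratio β ≤ ratio α)

      feasible : ∀ {M} α → 0# < α → α ≤ 1# → connectivity α A ≡.≡ M → Feasible M α
      feasible α 0<α α≤1 f≡M = 0<α , α≤1 , ≡.subst (Connected α A) f≡M (connected-connectivity α)

      -- At a fixed numerator the ratio falls as the parameter grows; at `s` the numerator is at
      -- most `M`.
      largest-minimal : ∀ {M s} → Feasible M s → (∀ {α} → Feasible M α → α ≤ s) →
        ∀ α → 0# < α → α ≤ 1# → connectivity α A ≡.≡ M → ratio s ≤ ratio α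
      largest-minimal {M} {s} (_ , _ , connected) largest α 0<α α≤1 f≡M =
        *-mono-≤ {fromℕ (connectivity s A)} {fromℕ (connectivity α A)} {s ⁻¹} {α ⁻¹}
          (0≤fromℕ (connectivity s A)) (inj₁ (⁻¹-pos 0<α))
          (fromℕ-mono-≤ (ℕ.≤-trans (connectivity-≤ {s} {M} connected) (ℕ.≤-reflexive (≡.sym f≡M))))
          (⁻¹-anti-≤ 0<α (largest {α} (feasible α 0<α α≤1 f≡M)))

      caseSuc : ∀ {M} {P : Set} α → connectivity α A ℕ.< suc M →
        (connectivity α A ℕ.< M → P) → (connectivity α A ≡.≡ M → P) → P
      caseSuc α f<1+M below at = [ below , at ]′ (ℕ.m≤n⇒m<n∨m≡n (ℕ.≤-pred f<1+M))

      minimalBelow-suc : ∀ {M β} → MinimalBelow M β →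
        (∃ λ s → Feasible M s × (∀ {α} → Feasible M α → α ≤ s)) ⊎ (∀ {α} → ¬ Feasible M α) →
        ∃ (MinimalBelow (suc M))
      minimalBelow-suc {M} {β} (0<β , β≤1 , minimal) (inj₂ infeasible) = β , 0<β , β≤1 , below
        where
        below : ∀ α → 0# < α → α ≤ 1# → connectivity α A ℕ.< suc M → ratio β ≤ ratio α
        below α 0<α α≤1 f<1+M = caseSuc α f<1+M (minimal α 0<α α≤1)
          λ f≡M → contradiction (feasible α 0<α α≤1 f≡M) (infeasible {α})
      minimalBelow-suc {M} {β} (0<β , β≤1 , minimal) (inj₁ (s , s-feasible@(0<s , s≤1 , _) , largest)) =
        choose (≤.total (ratio β) (ratio s))
        where
        below : ∀ {γ} → ratio γ ≤ ratio β → ratio γ ≤ ratio s →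
          ∀ α → 0# < α → α ≤ 1# → connectivity α A ℕ.< suc M → ratio γ ≤ ratio α
        below γ≤β γ≤s α 0<α α≤1 f<1+M = caseSuc α f<1+M
          (λ f<M → ≤.trans γ≤β (minimal α 0<α α≤1 f<M))
          (λ f≡M → ≤.trans γ≤s (largest-minimal {M} {s} s-feasible largest α 0<α α≤1 f≡M))
        choose : ratio β ≤ ratio s ⊎ ratio s ≤ ratio β → ∃ (MinimalBelow (suc M))
        choose (inj₁ β≤s) = β , 0<β , β≤1 , below {β} ≤.refl β≤s
        choose (inj₂ s≤β) = s , 0<s , s≤1 , below {s} s≤β ≤.refl

      minimalBelow : ∀ M → ∃ (MinimalBelow M)
      -- No connectivity is below 0, so the value 1 is arbitrary within the range.
      minimalBelow zero    = 1# , 0<1 , ≤.refl , λ _ _ _ ()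
      minimalBelow (suc M) = minimalBelow-suc (proj₂ (minimalBelow M)) (largestFeasible M)

      minimalRatio : ∃ λ β → 0# < β × β ≤ 1# × (∀ α → 0# < α → α ≤ 1# → ratio β ≤ ratio α)
      minimalRatio = let β , 0<β , β≤1 , minimal = minimalBelow (suc (suc k)) in
        β , 0<β , β≤1 , λ α 0<α α≤1 → minimal α 0<α α≤1 (ℕ.s≤s (connectivity-≤-suc α))

-- Choice of `m`, the constants, and the three bounds.

module LowerBound (R : CompleteOrderedField) where

  open import Algebra.Bundles using (module Group)
  import Algebra.Solver.Ring.NaturalCoefficients.Default as Solver
  import Data.Fin.Properties as Fin
  open import Data.Fin.Subset using (∣_∣; _∈_) renaming (_-_ to _∖_)
  open import Data.Nat.Base as ℕ using (ℕ; zero; suc)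
  import Data.Nat.Properties as ℕ
  open import Data.Product.Base using (∃; _×_; _,_; proj₁; proj₂)
  open import Data.Sum.Base using (inj₁)
  import Relation.Binary.PropositionalEquality as ≡
  open import Relation.Nullary using (contradiction)
  open FiniteGroup using (size; IsAbelian)

  open CompleteOrderedField R hiding (zero)
  open Analysis R
  open Cayley R
  open Reals R
  open Connectivity R
  open FiniteAbelianGroup using (least)
  open SeparatedSubset using (separatedSubset; weight)
  open Solver commutativeSemiring using (solve; _:=_; _:*_)

  private
    module Forms = CayleyForms R

  module _ {α : ℝ} (0<α : 0# < α) (α≤1 : α ≤ 1#) where

    private
      X = fromℕ 4 / α

      Xα≈4 : X * α ≈ fromℕ 4
      Xα≈4 = x/y*y≈x (fromℕ 4) 0<α

    4≤4/α : fromℕ 4 ≤ X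
    4≤4/α = x*y≤z⇒x≤z/y 0<α (≤-resp refl (*-identityʳ (fromℕ 4)) (*-monoʳ-≤ (0≤fromℕ 4) α≤1))

    1<4/α : 1# < X
    1<4/α = <-≤-trans (<-resp (+-identityʳ 1#) refl (fromℕ-mono-< {1} {4} (ℕ.s≤s ℕ.z<s))) 4≤4/α

    0<log[4/α] : 0# < log X
    0<log[4/α] = 0<log 1<4/α

    -- Multiplied by `α * α`, the left side is at most `2 * 8` and the right side is `4 * 4`.
    2m≤[4/α]² : ∀ m → α * fromℕ m ≤ fromℕ 8 → fromℕ (2 ℕ.* m) ≤ X ^ 2
    2m≤[4/α]² m αm≤8 = *-cancelʳ-≤ (*-pos 0<α 0<α) (≤-resp
      (sym (trans (*-congʳ (fromℕ-* 2 m))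
        (solve 3 (λ t m a → t :* m :* (a :* a) := t :* (a :* m) :* a) refl (fromℕ 2) (fromℕ m) α)))
      (trans (fromℕ-* 4 4) (trans (sym (*-cong Xα≈4 Xα≈4)) (trans
        (solve 2 (λ x a → x :* a :* (x :* a) := x :* x :* (a :* a)) refl X α)
        (*-congʳ (*-congˡ (sym (*-identityʳ X)))))))
      (≤.trans (*-monoʳ-≤ (*-nonneg (0≤fromℕ 2) (*-nonneg (inj₁ 0<α) (0≤fromℕ m))) α≤1)
        (≤-resp (sym (*-identityʳ _)) (sym (fromℕ-* 2 8)) (*-monoʳ-≤ (0≤fromℕ 2) αm≤8))))

    -- The least `m` with `7 ≤ α m`: its predecessor falls short of 7, and one step adds `α ≤ 1`.
    scale : ∀ n → fromℕ 7 ≤ α * fromℕ n → ∃ λ m → fromℕ 7 ≤ α * fromℕ m × α * fromℕ m ≤ fromℕ 8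
    scale n 7≤αn with least (λ m → fromℕ 7 ≤? (α * fromℕ m)) n 7≤αn
    ... | zero  , 7≤0  , _     = contradiction (≤-resp refl (zeroʳ α) 7≤0) (<⇒≱ (0<fromℕ-suc 6))
    ... | suc m , 7≤αm , below = suc m , 7≤αm ,
      ≤-resp (sym (trans (distribˡ α 1# (fromℕ m)) (+-congʳ (*-identityʳ α)))) refl
        (+-mono-≤ α≤1 (≮⇒≥ λ 7<αm → below m (ℕ.n<1+n m) (inj₁ 7<αm)))

    module _ (G : FiniteGroup) (abelian : IsAbelian G) where

      private
        N = size G
        f = connectivity α (𝓛 G)

        1≤N : 1# ≤ fromℕ N
        1≤N = 1≤fromℕ (ℕ.>-nonZero⁻¹ N {{Fin.nonZeroIndex (FiniteGroup.index G (Group.ε (FiniteGroup.group G)))}})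

      -- Of the factor 4, one 2 comes from the exponent `2 |T|` in the bound on `N`, the other from
      -- `2m ≤ (4/α)²`.
      log-size-≤-scale : ∀ m → fromℕ 7 ≤ α * fromℕ m → α * fromℕ m ≤ fromℕ 8 →
        log (fromℕ N) ≤ fromℕ (4 ℕ.* f) * log X
      log-size-≤-scale m 7≤αm αm≤8 = bound (separatedSubset (Forms.isAbelianGroup G abelian) 7≤m)
        where
        7≤m : 7 ℕ.≤ m
        7≤m = fromℕ-cancel-≤ (≤.trans 7≤αm (≤-resp refl (*-identityˡ (fromℕ m)) (*-monoˡ-≤ (0≤fromℕ m) α≤1)))
        flips = Forms.flips G abelian
        bound : (∃ λ T → N ℕ.≤ (2 ℕ.* m) ℕ.^ (2 ℕ.* ∣ T ∣) ×
            (∀ {i} → i ∈ T → ∃ λ S → m ℕ.* weight (flips S) (T ∖ i) ℕ.< 7 ℕ.* flips S i)) →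
          log (fromℕ N) ≤ fromℕ (4 ℕ.* f) * log X
        bound (T , N≤ , separated) = ≤.trans (log-mono 1≤N N≤X^) (≤.trans (log-^ (inj₁ 1<4/α) (2 ℕ.* (2 ℕ.* t)))
          (*-monoˡ-≤ (inj₁ 0<log[4/α]) (fromℕ-mono-≤ 4t≤4f)))
          where
          t = ∣ T ∣
          N≤X^ : fromℕ N ≤ X ^ (2 ℕ.* (2 ℕ.* t))
          N≤X^ = ≤.trans (fromℕ-mono-≤ N≤) (≤-resp (sym (fromℕ-^ (2 ℕ.* m) (2 ℕ.* t))) (^-assocʳ X 2 (2 ℕ.* t))
            (^-mono-≤ (0≤fromℕ (2 ℕ.* m)) (2m≤[4/α]² m αm≤8) (2 ℕ.* t)))
          t<f : t ℕ.< f
          t<f = connectivity-> (𝓛 G) {α} T λ {i} i∈T →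
            let S , dominates = separated i∈T in
            Forms.separated⇒¬⪯ G abelian {α} {m} S T i 0<α 7≤αm dominates
          4t≤4f : 2 ℕ.* (2 ℕ.* t) ℕ.≤ 4 ℕ.* f
          4t≤4f = ℕ.≤-trans (ℕ.≤-reflexive (≡.sym (ℕ.*-assoc 2 2 t))) (ℕ.*-monoʳ-≤ 4 (ℕ.<⇒≤ t<f))

      -- The Archimedean property is only available in contrapositive form, which
      -- suffices because ≤ is stable under double negation.
      log-size-≤ : log (fromℕ N) ≤ fromℕ (4 ℕ.* f) * log X
      log-size-≤ = ≮⇒≥ λ fails → archimedean (fromℕ 7 / α) λ n → ≮⇒≥ λ 7/α<n →
        let m , 7≤αm , αm≤8 = scale n (≤-resp (x/y*y≈x (fromℕ 7) 0<α) (*-comm (fromℕ n) α)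
              (*-monoˡ-≤ (inj₁ 0<α) (inj₁ 7/α<n)))
        in <⇒≱ fails (log-size-≤-scale m 7≤αm αm≤8)

      log-ratio-≤ : fromℕ 4 ⁻¹ * (log (fromℕ N) / log X) ≤ fromℕ f
      log-ratio-≤ = *-cancelˡ-≤ (0<fromℕ-suc 3) (≤-resp
        (trans (sym (*-identityˡ _)) (trans (*-congʳ (sym (⁻¹-inverseʳ (pos⇒≉0 (0<fromℕ-suc 3))))) (*-assoc _ _ _)))
        (fromℕ-* 4 f)
        (x≤z*y⇒x/y≤z 0<log[4/α] log-size-≤))

      -- 16 is `4 * 4`, the second factor coming from `α log (4/α) ≤ α (4/α) = 4`.
      log-size-≤-ratio : fromℕ 16 ⁻¹ * log (fromℕ N) ≤ fromℕ f / α
      log-size-≤-ratio = x*y≤z⇒x≤z/y 0<α (*-cancelˡ-≤ (0<fromℕ-suc 15) (≤-resp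
        (trans (sym (*-identityˡ _)) (trans (*-congʳ (sym (⁻¹-inverseʳ (pos⇒≉0 (0<fromℕ-suc 15)))))
          (solve 4 (λ s i l a → s :* i :* (l :* a) := s :* (i :* l :* a)) refl (fromℕ 16) (fromℕ 16 ⁻¹) (log (fromℕ N)) α)))
        (trans (*-congʳ (fromℕ-* 4 f)) (trans
          (solve 2 (λ s f → s :* f :* s := s :* s :* f) refl (fromℕ 4) (fromℕ f))
          (*-congʳ (sym (fromℕ-* 4 4)))))
        (≤.trans (*-monoˡ-≤ (inj₁ 0<α) log-size-≤)
          (≤-resp (sym (*-assoc (fromℕ (4 ℕ.* f)) (log X) α)) refl (*-monoʳ-≤ (0≤fromℕ (4 ℕ.* f)) αlogX≤4)))))
        where
        logX≤X : log X ≤ X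
        logX≤X = ≤.trans (log-≤ (inj₁ 1<4/α))
          (≤-resp (+-identityˡ _) (x+[y-x]≈y 1# X) (+-mono-≤ (inj₁ 0<1) ≤.refl))
        αlogX≤4 : log X * α ≤ fromℕ 4
        αlogX≤4 = ≤-resp refl Xα≈4 (*-monoˡ-≤ (inj₁ 0<α) logX≤X)

  private
    r = √ (fromℕ 7 / fromℕ 3) 0≤7/3
    0≤r : 0# ≤ r
    0≤r = proj₁ (proj₂ (√-exists (fromℕ 7 / fromℕ 3) 0≤7/3))
    r²*3≈7 : r * r * fromℕ 3 ≈ fromℕ 7
    r²*3≈7 = trans (*-congʳ (proj₂ (proj₂ (√-exists (fromℕ 7 / fromℕ 3) 0≤7/3)))) (x/y*y≈x (fromℕ 7) (0<fromℕ-suc 2))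

    -- `3 r² = 7` excludes `r ≤ 1` here and `r > 3` below, which places `α½ = (r - 1) / 2` in
    -- `(0 , 1]`.
    1<r : 1# < r
    1<r = ≰⇒> λ r≤1 → <⇒≱ (fromℕ-mono-< {3} {7} (ℕ.s≤s (ℕ.s≤s (ℕ.s≤s ℕ.z<s))))
      (≤-resp r²*3≈7 (trans (*-congʳ (*-identityˡ 1#)) (*-identityˡ (fromℕ 3)))
        (*-monoˡ-≤ (0≤fromℕ 3) (*-mono-≤ 0≤r (inj₁ 0<1) r≤1 r≤1)))

    r≤3 : r ≤ fromℕ 3
    r≤3 = ≮⇒≥ λ 3<r → <⇒≱ (fromℕ-mono-< {7} {27} (ℕ.m≤m+n 8 19))
      (≤-resp (trans (*-congʳ (sym (fromℕ-* 3 3))) (sym (fromℕ-* 9 3))) r²*3≈7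
        (*-monoˡ-≤ (0≤fromℕ 3) (*-mono-≤ (0≤fromℕ 3) 0≤r (inj₁ 3<r) (inj₁ 3<r))))

  0<α½ : 0# < α½
  0<α½ = *-pos (x<y⇒0<y-x 1<r) (⁻¹-pos (0<fromℕ-suc 1))

  α½≤1 : α½ ≤ 1#
  α½≤1 = x≤z*y⇒x/y≤z (0<fromℕ-suc 1) (≤-resp refl (sym (*-identityˡ (fromℕ 2)))
    (≤-resp (+-comm (- 1#) r) (trans (+-comm (- 1#) (fromℕ 3)) 3-1≈2) (+-monoʳ-≤ (- 1#) r≤3)))
    where
    3-1≈2 : fromℕ 3 - 1# ≈ fromℕ 2
    3-1≈2 = trans (+-congʳ (+-comm 1# (fromℕ 2))) (trans (+-assoc (fromℕ 2) 1# (- 1#))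
      (trans (+-congˡ (-‿inverseʳ 1#)) (+-identityʳ (fromℕ 2))))

  connectivity-bound : ∃ λ c → 0# < c × ((G : FiniteGroup) → IsAbelian G →
    ∀ α → 0# < α → α ≤ 1# → c * (log (fromℕ (size G)) / log (fromℕ 4 / α)) ≤ fromℕ (connectivity α (𝓛 G)))
  connectivity-bound = fromℕ 4 ⁻¹ , ⁻¹-pos (0<fromℕ-suc 3) ,
    λ G abelian α 0<α α≤1 → log-ratio-≤ 0<α α≤1 G abelian

  threshold-bound : ∃ λ c → 0# < c × ((G : FiniteGroup) → IsAbelian G →
    c * log (fromℕ (size G)) ≤ fromℕ (connectivityThreshold (𝓛 G)))
  threshold-bound = fromℕ 4 ⁻¹ * log (fromℕ 4 / α½) ⁻¹ ,
    *-pos (⁻¹-pos (0<fromℕ-suc 3)) (⁻¹-pos (0<log[4/α] 0<α½ α½≤1)) ,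
    λ G abelian → ≤-resp (trans (*-congˡ (*-comm _ _)) (sym (*-assoc _ _ _))) refl
      (log-ratio-≤ 0<α½ α½≤1 G abelian)

  minimum-bound : ∃ λ c → 0# < c × ((G : FiniteGroup) → IsAbelian G → ∃ λ m →
    IsMinimum (λ y → ∃ λ α → 0# < α × α ≤ 1# × y ≈ fromℕ (connectivity α (𝓛 G)) / α) m ×
    c * log (fromℕ (size G)) ≤ m)
  minimum-bound = fromℕ 16 ⁻¹ , ⁻¹-pos (0<fromℕ-suc 15) , λ G abelian →
    let β , 0<β , β≤1 , minimal = minimalRatio (𝓛 G) (Forms.𝓛-PSD G abelian) in
    ratio (𝓛 G) β ,
    ((_ , (β , 0<β , β≤1 , refl) , refl) ,
     λ y (α , 0<α , α≤1 , y≈) → ≤-resp refl (sym y≈) (minimal α 0<α α≤1)) ,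
    log-size-≤-ratio 0<β β≤1 G abelian

open FiniteGroup using (size; IsAbelian)

lemma4p6 : (R : CompleteOrderedField) →
    let open CompleteOrderedField R in
    let open Analysis R in
    let open Cayley R in
    (∃ λ c → 0# < c ×
    ((G : FiniteGroup) → IsAbelian G →
    ∀ α → 0# < α → α ≤ 1# →
    c * (log (fromℕ (size G)) / log (fromℕ 4 / α)) ≤ fromℕ (connectivity α (𝓛 G))))
    ×
    (∃ λ c → 0# < c ×
    ((G : FiniteGroup) → IsAbelian G →
    c * log (fromℕ (size G)) ≤ fromℕ (connectivityThreshold (𝓛 G))))
    ×
    (∃ λ c → 0# < c ×
    ((G : FiniteGroup) → IsAbelian G →
    ∃ λ m →
    IsMinimum (λ y → ∃ λ α → 0# < α × α ≤ 1# × y ≈ fromℕ (connectivity α (𝓛 G)) / α) m ×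
    c * log (fromℕ (size G)) ≤ m))
lemma4p6 R = connectivity-bound , threshold-bound , minimum-bound
  where open LowerBound R
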